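{- Let $p$ be an odd prime, and let $n$ be a positive integer with $2\mid n$ and $p-1\nmid n$. Then $$\frac{2\sum_{k=1}^n\binom{pn-1}{pk-1}(-1)^k}{(-p)^{\lfloor(n-2)/(p-1)\rfloor}p^{n+1}n}=\frac{F_p(pn,0)}{pn}\equiv\frac{n_*!}{n_*+1}B_{p-1-n_*}\pmod p.$$ Moreover, for any positive integers $b,m$ with $b>2\lfloor (pn-1)/(p-1)\rfloor$, $$\frac{2}{pn}\cdot\frac{(pn-1)!\,S(m\varphi(p^b),pn-1)}{(-p)^{\lfloor(pn-2)/(p-1)\rfloor}}\equiv-\frac{(pn-1)!\,S(m\varphi(p^b),pn)}{(-p)^{\lfloor(pn-1)/(p-1)\rfloor}}\equiv\frac{n_*!}{n_*+1}B_{p-1-n_*}\pmod p.$$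
   Context: For $n\in\mathbb{N}$, $r\in\mathbb{Z}$: $C_p(n,r)=\sum_{k\equiv r\,(\mathrm{mod}\ p)}\binom nk(-1)^k$ and $F_p(n,r)=(-p)^{ -\lfloor (n-1)/(p-1)\rfloor}C_p(n,r)+[\![n=0]\!]$ ($[\![A]\!]$ is $1$ if $A$ holds, else $0$). $n_*$ is the smallest positive residue of $n$ modulo $p-1$. $B_k$ are the Bernoulli numbers ($x/(e^x-1)=\sum_k B_kx^k/k!$). $S(m,n)$ is the Stirling number of the second kind (number of partitions of an $m$-set into $n$ nonempty blocks), and $\varphi$ is Euler's totient function. Congruences between rationals modulo $p$ mean the difference divided by $p$ is a $p$-adic integer. -}

module Defs where

open import Data.Nat as ℕ using (ℕ; zero; suc)
open import Data.Nat.Combinatorics using (_C_)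
open import Data.Nat.GCD using (gcd)
open import Data.Integer as ℤ using (ℤ; +_; -[1+_]; +[1+_])
open import Data.Integer.DivMod using (_/ℕ_)
import Data.Integer.Divisibility.Signed as ℤDiv
open import Data.Rational as ℚ using (ℚ; mkℚ; 0ℚ; 1ℚ; 1/_)
open import Data.Vec using (Vec; []; _∷_; lookup; last)
open import Data.Fin using (Fin; fromℕ<)
open import Data.Bool using (if_then_else_)
open import Relation.Nullary using (¬_)
open import Relation.Nullary.Decidable using (⌊_⌋)
open import Data.Nat.Divisibility using (_∣_)

Σℤ< : ℕ → (ℕ → ℤ) → ℤ
Σℤ< zero    f = + 0
Σℤ< (suc n) f = Σℤ< n f ℤ.+ f n

Σℚ< : ℕ → (ℕ → ℚ) → ℚ
Σℚ< zero    f = 0ℚ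
Σℚ< (suc n) f = Σℚ< n f ℚ.+ f n

sgn : ℕ → ℤ
sgn k = (ℤ.- (+ 1)) ℤ.^ k

ℕ→ℚ : ℕ → ℚ
ℕ→ℚ n = ((+ n) ℚ./ 1)

-- Total reciprocal (1/0 := 0); only ever applied to nonzero arguments
-- in the theorem (under its hypotheses).
inv : ℚ → ℚ
inv q@(mkℚ +[1+ n ] _ _) = 1/ q
inv q@(mkℚ -[1+ n ] _ _) = 1/ q
inv (mkℚ (+ zero) _ _)   = 0ℚ

_^ℚ_ : ℚ → ℕ → ℚ
q ^ℚ zero  = 1ℚ
q ^ℚ suc k = q ℚ.* (q ^ℚ k)

_^ℤ_ : ℚ → ℤ → ℚ
q ^ℤ (+ k)     = q ^ℚ k
q ^ℤ -[1+ k ]  = inv (q ^ℚ suc k)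

-- floor(a / d) for a positive divisor d (⌊a/0⌋ := 0, never used)
⌊_/_⌋ : ℤ → ℕ → ℤ
⌊ a / zero  ⌋ = + 0
⌊ a / suc d ⌋ = a /ℕ suc d

-- Congruence of rationals modulo p:
-- (a - b)/p is a p-adic integer, i.e. p does not divide the (reduced)
-- denominator of (a - b)/p.
_≡_[modℚ_] : ℚ → ℚ → ℕ → Set
a ≡ b [modℚ p ] = ¬ (p ∣ ℚ.denominatorℕ ((a ℚ.- b) ℚ.* inv (ℕ→ℚ p)))

Cp : ℕ → ℕ → ℤ → ℤ
Cp p n r = Σℤ< (suc n) λ k →
  if ⌊ (+ p) ℤDiv.∣? ((+ k) ℤ.- r) ⌋ then (+ (n C k)) ℤ.* sgn k else + 0

iverson0 : ℕ → ℚ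
iverson0 zero    = 1ℚ
iverson0 (suc _) = 0ℚ

Fp : ℕ → ℕ → ℤ → ℚ
Fp p n r =
  ((ℚ.- ℕ→ℚ p) ^ℤ (ℤ.- ⌊ (+ n) ℤ.- (+ 1) / p ℕ.∸ 1 ⌋)) ℚ.* ((Cp p n r) ℚ./ 1)
  ℚ.+ iverson0 n

-- n_* : smallest positive residue of n modulo p-1
nstar : ℕ → ℕ → ℕ
nstar p n with p ℕ.∸ 1
... | zero  = 0
... | suc d = suc (ℕ.pred n ℕ.% suc d)

-- Bernoulli numbers, x/(e^x-1) = Σ B_k x^k/k!  (so B_1 = -1/2):
-- B_0 = 1,  B_m = -1/(m+1) Σ_{k<m} binom(m+1,k) B_k.
bernVec : (n : ℕ) → Vec ℚ (suc n)
bernVec zero    = 1ℚ ∷ []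
bernVec (suc m) = next ∷ prev
  where
  prev : Vec ℚ (suc m)
  prev = bernVec m
  -- prev = B_m ∷ B_{m-1} ∷ … ∷ B_0 (most recent first)
  get : ℕ → ℚ
  get k with k ℕ.<? suc m
  ... | Relation.Nullary.yes k<  = lookup prev (fromℕ< (ℕ.s≤s (ℕ.m∸n≤m m k)))
    where import Data.Nat.Properties as ℕ
  ... | Relation.Nullary.no _ = 0ℚ
  M : ℕ
  M = suc m
  next : ℚ
  next = ℚ.- (inv (ℕ→ℚ (suc M)) ℚ.*
           Σℚ< M (λ k → ℕ→ℚ (suc M C k) ℚ.* get k))

bernoulli : ℕ → ℚ
bernoulli n = Data.Vec.head (bernVec n)
  where import Data.Vec

S : ℕ → ℕ → ℕ
S zero    zero    = 1
S zero    (suc k) = 0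
S (suc m) zero    = 0
S (suc m) (suc k) = suc k ℕ.* S m (suc k) ℕ.+ S m k

φ : ℕ → ℕ
φ n = go n
  where
  go : ℕ → ℕ
  go zero    = 0
  go (suc k) = go k ℕ.+ (if ⌊ gcd (suc k) n ℕ.≟ 1 ⌋ then 1 else 0)

-- For a polynomial f let T(f) be the sum of the coefficients of the x^k with p ∣ k. It depends only on f in
-- ℤ[x]/(x^p - 1), and C_p(N, 0) = T((x - 1)^N) for even N. In this ring (x - 1)^p = p (x - 1) u with
-- u ≡ -1 modulo (p, x - 1), so that (x - 1)^(pn) is p^⌊(pn-1)/(p-1)⌋ times, modulo p and up to sign, g^(n_*)
-- where g = (x - 1) u.
-- For a prime to p the substitution x ↦ x^a preserves T and multiplies x - 1 by A = 1 + ... + x^(a-1). Since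
-- A^p = a + p w, expanding A^(pn) yields (1 - a^n) C_p(pn, 0) ≡ p n a^(n-1) T((x - 1)^(pn) w) modulo one more
-- power of p than the right-hand side is divisible by, and a is chosen with a^(n_*) ≢ 1 modulo p.
-- Modulo p put x = e^z. Then T(f) ≡ f_0 - f_(p-1) in terms of the exponential coefficients, g ≡ -z, and
-- w is a logarithm of (e^(az) - 1)/(e^z - 1), whose derivative is a combination of β(az)/z and β(z)/z with
-- β(z) = z/(e^z - 1): the quotient is therefore given by the Bernoulli number of index p - 1 - n_*.
-- The Stirling numbers enter because k! S(M, k) is the coefficient of z^M/M! in (e^z - 1)^k, while 1 - i^M is
-- modulo p^b the indicator of p ∣ i when M is a positive multiple of φ(p^b).

module Submission where

open import Defs
open import Algebra.Bundles using (CommutativeRing)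
import Algebra.Properties.CommutativeSemiring.Binomial as Binomial
import Algebra.Properties.Monoid.Mult as Mult
import Algebra.Properties.Semiring.Sum as Sum
import Algebra.Solver.Ring as RingSolver
import Algebra.Solver.Ring.AlmostCommutativeRing as ACR
open import Data.Bool using (if_then_else_)
open import Data.Empty using (⊥-elim)
open import Data.Fin as Fin using (Fin; fromℕ<; toℕ)
import Data.Fin.Properties as Fin
open import Data.Integer as ℤ using (ℤ; +_; -[1+_]; +[1+_]; 0ℤ; 1ℤ)
import Data.Integer.Divisibility.Signed as ℤ∣
import Data.Integer.Properties as ℤ
open import Data.Integer.Tactic.RingSolver using () renaming (solve-∀ to ℤ-solve-∀)
open import Data.Maybe using (Maybe; just; nothing)
open import Data.Nat as ℕ using (ℕ; zero; suc; z≤n; s≤s; _!)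
open import Data.Nat.Combinatorics using (_C_; nCn≡1; nC1≡n; nCk≡nC[n∸k]; k>n⇒nCk≡0; nCk+nC[k+1]≡[n+1]C[k+1])
import Data.Nat.Coprimality as Coprimality
open import Data.Nat.Divisibility using (_∣_)
import Data.Nat.Divisibility as ℕ
import Data.Nat.DivMod as ℕ
open import Data.Nat.GCD using (gcd; gcd[m,n]∣m; gcd[m,n]∣n; gcd-greatest)
open import Data.Nat.Induction using (<-rec)
open import Data.Nat.Primality using (Prime; euclidsLemma; prime⇒irreducible; prime⇒nonTrivial)
import Data.Nat.Properties as ℕ
open import Data.Nat.Tactic.RingSolver using () renaming (solve-∀ to ℕ-solve-∀)
open import Data.Product using (Σ; _×_; _,_; proj₁; proj₂)
open import Data.Rational as ℚ using (ℚ; mkℚ; 0ℚ; 1ℚ; toℚᵘ)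
import Data.Rational.Properties as ℚ
open import Data.Rational.Unnormalised as ℚᵘ using (mkℚᵘ; *≡*)
import Data.Rational.Unnormalised.Properties as ℚᵘ
open import Data.Sum using (_⊎_; inj₁; inj₂; [_,_]′)
open import Data.Vec using (lookup)
open import Function using (_∘_)
open import Level using (0ℓ)
open import Relation.Binary.PropositionalEquality as ≡ using (_≡_; _≢_; cong; cong₂; subst; subst₂; module ≡-Reasoning)
open import Relation.Nullary using (Dec; yes; no; ¬_)
open import Relation.Nullary.Decidable using (⌊_⌋)

-- Modulo p the factor `g`^(n_*) alone has T = 0, so expanding (x - 1)^(pn) shows merely that
-- C_p(pn, 0) is divisible by more than p^⌊(pn-1)/(p-1)⌋, while the quotient by pn asks for v + 1
-- further powers of p if p^v is the exact power in n. The substitution x ↦ x^a supplies them at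
-- once: the deviation of A^(pn) from a^n carries the factor pn itself. The auxiliary a drops out.
-- With j = p - 1 - n_* the logarithm contributes a^n (a^j - 1) ≡ 1 - a^n, as p - 1 divides n + j,
-- and its denominator j turns into n_* + 1 ≡ -j. That some a has a^(n_*) ≢ 1 follows from the
-- vanishing of power sums, without a primitive root. Since n and p - 1 are even, so are n_* and j,
-- and both are at least 2: the indices 0 and 1, where B_1 and the linear term of the logarithmic
-- derivative would interfere, never occur. The factor 2 in the sums with pn - 1 comes from x ↦
-- x^(-1), which makes the two terms of T(x (x - 1)^(pn-1)) - T((x - 1)^(pn-1)) equal.

-- A power function that depends on the operations only, so that rings with the same
-- operations and different equalities share it.
power : {A : Set} → (A → A → A) → A → A → ℕ → A
power _∙_ e x zero    = e
power _∙_ e x (suc n) = x ∙ power _∙_ e x n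

-- Binomial coefficients

absorption : ∀ n k → suc k ℕ.* (suc n C suc k) ≡ suc n ℕ.* (n C k)
absorption zero    zero    = ≡.refl
absorption zero    (suc k) = ℕ.*-zeroʳ (suc (suc k))
absorption (suc n) zero    = begin
  1 ℕ.* (suc (suc n) C 1)  ≡⟨ cong (1 ℕ.*_) (nCk+nC[k+1]≡[n+1]C[k+1] (suc n) 0) ⟨
  1 ℕ.* (1 ℕ.+ (suc n C 1))  ≡⟨ ℕ.*-distribˡ-+ 1 1 _ ⟩
  1 ℕ.+ 1 ℕ.* (suc n C 1)  ≡⟨ cong suc (absorption n zero) ⟩
  1 ℕ.+ suc n ℕ.* 1  ≡⟨⟩
  suc (suc n) ℕ.* 1  ∎
  where open ≡-Reasoning
absorption (suc n) (suc k) = begin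
  suc (suc k) ℕ.* (suc (suc n) C suc (suc k))
    ≡⟨ cong (suc (suc k) ℕ.*_) (nCk+nC[k+1]≡[n+1]C[k+1] (suc n) (suc k)) ⟨
  suc (suc k) ℕ.* (c₁ ℕ.+ (suc n C suc (suc k)))
    ≡⟨ lemma (suc k) c₁ _ ⟩
  c₁ ℕ.+ suc k ℕ.* c₁ ℕ.+ suc (suc k) ℕ.* (suc n C suc (suc k))
    ≡⟨ cong₂ (λ a b → c₁ ℕ.+ a ℕ.+ b) (absorption n k) (absorption n (suc k)) ⟩
  c₁ ℕ.+ suc n ℕ.* (n C k) ℕ.+ suc n ℕ.* (n C suc k)
    ≡⟨ lemma′ (suc n) c₁ (n C k) (n C suc k) ⟩
  c₁ ℕ.+ suc n ℕ.* ((n C k) ℕ.+ (n C suc k))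
    ≡⟨ cong (λ a → c₁ ℕ.+ suc n ℕ.* a) (nCk+nC[k+1]≡[n+1]C[k+1] n k) ⟩
  suc (suc n) ℕ.* c₁ ∎
  where
  open ≡-Reasoning
  c₁ = suc n C suc k
  lemma : ∀ k a b → suc k ℕ.* (a ℕ.+ b) ≡ a ℕ.+ k ℕ.* a ℕ.+ suc k ℕ.* b
  lemma = ℕ-solve-∀
  lemma′ : ∀ n c a b → c ℕ.+ n ℕ.* a ℕ.+ n ℕ.* b ≡ c ℕ.+ n ℕ.* (a ℕ.+ b)
  lemma′ = ℕ-solve-∀

p∣pCk : ∀ {p} → Prime p → ∀ k → 0 ℕ.< k → k ℕ.< p → p ℕ.∣ p C k
p∣pCk {suc p} pr (suc k) _ k<p with euclidsLemma (suc k) (suc p C suc k) pr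
  (subst (suc p ℕ.∣_) (≡.sym (absorption p k)) (ℕ.divides (p C k) (ℕ.*-comm (suc p) (p C k))))
... | inj₁ p∣k = ⊥-elim (ℕ.<⇒≱ k<p (ℕ.∣⇒≤ p∣k))
... | inj₂ p∣c = p∣c

-- The binomial coefficient binom(m + 2, 2), by a recursion that runs along with the exponent in
-- `taylor₂`.
triangle : ℕ → ℕ
triangle zero    = 1
triangle (suc m) = triangle m ℕ.+ suc (suc m)

2triangle : ∀ m → triangle m ℕ.+ triangle m ≡ suc m ℕ.* suc (suc m)
2triangle zero    = ≡.refl
2triangle (suc m) = ≡.trans (lemma (triangle m) m) (≡.trans (cong (ℕ._+ (m ℕ.+ m ℕ.+ 4)) (2triangle m)) (lemma′ m))
  where
  lemma : ∀ t m → t ℕ.+ suc (suc m) ℕ.+ (t ℕ.+ suc (suc m)) ≡ t ℕ.+ t ℕ.+ (m ℕ.+ m ℕ.+ 4)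
  lemma = ℕ-solve-∀
  lemma′ : ∀ m → suc m ℕ.* suc (suc m) ℕ.+ (m ℕ.+ m ℕ.+ 4) ≡ suc (suc m) ℕ.* suc (suc (suc m))
  lemma′ = ℕ-solve-∀

-- Through this divisibility of binom(p, 2) by an odd p the quadratic terms in `PowerExpansion` gain
-- a factor p.
triangle≡ : ∀ m h → suc (suc m) ≡ suc (h ℕ.+ h) → triangle m ≡ suc (suc m) ℕ.* h
triangle≡ m h p≡1+2h = ℕ.*-cancelˡ-≡ (triangle m) (p ℕ.* h) 2 (begin
  2 ℕ.* triangle m  ≡⟨ cong (triangle m ℕ.+_) (ℕ.+-identityʳ _) ⟩
  triangle m ℕ.+ triangle m  ≡⟨ 2triangle m ⟩
  suc m ℕ.* p  ≡⟨ cong (ℕ._* p) (ℕ.suc-injective p≡1+2h) ⟩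
  (h ℕ.+ h) ℕ.* p  ≡⟨ lemma h p ⟩
  2 ℕ.* (p ℕ.* h)  ∎)
  where
  open ≡-Reasoning
  p = suc (suc m)
  lemma : ∀ h p → (h ℕ.+ h) ℕ.* p ≡ 2 ℕ.* (p ℕ.* h)
  lemma = ℕ-solve-∀

-- Commutative rings with their structure map from ℤ: its values serve as the
-- coefficients of the ring solver.
record ℤAlgebra : Set₁ where
  field
    commutativeRing : CommutativeRing 0ℓ 0ℓ
  open CommutativeRing commutativeRing public
  field
    ι     : ℤ → Carrier
    ι-+   : ∀ a b → ι (a ℤ.+ b) ≈ ι a + ι b
    ι-*   : ∀ a b → ι (a ℤ.* b) ≈ ι a * ι b
    ι-neg : ∀ a → ι (ℤ.- a) ≈ - ι a
    ι-0   : ι (+ 0) ≈ 0#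
    ι-1   : ι (+ 1) ≈ 1#

-- Powers and expansions in commutative rings

module Alg (S : ℤAlgebra) where
  open ℤAlgebra S
  open import Relation.Binary.Reasoning.Setoid setoid

  infixr 8 _^_
  _^_ : Carrier → ℕ → Carrier
  _^_ = power _*_ 1#

  acr : ACR.AlmostCommutativeRing 0ℓ 0ℓ
  acr = ACR.fromCommutativeRing commutativeRing

  ι-morphism : CommutativeRing.rawRing ℤ.+-*-commutativeRing ACR.-Raw-AlmostCommutative⟶ acr
  ι-morphism = record
    { ⟦_⟧ = ι ; +-homo = ι-+ ; *-homo = ι-* ; -‿homo = ι-neg ; 0-homo = ι-0 ; 1-homo = ι-1 }

  coeff≟ : ∀ a b → Maybe (ι a ≈ ι b)
  coeff≟ a b with a ℤ.≟ b
  ... | yes ≡.refl = just refl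
  ... | no _       = nothing

  open RingSolver _ acr ι-morphism coeff≟ public
    using (solve; _:=_; _:+_; _:*_; _:-_; :-_) renaming (con to κ)

  ≡⇒≈ : ∀ {x y} → x ≡ y → x ≈ y
  ≡⇒≈ ≡.refl = refl

  ^-cong : ∀ {x y} n → x ≈ y → x ^ n ≈ y ^ n
  ^-cong zero    eq = refl
  ^-cong (suc n) eq = *-cong eq (^-cong n eq)

  ^-homo-* : ∀ x m n → x ^ (m ℕ.+ n) ≈ x ^ m * x ^ n
  ^-homo-* x zero    n = sym (*-identityˡ _)
  ^-homo-* x (suc m) n = trans (*-congˡ (^-homo-* x m n)) (sym (*-assoc _ _ _))

  ^-assoc : ∀ x m n → x ^ (m ℕ.* n) ≈ (x ^ n) ^ m
  ^-assoc x zero    n = refl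
  ^-assoc x (suc m) n = trans (^-homo-* x n (m ℕ.* n)) (*-congˡ (^-assoc x m n))

  ^-distrib-* : ∀ x y n → (x * y) ^ n ≈ x ^ n * y ^ n
  ^-distrib-* x y zero    = sym (*-identityˡ _)
  ^-distrib-* x y (suc n) = trans (*-congˡ (^-distrib-* x y n))
    (solve 4 (λ x y a b → (x :* y) :* (a :* b) := (x :* a) :* (y :* b)) refl x y (x ^ n) (y ^ n))

  1^ : ∀ n → 1# ^ n ≈ 1#
  1^ zero    = refl
  1^ (suc n) = trans (*-identityˡ _) (1^ n)

  ι-^ : ∀ a n → ι (a ℤ.^ n) ≈ ι a ^ n
  ι-^ a zero    = ι-1
  ι-^ a (suc n) = trans (ι-* a _) (*-congˡ (ι-^ a n))

  module ×M = Mult +-monoid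
  open ×M using () renaming (_×_ to _·_)

  ·≈ι* : ∀ n x → n · x ≈ ι (+ n) * x
  ·≈ι* zero    x = sym (trans (*-congʳ ι-0) (zeroˡ x))
  ·≈ι* (suc n) x = begin
    x + n · x  ≈⟨ +-congˡ (·≈ι* n x) ⟩
    x + ι (+ n) * x  ≈⟨ solve 2 (λ x n → x :+ n :* x := (κ (+ 1) :+ n) :* x) refl x (ι (+ n)) ⟩
    (ι (+ 1) + ι (+ n)) * x  ≈⟨ *-congʳ (ι-+ (+ 1) (+ n)) ⟨
    ι (+ suc n) * x  ∎

  _∣′_ : ℤ → Carrier → Set
  m ∣′ x = Σ Carrier λ q → x ≈ ι m * q

  ∣′-+ : ∀ {m x y} → m ∣′ x → m ∣′ y → m ∣′ (x + y)
  ∣′-+ (q , e) (r , f) = q + r , trans (+-cong e f) (sym (distribˡ _ _ _))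

  ∣′-0 : ∀ {m} → m ∣′ 0#
  ∣′-0 = 0# , sym (zeroʳ _)

  open Sum semiring using (sum; sum-init-last)

  ∣′-sum : ∀ {m} n (f : Fin n → Carrier) → (∀ i → m ∣′ f i) → m ∣′ sum f
  ∣′-sum zero    f h = ∣′-0
  ∣′-sum (suc n) f h = ∣′-+ (h Fin.zero) (∣′-sum n (f ∘ Fin.suc) (h ∘ Fin.suc))

  -- The inner binomial coefficients are multiples of p. The cofactor is kept as a witness and not
  -- hidden in a congruence, because the polynomials `g` and `w` are made of such cofactors.
  freshman : ∀ {p} → Prime p → ∀ x y → Σ Carrier λ q → (x + y) ^ p ≈ (x ^ p + y ^ p) + ι (+ p) * q
  freshman {zero}        pr x y = ⊥-elim (ℕ.NonTrivial.nonTrivial (prime⇒nonTrivial pr))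
  freshman {suc zero}    pr x y = ⊥-elim (ℕ.NonTrivial.nonTrivial (prime⇒nonTrivial pr))
  freshman {suc (suc n)} pr x y = let q , e = middle in q , (begin
    (x + y) ^ p  ≈⟨ ^≈^ (x + y) p ⟩
    (x + y) ^ˢ p  ≈⟨ theorem p x y ⟩
    t Fin.zero + sum t′  ≈⟨ +-congˡ (sum-init-last t′) ⟩
    t Fin.zero + (sum (λ i → t′ (Fin.inject₁ i)) + t′ (Fin.fromℕ (suc n)))
      ≈⟨ +-cong first (+-cong e last′) ⟩
    y ^ p + (ι (+ p) * q + x ^ p)
      ≈⟨ solve 3 (λ a b c → a :+ (b :+ c) := (c :+ a) :+ b) refl (y ^ p) (ι (+ p) * q) (x ^ p) ⟩
    (x ^ p + y ^ p) + ι (+ p) * q  ∎)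
    where
    p = suc (suc n)
    open Binomial commutativeSemiring using (theorem; binomialTerm)
    open import Algebra.Properties.Semiring.Exp semiring using () renaming (_^_ to _^ˢ_)
    ^≈^ : ∀ x n → x ^ n ≈ x ^ˢ n
    ^≈^ x zero    = refl
    ^≈^ x (suc n) = *-congˡ (^≈^ x n)
    t = binomialTerm x y p
    t′ : Fin (suc (suc n)) → Carrier
    t′ i = t (Fin.suc i)
    first : t Fin.zero ≈ y ^ p
    first = trans (+-identityʳ _) (trans (*-identityˡ _) (sym (^≈^ y p)))
    last′ : t′ (Fin.fromℕ (suc n)) ≈ x ^ p
    last′ = begin
      (p C toℕ k) · (x ^ˢ toℕ k * y ^ˢ (p ℕ.∸ toℕ k))
        ≈⟨ ≡⇒≈ (cong (λ j → (p C j) · (x ^ˢ j * y ^ˢ (p ℕ.∸ j))) (cong suc (Fin.toℕ-fromℕ (suc n)))) ⟩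
      (p C p) · (x ^ˢ p * y ^ˢ (p ℕ.∸ p))
        ≈⟨ ≡⇒≈ (cong₂ (λ c j → c · (x ^ˢ p * y ^ˢ j)) (nCn≡1 p) (ℕ.n∸n≡0 p)) ⟩
      x ^ˢ p * 1# + 0#  ≈⟨ trans (+-identityʳ _) (*-identityʳ _) ⟩
      x ^ˢ p  ≈⟨ ^≈^ x p ⟨
      x ^ p  ∎
      where k = Fin.suc (Fin.fromℕ (suc n))
    middle : (+ p) ∣′ sum (λ i → t′ (Fin.inject₁ i))
    middle = ∣′-sum (suc n) _ λ i → term i
      where
      term : ∀ i → (+ p) ∣′ t′ (Fin.inject₁ i)
      term i with p∣pCk pr (suc (toℕ (Fin.inject₁ i))) (s≤s z≤n)
                    (s≤s (subst (ℕ._< suc n) (≡.sym (Fin.toℕ-inject₁ i)) (Fin.toℕ<n i)))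
      ... | ℕ.divides c eq = ι (+ c) * b , (begin
        (p C k) · b  ≈⟨ ·≈ι* (p C k) b ⟩
        ι (+ (p C k)) * b  ≈⟨ ≡⇒≈ (cong (λ z → ι z * b) (≡.trans (cong +_ (≡.trans eq (ℕ.*-comm c p))) (ℤ.pos-* p c))) ⟩
        ι (+ p ℤ.* + c) * b  ≈⟨ *-congʳ (ι-* _ _) ⟩
        (ι (+ p) * ι (+ c)) * b  ≈⟨ *-assoc _ _ _ ⟩
        ι (+ p) * (ι (+ c) * b)  ∎)
        where
        k = suc (toℕ (Fin.inject₁ i))
        b = x ^ˢ k * y ^ˢ (p ℕ.∸ k)

  -- When p divides h, a multiple of h³ may stay unspecified, but the first two coefficients have to
  -- be explicit: their divisibility by p decides the precision in `step`.
  taylor₂ : ∀ m x h → Σ Carrier λ r →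
    (x + h) ^ suc (suc m) ≈ x ^ suc (suc m) + ι (+ suc (suc m)) * (x ^ suc m * h)
      + ι (+ triangle m) * (x ^ m * (h * h)) + h * (h * h) * r
  taylor₂ zero x h = 0# , (begin
    (x + h) * ((x + h) * 1#)  ≈⟨ *-congˡ (*-identityʳ _) ⟩
    (x + h) * (x + h)
      ≈⟨ solve 3 (λ x h z → (x :+ h) :* (x :+ h) := x :* (x :* κ (+ 1)) :+ κ (+ 2) :* (x :* κ (+ 1) :* h)
            :+ κ (+ 1) :* (κ (+ 1) :* (h :* h)) :+ h :* (h :* h) :* κ (+ 0)) refl x h 0# ⟩
    x * (x * ι (+ 1)) + ι (+ 2) * (x * ι (+ 1) * h) + ι (+ 1) * (ι (+ 1) * (h * h)) + h * (h * h) * ι (+ 0)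
      ≈⟨ +-cong (+-cong (+-cong (*-congˡ (*-congˡ ι-1)) (*-congˡ (*-congʳ (*-congˡ ι-1)))) (*-congˡ (*-congʳ ι-1))) (*-congˡ ι-0) ⟩
    x * (x * 1#) + ι (+ 2) * (x * 1# * h) + ι (+ 1) * (1# * (h * h)) + h * (h * h) * 0# ∎)
  taylor₂ (suc m) x h = let r , e = taylor₂ m x h in
    x * r + h * r + ι (+ triangle m) * x ^ m , (begin
    (x + h) * (x + h) ^ suc (suc m) ≈⟨ *-congˡ e ⟩
    (x + h) * (x * (x * y) + n * ((x * y) * h) + c * (y * (h * h)) + h * (h * h) * r)
      ≈⟨ solve 6 (λ x h y r n c →
           (x :+ h) :* (x :* (x :* y) :+ n :* ((x :* y) :* h) :+ c :* (y :* (h :* h)) :+ h :* (h :* h) :* r)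
        := x :* (x :* (x :* y)) :+ (κ (+ 1) :+ n) :* ((x :* (x :* y)) :* h) :+ (c :+ n) :* ((x :* y) :* (h :* h))
             :+ h :* (h :* h) :* (x :* r :+ h :* r :+ c :* y)) refl x h y r n c ⟩
    x * (x * (x * y)) + (ι (+ 1) + n) * ((x * (x * y)) * h) + (c + n) * ((x * y) * (h * h))
             + h * (h * h) * (x * r + h * r + c * y)
      ≈⟨ +-congʳ (+-cong (+-congˡ (*-congʳ (ι-+ _ _))) (*-congʳ (ι-+ _ _))) ⟨
    x * (x * (x * y)) + ι (+ suc (suc (suc m))) * ((x * (x * y)) * h) + ι (+ triangle (suc m)) * ((x * y) * (h * h))
             + h * (h * h) * (x * r + h * r + c * y) ∎)
    where
    y = x ^ m
    n = ι (+ suc (suc m))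
    c = ι (+ triangle m)

ℤ-algebra : ℤAlgebra
ℤ-algebra = record
  { commutativeRing = ℤ.+-*-commutativeRing
  ; ι = λ a → a
  ; ι-+ = λ _ _ → ≡.refl ; ι-* = λ _ _ → ≡.refl ; ι-neg = λ _ → ≡.refl ; ι-0 = ≡.refl ; ι-1 = ≡.refl
  }

-- Congruences of integers

infix 4 _≅_[_]
record _≅_[_] (a b m : ℤ) : Set where
  constructor _,_
  field
    quotient : ℤ
    equality : a ≡ b ℤ.+ m ℤ.* quotient

-- The integers themselves with a coarser equality instead of residue classes, so that the same
-- terms serve for every modulus.
module Mod (m : ℤ) where
  infix 4 _≅_
  _≅_ : ℤ → ℤ → Set
  a ≅ b = a ≅ b [ m ]

  ≡⇒≅ : ∀ {a b} → a ≡ b → a ≅ b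
  ≡⇒≅ {a} ≡.refl = 0ℤ , lemma m a
    where
    lemma : ∀ m a → a ≡ a ℤ.+ m ℤ.* 0ℤ
    lemma = ℤ-solve-∀

  ≅-refl : ∀ {a} → a ≅ a
  ≅-refl = ≡⇒≅ ≡.refl

  ≅-sym : ∀ {a b} → a ≅ b → b ≅ a
  ≅-sym {b = b} (q , ≡.refl) = ℤ.- q , lemma m b q
    where
    lemma : ∀ m b q → b ≡ b ℤ.+ m ℤ.* q ℤ.+ m ℤ.* (ℤ.- q)
    lemma = ℤ-solve-∀

  ≅-trans : ∀ {a b c} → a ≅ b → b ≅ c → a ≅ c
  ≅-trans {c = c} (q , ≡.refl) (r , ≡.refl) = r ℤ.+ q , lemma m c q r
    where
    lemma : ∀ m b q r → b ℤ.+ m ℤ.* r ℤ.+ m ℤ.* q ≡ b ℤ.+ m ℤ.* (r ℤ.+ q)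
    lemma = ℤ-solve-∀

  +-cong : ∀ {a b c d} → a ≅ b → c ≅ d → a ℤ.+ c ≅ b ℤ.+ d
  +-cong {b = b} {d = d} (q , ≡.refl) (r , ≡.refl) = q ℤ.+ r , lemma m b d q r
    where
    lemma : ∀ m b d q r → b ℤ.+ m ℤ.* q ℤ.+ (d ℤ.+ m ℤ.* r) ≡ b ℤ.+ d ℤ.+ m ℤ.* (q ℤ.+ r)
    lemma = ℤ-solve-∀

  *-cong : ∀ {a b c d} → a ≅ b → c ≅ d → a ℤ.* c ≅ b ℤ.* d
  *-cong {b = b} {d = d} (q , ≡.refl) (r , ≡.refl) = _ , lemma m b d q r
    where
    lemma : ∀ m b d q r → (b ℤ.+ m ℤ.* q) ℤ.* (d ℤ.+ m ℤ.* r)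
      ≡ b ℤ.* d ℤ.+ m ℤ.* (q ℤ.* d ℤ.+ b ℤ.* r ℤ.+ m ℤ.* (q ℤ.* r))
    lemma = ℤ-solve-∀

  neg-cong : ∀ {a b} → a ≅ b → ℤ.- a ≅ ℤ.- b
  neg-cong {b = b} (q , ≡.refl) = ℤ.- q , lemma m b q
    where
    lemma : ∀ m b q → ℤ.- (b ℤ.+ m ℤ.* q) ≡ ℤ.- b ℤ.+ m ℤ.* (ℤ.- q)
    lemma = ℤ-solve-∀

  algebra : ℤAlgebra
  algebra = record
    { commutativeRing = record
      { Carrier = ℤ ; _≈_ = _≅_ ; _+_ = ℤ._+_ ; _*_ = ℤ._*_ ; -_ = ℤ.-_ ; 0# = 0ℤ ; 1# = 1ℤ
      ; isCommutativeRing = record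
        { isRing = record
          { +-isAbelianGroup = record
            { isGroup = record
              { isMonoid = record
                { isSemigroup = record
                  { isMagma = record
                    { isEquivalence = record { refl = ≅-refl ; sym = ≅-sym ; trans = ≅-trans }
                    ; ∙-cong = +-cong }
                  ; assoc = λ a b c → ≡⇒≅ (ℤ.+-assoc a b c) }
                ; identity = (λ a → ≡⇒≅ (ℤ.+-identityˡ a)) , (λ a → ≡⇒≅ (ℤ.+-identityʳ a)) }
              ; inverse = (λ a → ≡⇒≅ (ℤ.+-inverseˡ a)) , (λ a → ≡⇒≅ (ℤ.+-inverseʳ a))
              ; ⁻¹-cong = neg-cong }
            ; comm = λ a b → ≡⇒≅ (ℤ.+-comm a b) }
          ; *-cong = *-cong
          ; *-assoc = λ a b c → ≡⇒≅ (ℤ.*-assoc a b c)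
          ; *-identity = (λ a → ≡⇒≅ (ℤ.*-identityˡ a)) , (λ a → ≡⇒≅ (ℤ.*-identityʳ a))
          ; distrib = (λ a b c → ≡⇒≅ (ℤ.*-distribˡ-+ a b c)) , (λ a b c → ≡⇒≅ (ℤ.*-distribʳ-+ a b c)) }
        ; *-comm = λ a b → ≡⇒≅ (ℤ.*-comm a b) } }
    ; ι = λ a → a
    ; ι-+ = λ _ _ → ≅-refl ; ι-* = λ _ _ → ≅-refl ; ι-neg = λ _ → ≅-refl ; ι-0 = ≅-refl ; ι-1 = ≅-refl
    }

-- ℤ[x] acting on sequences, x being the shift.

data Poly : Set where
  con     : ℤ → Poly
  X       : Poly
  _⊞_ _⊠_ : Poly → Poly → Poly

infixl 6 _⊞_
infixl 7 _⊠_

Seq : Set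
Seq = ℕ → ℤ

act : Poly → Seq → Seq
act (con c) u i = c ℤ.* u i
act X       u i = u (suc i)
act (f ⊞ g) u i = act f u i ℤ.+ act g u i
act (f ⊠ g) u   = act f (act g u)

act-cong-mod : ∀ m f {u v} → (∀ i → u i ≅ v i [ m ]) → ∀ i → act f u i ≅ act f v i [ m ]
act-cong-mod m (con c) h i = Mod.*-cong m (Mod.≅-refl m {c}) (h i)
act-cong-mod m X       h i = h (suc i)
act-cong-mod m (f ⊞ g) h i = Mod.+-cong m (act-cong-mod m f h i) (act-cong-mod m g h i)
act-cong-mod m (f ⊠ g) h   = act-cong-mod m f (act-cong-mod m g h)

act-cong : ∀ f {u v} → (∀ i → u i ≡ v i) → ∀ i → act f u i ≡ act f v i
act-cong (con c) h i = cong (c ℤ.*_) (h i)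
act-cong X       h i = h (suc i)
act-cong (f ⊞ g) h i = cong₂ ℤ._+_ (act-cong f h i) (act-cong g h i)
act-cong (f ⊠ g) h   = act-cong f (act-cong g h)

act-+ : ∀ f u v i → act f (λ j → u j ℤ.+ v j) i ≡ act f u i ℤ.+ act f v i
act-+ (con c) u v i = ℤ.*-distribˡ-+ c (u i) (v i)
act-+ X       u v i = ≡.refl
act-+ (f ⊞ g) u v i = ≡.trans (cong₂ ℤ._+_ (act-+ f u v i) (act-+ g u v i))
  (lemma (act f u i) (act f v i) (act g u i) (act g v i))
  where
  lemma : ∀ a b c d → (a ℤ.+ b) ℤ.+ (c ℤ.+ d) ≡ (a ℤ.+ c) ℤ.+ (b ℤ.+ d)
  lemma = ℤ-solve-∀
act-+ (f ⊠ g) u v i = ≡.trans (act-cong f (act-+ g u v) i) (act-+ f (act g u) (act g v) i)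

act-* : ∀ f c u i → act f (λ j → c ℤ.* u j) i ≡ c ℤ.* act f u i
act-* (con d) c u i = lemma d c (u i)
  where
  lemma : ∀ d c u → d ℤ.* (c ℤ.* u) ≡ c ℤ.* (d ℤ.* u)
  lemma = ℤ-solve-∀
act-* X       c u i = ≡.refl
act-* (f ⊞ g) c u i = ≡.trans (cong₂ ℤ._+_ (act-* f c u i) (act-* g c u i)) (≡.sym (ℤ.*-distribˡ-+ c _ _))
act-* (f ⊠ g) c u i = ≡.trans (act-cong f (act-* g c u) i) (act-* f c (act g u) i)

act-shift : ∀ d f u i → act f (λ j → u (d ℕ.+ j)) i ≡ act f u (d ℕ.+ i)
act-shift d (con c) u i = ≡.refl
act-shift d X       u i = cong u (ℕ.+-suc d i)
act-shift d (f ⊞ g) u i = cong₂ ℤ._+_ (act-shift d f u i) (act-shift d g u i)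
act-shift d (f ⊠ g) u i = ≡.trans (act-cong f (act-shift d g u) i) (act-shift d f (act g u) i)

-- Every `act g` is linear and commutes with the shift, and all operators are generated by scalars
-- and the shift. Commutativity of the polynomial ring is thus a property of operators and requires
-- no normal form.
act-comm : ∀ f g u i → act f (act g u) i ≡ act g (act f u) i
act-comm (con c) g u i = ≡.sym (act-* g c u i)
act-comm X       g u i = ≡.sym (act-shift 1 g u i)
act-comm (f ⊞ h) g u i = ≡.trans (cong₂ ℤ._+_ (act-comm f g u i) (act-comm h g u i))
  (≡.sym (act-+ g (act f u) (act h u) i))
act-comm (f ⊠ h) g u i = ≡.trans (act-cong f (act-comm h g u) i) (act-comm f g (act h u) i)

Periodic : ℕ → Seq → Set
Periodic d u = ∀ i → u (d ℕ.+ i) ≡ u i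

act-periodic : ∀ {d} f {u} → Periodic d u → Periodic d (act f u)
act-periodic {d} f {u} per i = ≡.trans (≡.sym (act-shift d f u i)) (act-cong f per i)

-- ℤ[x]/(x^d - 1), since x^d - 1 annihilates exactly the d-periodic sequences; d = 0 gives ℤ[x].
module Cyclic (d : ℕ) where
  infix 4 _≈_
  record _≈_ (f g : Poly) : Set where
    constructor ⟪_⟫
    field
      on : ∀ u → Periodic d u → ∀ i → act f u i ≡ act g u i
  open _≈_ public

  algebra : ℤAlgebra
  algebra = record
    { commutativeRing = record
      { Carrier = Poly ; _≈_ = _≈_ ; _+_ = _⊞_ ; _*_ = _⊠_ ; -_ = con (ℤ.- 1ℤ) ⊠_ ; 0# = con 0ℤ ; 1# = con 1ℤ
      ; isCommutativeRing = record
        { isRing = record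
          { +-isAbelianGroup = record
            { isGroup = record
              { isMonoid = record
                { isSemigroup = record
                  { isMagma = record
                    { isEquivalence = record
                      { refl  = ⟪ (λ u _ i → ≡.refl) ⟫
                      ; sym   = λ e → ⟪ (λ u per i → ≡.sym (on e u per i)) ⟫
                      ; trans = λ e e′ → ⟪ (λ u per i → ≡.trans (on e u per i) (on e′ u per i)) ⟫ }
                    ; ∙-cong = λ e e′ → ⟪ (λ u per i → cong₂ ℤ._+_ (on e u per i) (on e′ u per i)) ⟫ }
                  ; assoc = λ f g h → ⟪ (λ u per i → ℤ.+-assoc (act f u i) (act g u i) (act h u i)) ⟫ }
                ; identity = (λ f → ⟪ (λ u per i → lemma₁ (u i) (act f u i)) ⟫) , (λ f → ⟪ (λ u per i → lemma₂ (u i) (act f u i)) ⟫) }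
              ; inverse = (λ f → ⟪ (λ u per i → lemma₃ (u i) (act f u i)) ⟫) , (λ f → ⟪ (λ u per i → lemma₄ (u i) (act f u i)) ⟫)
              ; ⁻¹-cong = λ e → ⟪ (λ u per i → cong (ℤ.- 1ℤ ℤ.*_) (on e u per i)) ⟫ }
            ; comm = λ f g → ⟪ (λ u per i → ℤ.+-comm (act f u i) (act g u i)) ⟫ }
          ; *-cong = λ {f} {f′} {g} {g′} e e′ → ⟪ (λ u per i →
              ≡.trans (act-cong f (on e′ u per) i) (on e (act g′ u) (act-periodic g′ per) i)) ⟫
          ; *-assoc = λ f g h → ⟪ (λ u per i → ≡.refl) ⟫
          ; *-identity = (λ f → ⟪ (λ u per i → ℤ.*-identityˡ (act f u i)) ⟫)
                       , (λ f → ⟪ (λ u per i → act-cong f (λ j → ℤ.*-identityˡ (u j)) i) ⟫)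
          ; distrib = (λ f g h → ⟪ (λ u per i → act-+ f (act g u) (act h u) i) ⟫) , (λ f g h → ⟪ (λ u per i → ≡.refl) ⟫) }
        ; *-comm = λ f g → ⟪ (λ u per i → act-comm f g u i) ⟫ } }
    ; ι = con
    ; ι-+ = λ a b → ⟪ (λ u per i → ℤ.*-distribʳ-+ (u i) a b) ⟫
    ; ι-* = λ a b → ⟪ (λ u per i → ℤ.*-assoc a b (u i)) ⟫
    ; ι-neg = λ a → ⟪ (λ u per i → lemma₅ a (u i)) ⟫
    ; ι-0 = ⟪ (λ u per i → ≡.refl) ⟫
    ; ι-1 = ⟪ (λ u per i → ≡.refl) ⟫
    }
    where
    lemma₁ : ∀ u a → 0ℤ ℤ.* u ℤ.+ a ≡ a
    lemma₁ = ℤ-solve-∀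
    lemma₂ : ∀ u a → a ℤ.+ 0ℤ ℤ.* u ≡ a
    lemma₂ = ℤ-solve-∀
    lemma₃ : ∀ u a → ℤ.- 1ℤ ℤ.* a ℤ.+ a ≡ 0ℤ ℤ.* u
    lemma₃ = ℤ-solve-∀
    lemma₄ : ∀ u a → a ℤ.+ ℤ.- 1ℤ ℤ.* a ≡ 0ℤ ℤ.* u
    lemma₄ = ℤ-solve-∀
    lemma₅ : ∀ a u → ℤ.- a ℤ.* u ≡ ℤ.- 1ℤ ℤ.* (a ℤ.* u)
    lemma₅ = ℤ-solve-∀

-- Exponential power series: u stands for Σ u_j z^j / j!, shift is d/dz and the product
-- is determined by the Leibniz rule.

shift : Seq → Seq
shift u j = u (suc j)

infixl 6 _⊕_
infixl 7 _⊛_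

_⊕_ : Seq → Seq → Seq
(u ⊕ v) j = u j ℤ.+ v j

_⊛_ : Seq → Seq → Seq
(u ⊛ v) zero    = u 0 ℤ.* v 0
(u ⊛ v) (suc j) = (shift u ⊛ v) j ℤ.+ (u ⊛ shift v) j

constant : ℤ → Seq
constant c zero    = c
constant c (suc j) = 0ℤ

⊛-cong-mod : ∀ m d {u u′ v v′} → (∀ j → j ℕ.< d → u j ≅ u′ j [ m ]) → (∀ j → j ℕ.< d → v j ≅ v′ j [ m ]) →
  ∀ j → j ℕ.< d → (u ⊛ v) j ≅ (u′ ⊛ v′) j [ m ]
⊛-cong-mod m d       e e′ zero    0<d = Mod.*-cong m (e 0 0<d) (e′ 0 0<d)
⊛-cong-mod m (suc d) e e′ (suc j) (s≤s j<d) = Mod.+-cong m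
  (⊛-cong-mod m d (λ i i<d → e (suc i) (s≤s i<d)) (λ i i<d → e′ i (ℕ.m<n⇒m<1+n i<d)) j j<d)
  (⊛-cong-mod m d (λ i i<d → e i (ℕ.m<n⇒m<1+n i<d)) (λ i i<d → e′ (suc i) (s≤s i<d)) j j<d)

⊛-cong : ∀ {u u′ v v′} → (∀ j → u j ≡ u′ j) → (∀ j → v j ≡ v′ j) → ∀ j → (u ⊛ v) j ≡ (u′ ⊛ v′) j
⊛-cong e e′ zero    = cong₂ ℤ._*_ (e 0) (e′ 0)
⊛-cong e e′ (suc j) = cong₂ ℤ._+_ (⊛-cong (e ∘ suc) e′ j) (⊛-cong e (e′ ∘ suc) j)

⊛-comm : ∀ u v j → (u ⊛ v) j ≡ (v ⊛ u) j
⊛-comm u v zero    = ℤ.*-comm (u 0) (v 0)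
⊛-comm u v (suc j) = ≡.trans (cong₂ ℤ._+_ (⊛-comm (shift u) v j) (⊛-comm u (shift v) j)) (ℤ.+-comm ((v ⊛ shift u) j) _)

⊛-distribˡ : ∀ u v w j → (u ⊛ (v ⊕ w)) j ≡ (u ⊛ v ⊕ u ⊛ w) j
⊛-distribˡ u v w zero    = ℤ.*-distribˡ-+ (u 0) (v 0) (w 0)
⊛-distribˡ u v w (suc j) = ≡.trans
  (cong₂ ℤ._+_ (⊛-distribˡ (shift u) v w j) (⊛-distribˡ u (shift v) (shift w) j))
  (lemma ((shift u ⊛ v) j) ((shift u ⊛ w) j) ((u ⊛ shift v) j) ((u ⊛ shift w) j))
  where
  lemma : ∀ a b c d → (a ℤ.+ b) ℤ.+ (c ℤ.+ d) ≡ (a ℤ.+ c) ℤ.+ (b ℤ.+ d)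
  lemma = ℤ-solve-∀

⊛-distribʳ : ∀ u v w j → ((v ⊕ w) ⊛ u) j ≡ (v ⊛ u ⊕ w ⊛ u) j
⊛-distribʳ u v w j = ≡.trans (⊛-comm (v ⊕ w) u j) (≡.trans (⊛-distribˡ u v w j)
  (cong₂ ℤ._+_ (⊛-comm u v j) (⊛-comm u w j)))

⊛-assoc : ∀ u v w j → (u ⊛ v ⊛ w) j ≡ (u ⊛ (v ⊛ w)) j
⊛-assoc u v w zero    = ℤ.*-assoc (u 0) (v 0) (w 0)
⊛-assoc u v w (suc j) = begin
  ((shift u ⊛ v ⊕ u ⊛ shift v) ⊛ w) j ℤ.+ (u ⊛ v ⊛ shift w) j
    ≡⟨ cong₂ ℤ._+_ (⊛-distribʳ w (shift u ⊛ v) (u ⊛ shift v) j) ≡.refl ⟩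
  (shift u ⊛ v ⊛ w) j ℤ.+ (u ⊛ shift v ⊛ w) j ℤ.+ (u ⊛ v ⊛ shift w) j
    ≡⟨ cong₂ ℤ._+_ (cong₂ ℤ._+_ (⊛-assoc (shift u) v w j) (⊛-assoc u (shift v) w j)) (⊛-assoc u v (shift w) j) ⟩
  (shift u ⊛ (v ⊛ w)) j ℤ.+ (u ⊛ (shift v ⊛ w)) j ℤ.+ (u ⊛ (v ⊛ shift w)) j
    ≡⟨ ℤ.+-assoc ((shift u ⊛ (v ⊛ w)) j) _ _ ⟩
  (shift u ⊛ (v ⊛ w)) j ℤ.+ ((u ⊛ (shift v ⊛ w)) j ℤ.+ (u ⊛ (v ⊛ shift w)) j)
    ≡⟨ cong (λ a → (shift u ⊛ (v ⊛ w)) j ℤ.+ a) (⊛-distribˡ u (shift v ⊛ w) (v ⊛ shift w) j) ⟨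
  (shift u ⊛ (v ⊛ w)) j ℤ.+ (u ⊛ (shift v ⊛ w ⊕ v ⊛ shift w)) j ∎
  where open ≡-Reasoning

⊛-zeroˡ : ∀ u → ∀ {v} → (∀ j → v j ≡ 0ℤ) → ∀ j → (v ⊛ u) j ≡ 0ℤ
⊛-zeroˡ u h zero    = cong (ℤ._* u 0) (h 0)
⊛-zeroˡ u h (suc j) = cong₂ ℤ._+_ (⊛-zeroˡ u (h ∘ suc) j) (⊛-zeroˡ (shift u) h j)

⊛-constant : ∀ c u j → (constant c ⊛ u) j ≡ c ℤ.* u j
⊛-constant c u zero    = ≡.refl
⊛-constant c u (suc j) = ≡.trans (cong₂ ℤ._+_ (⊛-zeroˡ u (λ _ → ≡.refl) j) (⊛-constant c (shift u) j))
  (ℤ.+-identityˡ _)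

-- Coefficients from `d` on are ignored. For `d` = p this permits division by z, which costs factors
-- below p, and the congruence `E-g`, which comes from the vanishing of (e^z - 1)^p below z^p.
module Hurwitz (m : ℤ) (d : ℕ) where
  open Mod m using (≡⇒≅; ≅-refl; ≅-sym; ≅-trans)
  infix 4 _≈_
  record _≈_ (u v : Seq) : Set where
    constructor ⟪_⟫
    field
      at : ∀ j → j ℕ.< d → u j ≅ v j [ m ]
  open _≈_ public

  ≡⇒≈ : ∀ {u v} → (∀ j → u j ≡ v j) → u ≈ v
  ≡⇒≈ e = ⟪ (λ j _ → ≡⇒≅ (e j)) ⟫

  algebra : ℤAlgebra
  algebra = record
    { commutativeRing = record
      { Carrier = Seq ; _≈_ = _≈_ ; _+_ = _⊕_ ; _*_ = _⊛_ ; -_ = λ u j → ℤ.- u j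
      ; 0# = constant 0ℤ ; 1# = constant 1ℤ
      ; isCommutativeRing = record
        { isRing = record
          { +-isAbelianGroup = record
            { isGroup = record
              { isMonoid = record
                { isSemigroup = record
                  { isMagma = record
                    { isEquivalence = record
                      { refl  = ⟪ (λ j _ → ≅-refl) ⟫
                      ; sym   = λ e → ⟪ (λ j j<d → ≅-sym (at e j j<d)) ⟫
                      ; trans = λ e e′ → ⟪ (λ j j<d → ≅-trans (at e j j<d) (at e′ j j<d)) ⟫ }
                    ; ∙-cong = λ e e′ → ⟪ (λ j j<d → Mod.+-cong m (at e j j<d) (at e′ j j<d)) ⟫ }
                  ; assoc = λ u v w → ≡⇒≈ λ j → ℤ.+-assoc (u j) (v j) (w j) }
                ; identity = (λ u → ≡⇒≈ λ j → ≡.trans (cong (ℤ._+ u j) (zeros j)) (ℤ.+-identityˡ (u j)))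
                           , (λ u → ≡⇒≈ λ j → ≡.trans (cong (λ a → u j ℤ.+ a) (zeros j)) (ℤ.+-identityʳ (u j))) }
              ; inverse = (λ u → ≡⇒≈ λ j → ≡.trans (ℤ.+-inverseˡ (u j)) (≡.sym (zeros j)))
                        , (λ u → ≡⇒≈ λ j → ≡.trans (ℤ.+-inverseʳ (u j)) (≡.sym (zeros j)))
              ; ⁻¹-cong = λ e → ⟪ (λ j j<d → Mod.neg-cong m (at e j j<d)) ⟫ }
            ; comm = λ u v → ≡⇒≈ λ j → ℤ.+-comm (u j) (v j) }
          ; *-cong = λ e e′ → ⟪ ⊛-cong-mod m d (at e) (at e′) ⟫
          ; *-assoc = λ u v w → ≡⇒≈ (⊛-assoc u v w)
          ; *-identity = (λ u → ≡⇒≈ (one u)) , (λ u → ≡⇒≈ λ j → ≡.trans (⊛-comm u (constant 1ℤ) j) (one u j))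
          ; distrib = (λ u v w → ≡⇒≈ (⊛-distribˡ u v w)) , (λ u v w → ≡⇒≈ (⊛-distribʳ u v w)) }
        ; *-comm = λ u v → ≡⇒≈ (⊛-comm u v) } }
    ; ι = constant
    ; ι-+ = λ a b → ≡⇒≈ λ { zero → ≡.refl ; (suc j) → ≡.refl }
    ; ι-* = λ a b → ≡⇒≈ λ j → ≡.trans (scalar a b j) (≡.sym (⊛-constant a (constant b) j))
    ; ι-neg = λ a → ≡⇒≈ λ { zero → ≡.refl ; (suc j) → ≡.refl }
    ; ι-0 = ⟪ (λ j _ → ≅-refl) ⟫
    ; ι-1 = ⟪ (λ j _ → ≅-refl) ⟫
    }
    where
    zeros : ∀ j → constant 0ℤ j ≡ 0ℤ
    zeros zero    = ≡.refl
    zeros (suc j) = ≡.refl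
    one : ∀ u j → (constant 1ℤ ⊛ u) j ≡ u j
    one u j = ≡.trans (⊛-constant 1ℤ u j) (ℤ.*-identityˡ (u j))
    scalar : ∀ a b j → constant (a ℤ.* b) j ≡ a ℤ.* constant b j
    scalar a b zero    = ≡.refl
    scalar a b (suc j) = ≡.sym (ℤ.*-zeroʳ a)

-- Polynomials evaluated at e^z

infixr 8 _^ᵖ_ _^ˢ_
_^ᵖ_ : Poly → ℕ → Poly
_^ᵖ_ = power _⊠_ (con 1ℤ)

_^ˢ_ : Seq → ℕ → Seq
_^ˢ_ = power _⊛_ (constant 1ℤ)

-- The series e^(cz); `scale` below substitutes cz for z.
expo : ℤ → Seq
expo c j = c ℤ.^ j

scale : ℤ → Seq → Seq
scale c u j = c ℤ.^ j ℤ.* u j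

⊛-scalarˡ : ∀ c u v j → ((λ i → c ℤ.* u i) ⊛ v) j ≡ c ℤ.* (u ⊛ v) j
⊛-scalarˡ c u v zero    = ℤ.*-assoc c _ _
⊛-scalarˡ c u v (suc j) = ≡.trans (cong₂ ℤ._+_ (⊛-scalarˡ c (shift u) v j) (⊛-scalarˡ c u (shift v) j))
  (≡.sym (ℤ.*-distribˡ-+ c _ _))

⊛-scalarʳ : ∀ c u v j → (u ⊛ (λ i → c ℤ.* v i)) j ≡ c ℤ.* (u ⊛ v) j
⊛-scalarʳ c u v j = ≡.trans (⊛-comm u _ j) (≡.trans (⊛-scalarˡ c v u j) (cong (c ℤ.*_) (⊛-comm v u j)))

expo-⊛ : ∀ a b j → (expo a ⊛ expo b) j ≡ expo (a ℤ.+ b) j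
expo-⊛ a b zero    = ≡.refl
expo-⊛ a b (suc j) = begin
  (shift (expo a) ⊛ expo b) j ℤ.+ (expo a ⊛ shift (expo b)) j
    ≡⟨ cong₂ ℤ._+_ (⊛-scalarˡ a (expo a) (expo b) j) (⊛-scalarʳ b (expo a) (expo b) j) ⟩
  a ℤ.* (expo a ⊛ expo b) j ℤ.+ b ℤ.* (expo a ⊛ expo b) j  ≡⟨ ℤ.*-distribʳ-+ _ a b ⟨
  (a ℤ.+ b) ℤ.* (expo a ⊛ expo b) j  ≡⟨ cong ((a ℤ.+ b) ℤ.*_) (expo-⊛ a b j) ⟩
  (a ℤ.+ b) ℤ.* expo (a ℤ.+ b) j  ∎
  where open ≡-Reasoning

scale-⊛ : ∀ c u v j → scale c (u ⊛ v) j ≡ (scale c u ⊛ scale c v) j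
scale-⊛ c u v zero    = lemma (u 0) (v 0)
  where
  lemma : ∀ a b → 1ℤ ℤ.* (a ℤ.* b) ≡ 1ℤ ℤ.* a ℤ.* (1ℤ ℤ.* b)
  lemma = ℤ-solve-∀
scale-⊛ c u v (suc j) = begin
  c ℤ.* c ℤ.^ j ℤ.* (a ℤ.+ b)  ≡⟨ lemma c (c ℤ.^ j) a b ⟩
  c ℤ.* (c ℤ.^ j ℤ.* a) ℤ.+ c ℤ.* (c ℤ.^ j ℤ.* b)
    ≡⟨ cong₂ (λ x y → c ℤ.* x ℤ.+ c ℤ.* y) (scale-⊛ c (shift u) v j) (scale-⊛ c u (shift v) j) ⟩
  c ℤ.* (scale c (shift u) ⊛ scale c v) j ℤ.+ c ℤ.* (scale c u ⊛ scale c (shift v)) j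
    ≡⟨ cong₂ ℤ._+_ (⊛-scalarˡ c (scale c (shift u)) (scale c v) j) (⊛-scalarʳ c (scale c u) (scale c (shift v)) j) ⟨
  ((λ i → c ℤ.* scale c (shift u) i) ⊛ scale c v) j ℤ.+ (scale c u ⊛ (λ i → c ℤ.* scale c (shift v) i)) j
    ≡⟨ cong₂ ℤ._+_ (⊛-cong (λ i → ≡.sym (ℤ.*-assoc c _ (u (suc i)))) (λ _ → ≡.refl) j)
                   (⊛-cong {u = scale c u} (λ _ → ≡.refl) (λ i → ≡.sym (ℤ.*-assoc c _ (v (suc i)))) j) ⟩
  (scale c u ⊛ scale c v) (suc j) ∎
  where
  open ≡-Reasoning
  a = (shift u ⊛ v) j
  b = (u ⊛ shift v) j
  lemma : ∀ c d a b → c ℤ.* d ℤ.* (a ℤ.+ b) ≡ c ℤ.* (d ℤ.* a) ℤ.+ c ℤ.* (d ℤ.* b)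
  lemma = ℤ-solve-∀

-- E f is f(e^z), so E f j = Σ f_k k^j is the j-th moment of the coefficients of f.
E : Poly → Seq
E (con c) = constant c
E X       = expo 1ℤ
E (f ⊞ g) = E f ⊕ E g
E (f ⊠ g) = E f ⊛ E g

E-^ : ∀ f n → E (f ^ᵖ n) ≡ E f ^ˢ n
E-^ f zero    = ≡.refl
E-^ f (suc n) = cong (E f ⊛_) (E-^ f n)

-- The step from i to i + 1 multiplies e^(iz) by e^z, so on these sequences f acts as multiplication
-- by f(e^z). The factor `v` is carried along for the sake of products, where it absorbs `E g`.
act-⊛-expo : ∀ f v i j → act f (λ i → (v ⊛ expo (+ i)) j) i ≡ (v ⊛ E f ⊛ expo (+ i)) j
act-⊛-expo (con c) v i j = begin
  c ℤ.* (v ⊛ expo (+ i)) j  ≡⟨ ⊛-constant c _ j ⟨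
  (constant c ⊛ (v ⊛ expo (+ i))) j  ≡⟨ ⊛-assoc (constant c) v _ j ⟨
  (constant c ⊛ v ⊛ expo (+ i)) j  ≡⟨ ⊛-cong (⊛-comm (constant c) v) (λ _ → ≡.refl) j ⟩
  (v ⊛ constant c ⊛ expo (+ i)) j  ∎
  where open ≡-Reasoning
act-⊛-expo X v i j = ≡.trans
  (⊛-cong {u = v} (λ _ → ≡.refl) (λ l → ≡.sym (expo-⊛ 1ℤ (+ i) l)) j)
  (≡.sym (⊛-assoc v (expo 1ℤ) (expo (+ i)) j))
act-⊛-expo (f ⊞ g) v i j = begin
  act f w i ℤ.+ act g w i  ≡⟨ cong₂ ℤ._+_ (act-⊛-expo f v i j) (act-⊛-expo g v i j) ⟩
  (v ⊛ E f ⊛ expo (+ i)) j ℤ.+ (v ⊛ E g ⊛ expo (+ i)) j  ≡⟨ ⊛-distribʳ (expo (+ i)) (v ⊛ E f) (v ⊛ E g) j ⟨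
  ((v ⊛ E f ⊕ v ⊛ E g) ⊛ expo (+ i)) j  ≡⟨ ⊛-cong (⊛-distribˡ v (E f) (E g)) (λ _ → ≡.refl) j ⟨
  (v ⊛ (E f ⊕ E g) ⊛ expo (+ i)) j  ∎
  where
  open ≡-Reasoning
  w : Seq
  w i = (v ⊛ expo (+ i)) j
act-⊛-expo (f ⊠ g) v i j = begin
  act f (act g (λ i → (v ⊛ expo (+ i)) j)) i  ≡⟨ act-cong f (λ i → act-⊛-expo g v i j) i ⟩
  act f (λ i → (v ⊛ E g ⊛ expo (+ i)) j) i  ≡⟨ act-⊛-expo f (v ⊛ E g) i j ⟩
  (v ⊛ E g ⊛ E f ⊛ expo (+ i)) j  ≡⟨ ⊛-cong swap (λ _ → ≡.refl) j ⟩
  (v ⊛ (E f ⊛ E g) ⊛ expo (+ i)) j  ∎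
  where
  open ≡-Reasoning
  swap : ∀ l → (v ⊛ E g ⊛ E f) l ≡ (v ⊛ (E f ⊛ E g)) l
  swap l = ≡.trans (⊛-assoc v (E g) (E f) l) (⊛-cong {u = v} (λ _ → ≡.refl) (⊛-comm (E g) (E f)) l)

-- The power i^j is the coefficient of index j in e^(iz), so `act-⊛-expo` applies with v = 1 at i =
-- 0.
moment : ∀ f j → act f (λ i → (+ i) ℤ.^ j) 0 ≡ E f j
moment f j = begin
  act f (λ i → expo (+ i) j) 0  ≡⟨ act-cong f (λ i → one (expo (+ i)) j) 0 ⟨
  act f (λ i → (constant 1ℤ ⊛ expo (+ i)) j) 0 ≡⟨ act-⊛-expo f (constant 1ℤ) 0 j ⟩
  (constant 1ℤ ⊛ E f ⊛ expo 0ℤ) j  ≡⟨ ⊛-cong (one (E f)) expo-0 j ⟩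
  (E f ⊛ constant 1ℤ) j  ≡⟨ ⊛-comm (E f) _ j ⟩
  (constant 1ℤ ⊛ E f) j  ≡⟨ one (E f) j ⟩
  E f j  ∎
  where
  open ≡-Reasoning
  one : ∀ u j → (constant 1ℤ ⊛ u) j ≡ u j
  one u j = ≡.trans (⊛-constant 1ℤ u j) (ℤ.*-identityˡ (u j))
  expo-0 : ∀ j → expo 0ℤ j ≡ constant 1ℤ j
  expo-0 zero    = ≡.refl
  expo-0 (suc j) = ≡.refl

-- `E` is defined on expressions. It respects equality of polynomials because each moment is an
-- action on a sequence, and period 0 admits every sequence.
E-cong : ∀ {f g} → Cyclic._≈_ 0 f g → ∀ j → E f j ≡ E g j
E-cong {f} {g} e j = ≡.trans (≡.sym (moment f j)) (≡.trans (Cyclic.on e _ (λ _ → ≡.refl) 0) (moment g j))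

sub : ℕ → Poly → Poly
sub a (con c) = con c
sub a X       = X ^ᵖ a
sub a (f ⊞ g) = sub a f ⊞ sub a g
sub a (f ⊠ g) = sub a f ⊠ sub a g

sub-^ : ∀ a f n → sub a (f ^ᵖ n) ≡ sub a f ^ᵖ n
sub-^ a f zero    = ≡.refl
sub-^ a f (suc n) = cong (sub a f ⊠_) (sub-^ a f n)

act-X^ : ∀ n u i → act (X ^ᵖ n) u i ≡ u (n ℕ.+ i)
act-X^ zero    u i = ℤ.*-identityˡ (u i)
act-X^ (suc n) u i = ≡.trans (act-X^ n u (suc i)) (cong u (ℕ.+-suc n i))

act-sub : ∀ a f u i → act (sub a f) u (a ℕ.* i) ≡ act f (λ j → u (a ℕ.* j)) i
act-sub a (con c) u i = ≡.refl
act-sub a X       u i = ≡.trans (act-X^ a u (a ℕ.* i)) (cong u (≡.sym (ℕ.*-suc a i)))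
act-sub a (f ⊞ g) u i = cong₂ ℤ._+_ (act-sub a f u i) (act-sub a g u i)
act-sub a (f ⊠ g) u i = ≡.trans (act-sub a f (act (sub a g) u) i) (act-cong f (act-sub a g u) i)

expo-X^ : ∀ n j → E (X ^ᵖ n) j ≡ (+ n) ℤ.^ j
expo-X^ zero    zero    = ≡.refl
expo-X^ zero    (suc j) = ≡.refl
expo-X^ (suc n) j = ≡.trans (⊛-cong {u = expo 1ℤ} (λ _ → ≡.refl) (expo-X^ n) j) (expo-⊛ 1ℤ (+ n) j)

E-sub : ∀ a f j → E (sub a f) j ≡ scale (+ a) (E f) j
E-sub a (con c) zero    = ≡.sym (ℤ.*-identityˡ c)
E-sub a (con c) (suc j) = ≡.sym (ℤ.*-zeroʳ ((+ a) ℤ.^ suc j))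
E-sub a X       j = ≡.trans (expo-X^ a j) (≡.sym (≡.trans (cong ((+ a) ℤ.^ j ℤ.*_) (ℤ.^-zeroˡ j)) (ℤ.*-identityʳ _)))
E-sub a (f ⊞ g) j = ≡.trans (cong₂ ℤ._+_ (E-sub a f j) (E-sub a g j)) (≡.sym (ℤ.*-distribˡ-+ ((+ a) ℤ.^ j) _ _))
E-sub a (f ⊠ g) j = ≡.trans (⊛-cong (E-sub a f) (E-sub a g) j) (≡.sym (scale-⊛ (+ a) (E f) (E g) j))

-- Division by x - 1

ε : Poly
ε = X ⊞ con (ℤ.- 1ℤ)

-- The quotient of f - f(1) by x - 1, where f(1) is `E f 0`. The last clause rests on fg - f(1)g(1)
-- = f(1)(g - g(1)) + (f - f(1))g.
quo : Poly → Poly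
quo (con c) = con 0ℤ
quo X       = con 1ℤ
quo (f ⊞ g) = quo f ⊞ quo g
quo (f ⊠ g) = con (E f 0) ⊠ quo g ⊞ quo f ⊠ g

module ℤ[x] where
  open Cyclic 0 public using (_≈_; algebra; ⟪_⟫; on)
  open ℤAlgebra algebra public hiding (_≈_)
  open Alg algebra public

quo-correct : ∀ f → f ℤ[x].≈ con (E f 0) ⊞ ε ⊠ quo f
quo-correct (con c) = solve 2 (λ c x → c := c :+ (x :+ κ (ℤ.- 1ℤ)) :* κ 0ℤ) refl (con c) X
  where open ℤ[x]
quo-correct X = solve 1 (λ x → x := κ 1ℤ :+ (x :+ κ (ℤ.- 1ℤ)) :* κ 1ℤ) refl X
  where open ℤ[x]
quo-correct (f ⊞ g) = begin
  f ⊞ g  ≈⟨ +-cong (quo-correct f) (quo-correct g) ⟩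
  (con f₀ ⊞ ε ⊠ quo f) ⊞ (con g₀ ⊞ ε ⊠ quo g)
    ≈⟨ solve 5 (λ a b e u v → (a :+ e :* u) :+ (b :+ e :* v) := (a :+ b) :+ e :* (u :+ v)) refl
         (con f₀) (con g₀) ε (quo f) (quo g) ⟩
  (con f₀ ⊞ con g₀) ⊞ ε ⊠ (quo f ⊞ quo g)  ≈⟨ +-congʳ (ι-+ f₀ g₀) ⟨
  con (f₀ ℤ.+ g₀) ⊞ ε ⊠ (quo f ⊞ quo g)  ∎
  where
  open ℤ[x]
  open import Relation.Binary.Reasoning.Setoid setoid
  f₀ = E f 0
  g₀ = E g 0
quo-correct (f ⊠ g) = begin
  f ⊠ g  ≈⟨ *-congʳ {g} (quo-correct f) ⟩
  (con f₀ ⊞ ε ⊠ quo f) ⊠ g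
    ≈⟨ solve 4 (λ a g e u → (a :+ e :* u) :* g := a :* g :+ e :* (u :* g)) refl (con f₀) g ε (quo f) ⟩
  con f₀ ⊠ g ⊞ ε ⊠ (quo f ⊠ g)  ≈⟨ +-congʳ (*-congˡ {con f₀} (quo-correct g)) ⟩
  con f₀ ⊠ (con g₀ ⊞ ε ⊠ quo g) ⊞ ε ⊠ (quo f ⊠ g)
    ≈⟨ solve 5 (λ a b e w v → a :* (b :+ e :* v) :+ e :* w := a :* b :+ e :* (a :* v :+ w)) refl
         (con f₀) (con g₀) ε (quo f ⊠ g) (quo g) ⟩
  con f₀ ⊠ con g₀ ⊞ ε ⊠ (con f₀ ⊠ quo g ⊞ quo f ⊠ g)  ≈⟨ +-congʳ (ι-* f₀ g₀) ⟨
  con (f₀ ℤ.* g₀) ⊞ ε ⊠ (con f₀ ⊠ quo g ⊞ quo f ⊠ g)  ∎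
  where
  open ℤ[x]
  open import Relation.Binary.Reasoning.Setoid setoid
  f₀ = E f 0
  g₀ = E g 0

lift : ∀ {d f g} → f ℤ[x].≈ g → Cyclic._≈_ d f g
lift e = Cyclic.⟪ (λ u _ → Cyclic.on e u (λ _ → ≡.refl)) ⟫

-- Arithmetic modulo a prime and its powers

≅0⇒∣ : ∀ {m c} → c ≅ 0ℤ [ + m ] → m ℕ.∣ ℤ.∣ c ∣
≅0⇒∣ {m} (q , ≡.refl) = ℕ.divides ℤ.∣ q ∣ (≡.trans (cong ℤ.∣_∣ (ℤ.+-identityˡ (+ m ℤ.* q)))
  (≡.trans (ℤ.abs-* (+ m) q) (ℕ.*-comm m _)))

∣⇒≅0 : ∀ {m c} → m ℕ.∣ ℤ.∣ c ∣ → c ≅ 0ℤ [ + m ]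
∣⇒≅0 {m} {c} d with ℤ∣.∣ᵤ⇒∣ {+ m} {c} d
... | ℤ∣.divides q e = q , ≡.trans e (≡.trans (ℤ.*-comm q (+ m)) (≡.sym (ℤ.+-identityˡ _)))

≅⇒-≅0 : ∀ {m a b} → a ≅ b [ m ] → a ℤ.- b ≅ 0ℤ [ m ]
≅⇒-≅0 {m} {b = b} (q , ≡.refl) = q , lemma m b q
  where
  lemma : ∀ m b q → b ℤ.+ m ℤ.* q ℤ.- b ≡ 0ℤ ℤ.+ m ℤ.* q
  lemma = ℤ-solve-∀

-≅0⇒≅ : ∀ {m a b} → a ℤ.- b ≅ 0ℤ [ m ] → a ≅ b [ m ]
-≅0⇒≅ {m} {a} {b} (q , e) = q , ≡.trans (lemma a b) (cong (λ c → b ℤ.+ c) (≡.trans e (ℤ.+-identityˡ _)))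
  where
  lemma : ∀ a b → a ≡ b ℤ.+ (a ℤ.- b)
  lemma = ℤ-solve-∀

module PrimeMod {p : ℕ} (pr : Prime p) where
  P : ℤ
  P = + p

  open Mod P using () renaming (algebra to ℤ/p)
  module ℤ/p where
    open ℤAlgebra ℤ/p public
    open Alg ℤ/p public
    open import Relation.Binary.Reasoning.Setoid setoid public

  p∤_ : ℤ → Set
  p∤ c = ¬ (c ≅ 0ℤ [ P ])

  1<p : 1 ℕ.< p
  1<p = ℕ.nonTrivial⇒n>1 p {{prime⇒nonTrivial pr}}

  l : ℕ
  l = p ℕ.∸ 1

  p≡1+l : suc l ≡ p
  p≡1+l = ℕ.m+[n∸m]≡n (ℕ.<⇒≤ 1<p)

  0<l : 0 ℕ.< l
  0<l = ℕ.m<n⇒0<n∸m 1<p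

  euclid : ∀ a b → a ℤ.* b ≅ 0ℤ [ P ] → a ≅ 0ℤ [ P ] ⊎ b ≅ 0ℤ [ P ]
  euclid a b ab≅0 with euclidsLemma ℤ.∣ a ∣ ℤ.∣ b ∣ pr (subst (p ℕ.∣_) (ℤ.abs-* a b) (≅0⇒∣ ab≅0))
  ... | inj₁ d = inj₁ (∣⇒≅0 d)
  ... | inj₂ d = inj₂ (∣⇒≅0 d)

  p∤-* : ∀ {a b} → p∤ a → p∤ b → p∤ (a ℤ.* b)
  p∤-* {a} {b} na nb ab with euclid a b ab
  ... | inj₁ d = na d
  ... | inj₂ d = nb d

  p∤-ℕ : ∀ {c} → ¬ (p ℕ.∣ c) → p∤ (+ c)
  p∤-ℕ n d = n (≅0⇒∣ d)

  <⇒p∤ : ∀ {c} → 0 ℕ.< c → c ℕ.< p → p∤ (+ c)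
  <⇒p∤ {suc c} _ c<p d = ℕ.<⇒≱ c<p (ℕ.∣⇒≤ (≅0⇒∣ d))

  cancel : ∀ {c} a b → p∤ c → c ℤ.* a ≅ c ℤ.* b [ P ] → a ≅ b [ P ]
  cancel {c} a b n e with euclid c (a ℤ.- b) (subst (_≅ 0ℤ [ P ]) (lemma c a b) (≅⇒-≅0 e))
    where
    lemma : ∀ c a b → c ℤ.* a ℤ.- c ℤ.* b ≡ c ℤ.* (a ℤ.- b)
    lemma = ℤ-solve-∀
  ... | inj₁ d = ⊥-elim (n d)
  ... | inj₂ d = -≅0⇒≅ d

  fermat : ∀ c → c ℤ.^ p ≅ c [ P ]
  fermat c = ℤ/p.trans (ℤ/p.ι-^ c p) (go c)
    where
    open ℤ/p
    -- By `freshman` the congruences for c and for 1 + c are equivalent; the two directions carry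
    -- the induction upwards and downwards from 0.
    pow-1 : (c d : ℤ) → 1ℤ ℤ.+ c ≡ d → (c ^ p ≅ c [ P ] → d ^ p ≅ d [ P ]) × (d ^ p ≅ d [ P ] → c ^ p ≅ c [ P ])
    pow-1 c d ≡.refl = let q , e = freshman pr 1ℤ c in
      let e′ : (1ℤ ℤ.+ c) ^ p ≅ 1ℤ ℤ.+ c ^ p [ P ]
          e′ = trans e (trans (+-cong (+-congʳ (1^ p)) (q , ≡.sym (ℤ.+-identityˡ _))) (+-identityʳ _))
      in (λ h → trans e′ (+-congˡ {1ℤ} h))
       , (λ h → +-cancelˡ 1ℤ (c ^ p) c (trans (sym e′) h))
      where open import Algebra.Properties.Ring ring using (+-cancelˡ)
    go : ∀ c → c ^ p ≅ c [ P ]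
    go (+ zero) = zero^ p 1<p
      where
      zero^ : ∀ n → 1 ℕ.< n → 0ℤ ^ n ≅ 0ℤ [ P ]
      zero^ (suc n) _ = zeroˡ (0ℤ ^ n)
    go (+ suc n) = proj₁ (pow-1 (+ n) (+ suc n) ≡.refl) (go (+ n))
    go -[1+ zero ] = proj₂ (pow-1 -[1+ 0 ] 0ℤ ≡.refl) (go (+ 0))
    go -[1+ suc n ] = proj₂ (pow-1 -[1+ suc n ] -[1+ n ] ≡.refl) (go -[1+ n ])

  fermat′ : ∀ {c} → p∤ c → c ℤ.^ (p ℕ.∸ 1) ≅ 1ℤ [ P ]
  fermat′ {c} n = cancel _ _ n (subst (λ d → c ℤ.* c ℤ.^ (p ℕ.∸ 1) ≅ d [ P ]) (≡.sym (ℤ.*-identityʳ c))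
    (subst (λ m → c ℤ.^ m ≅ c [ P ]) (≡.sym (ℕ.m+[n∸m]≡n (ℕ.<⇒≤ 1<p))) (fermat c)))

  -- In (1 + mr)^p the linear term has the factor pm, and the others have m², a multiple of pm
  -- because p divides m.
  raise : ∀ {c m} → m ≅ 0ℤ [ P ] → c ≅ 1ℤ [ m ] → c ℤ.^ p ≅ 1ℤ [ m ℤ.* P ]
  raise {m = m} (t , m≡) (r , ≡.refl) = go p 1<p m≡
    where
    open Alg ℤ-algebra using (_^_; ι-^; 1^; taylor₂)
    -- The exponent is separated from `P`, to be matched in the shape n′ + 2 that `taylor₂` demands.
    go : ∀ n → 1 ℕ.< n → m ≡ 0ℤ ℤ.+ + n ℤ.* t → (1ℤ ℤ.+ m ℤ.* r) ℤ.^ n ≅ 1ℤ [ m ℤ.* + n ]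
    go (suc zero) (s≤s ()) _
    go n@(suc (suc n′)) _ m≡ = let r′ , e = taylor₂ n′ 1ℤ h in
      r ℤ.+ T ℤ.* (t ℤ.* r ℤ.* r) ℤ.+ t ℤ.* r ℤ.* r ℤ.* h ℤ.* r′ , (begin
      (1ℤ ℤ.+ h) ℤ.^ n  ≡⟨ ι-^ (1ℤ ℤ.+ h) n ⟩
      (1ℤ ℤ.+ h) ^ n  ≡⟨ e ⟩
      1ℤ ^ n ℤ.+ + n ℤ.* (1ℤ ^ suc n′ ℤ.* h) ℤ.+ T ℤ.* (1ℤ ^ n′ ℤ.* (h ℤ.* h)) ℤ.+ h ℤ.* (h ℤ.* h) ℤ.* r′
        ≡⟨ cong₂ (λ a b → a ℤ.+ + n ℤ.* (b ℤ.* h) ℤ.+ T ℤ.* (1ℤ ^ n′ ℤ.* (h ℤ.* h)) ℤ.+ h ℤ.* (h ℤ.* h) ℤ.* r′) (1^ n) (1^ (suc n′)) ⟩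
      1ℤ ℤ.+ + n ℤ.* (1ℤ ℤ.* h) ℤ.+ T ℤ.* (1ℤ ^ n′ ℤ.* (h ℤ.* h)) ℤ.+ h ℤ.* (h ℤ.* h) ℤ.* r′
        ≡⟨ cong₂ (λ a b → 1ℤ ℤ.+ + n ℤ.* (1ℤ ℤ.* h) ℤ.+ T ℤ.* (a ℤ.* (h ℤ.* b)) ℤ.+ h ℤ.* (h ℤ.* b) ℤ.* r′) (1^ n′) (cong (ℤ._* r) m≡) ⟩
      1ℤ ℤ.+ + n ℤ.* (1ℤ ℤ.* h) ℤ.+ T ℤ.* (1ℤ ℤ.* (h ℤ.* h′)) ℤ.+ h ℤ.* (h ℤ.* h′) ℤ.* r′
        ≡⟨ lemma (+ n) m t r T r′ h ⟩
      1ℤ ℤ.+ m ℤ.* + n ℤ.* (r ℤ.+ T ℤ.* (t ℤ.* r ℤ.* r) ℤ.+ t ℤ.* r ℤ.* r ℤ.* h ℤ.* r′) ∎)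
      where
      open ≡-Reasoning
      h = m ℤ.* r
      h′ = (0ℤ ℤ.+ + n ℤ.* t) ℤ.* r
      T = + triangle n′
      lemma : ∀ n m t r T r′ h → 1ℤ ℤ.+ n ℤ.* (1ℤ ℤ.* (m ℤ.* r)) ℤ.+ T ℤ.* (1ℤ ℤ.* (m ℤ.* r ℤ.* ((0ℤ ℤ.+ n ℤ.* t) ℤ.* r)))
        ℤ.+ h ℤ.* (m ℤ.* r ℤ.* ((0ℤ ℤ.+ n ℤ.* t) ℤ.* r)) ℤ.* r′
        ≡ 1ℤ ℤ.+ m ℤ.* n ℤ.* (r ℤ.+ T ℤ.* (t ℤ.* r ℤ.* r) ℤ.+ t ℤ.* r ℤ.* r ℤ.* h ℤ.* r′)
      lemma = ℤ-solve-∀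

  euler : ∀ {c} → p∤ c → ∀ b → c ℤ.^ ((p ℕ.∸ 1) ℕ.* p ℕ.^ b) ≅ 1ℤ [ P ℤ.^ suc b ]
  euler {c} n zero    = subst₂ (λ e m → c ℤ.^ e ≅ 1ℤ [ m ]) (≡.sym (ℕ.*-identityʳ (p ℕ.∸ 1))) (≡.sym (ℤ.*-identityʳ P)) (fermat′ n)
  euler {c} n (suc b) = subst₂ (_≅ 1ℤ [_])
    (≡.trans (ℤ.^-*-assoc c ((p ℕ.∸ 1) ℕ.* p ℕ.^ b) p) (cong (c ℤ.^_) (lemma (p ℕ.∸ 1) (p ℕ.^ b) p))) (ℤ.*-comm (P ℤ.^ suc b) P)
    (raise (P ℤ.^ b , ≡.sym (ℤ.+-identityˡ _)) (euler n b))
    where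
    lemma : ∀ a b c → a ℕ.* b ℕ.* c ≡ a ℕ.* (c ℕ.* b)
    lemma = ℕ-solve-∀

  euler-multiple : ∀ {c} → p∤ c → ∀ b m → c ℤ.^ (m ℕ.* ((p ℕ.∸ 1) ℕ.* p ℕ.^ b)) ≅ 1ℤ [ P ℤ.^ suc b ]
  euler-multiple {c} n b m = subst (_≅ 1ℤ [ q ])
    (≡.trans (ℤ.^-*-assoc c M m) (cong (c ℤ.^_) (ℕ.*-comm M m)))
    (trans (ι-^ (c ℤ.^ M) m) (trans (^-cong m (euler n b)) (1^ m)))
    where
    M = (p ℕ.∸ 1) ℕ.* p ℕ.^ b
    q = P ℤ.^ suc b
    open ℤAlgebra (Mod.algebra q)
    open Alg (Mod.algebra q)

-- d/dz (e^z - 1)^(k+1) = (k+1) ((e^z - 1)^(k+1) + (e^z - 1)^k), the recursion of k! S(j,k).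
module _ where
  private
    e : Seq
    e = E ε

  shift-e : ∀ j → shift e j ≡ (e ⊕ constant 1ℤ) j
  shift-e zero    = ≡.refl
  shift-e (suc j) = ≡.trans (cong (ℤ._+ 0ℤ) (ℤ.*-identityˡ (1ℤ ℤ.^ suc j))) (≡.sym (ℤ.+-identityʳ _))

  shift-e^ : ∀ k j → shift (e ^ˢ suc k) j ≡ + suc k ℤ.* ((e ^ˢ suc k) j ℤ.+ (e ^ˢ k) j)
  shift-e^ zero    j = begin
    (shift e ⊛ constant 1ℤ) j ℤ.+ (e ⊛ shift (constant 1ℤ)) j
      ≡⟨ cong₂ ℤ._+_ (one (shift e) j) (≡.trans (⊛-comm e _ j) (⊛-zeroˡ e (λ _ → ≡.refl) j)) ⟩
    shift e j ℤ.+ 0ℤ  ≡⟨ ℤ.+-identityʳ _ ⟩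
    shift e j  ≡⟨ shift-e j ⟩
    e j ℤ.+ constant 1ℤ j  ≡⟨ cong (ℤ._+ constant 1ℤ j) (one e j) ⟨
    (e ^ˢ 1) j ℤ.+ (e ^ˢ 0) j  ≡⟨ ℤ.*-identityˡ _ ⟨
    1ℤ ℤ.* ((e ^ˢ 1) j ℤ.+ (e ^ˢ 0) j)  ∎
    where
    open ≡-Reasoning
    one : ∀ u j → (u ⊛ constant 1ℤ) j ≡ u j
    one u j = ≡.trans (⊛-comm u _ j) (≡.trans (⊛-constant 1ℤ u j) (ℤ.*-identityˡ _))
  shift-e^ (suc k) j = begin
    (shift e ⊛ u) j ℤ.+ (e ⊛ shift u) j
      ≡⟨ cong₂ ℤ._+_ (⊛-cong shift-e (λ _ → ≡.refl) j) (⊛-cong {u = e} (λ _ → ≡.refl) (shift-e^ k) j) ⟩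
    ((e ⊕ constant 1ℤ) ⊛ u) j ℤ.+ (e ⊛ (λ i → c ℤ.* (u ⊕ v) i)) j
      ≡⟨ cong₂ ℤ._+_ (⊛-distribʳ u e (constant 1ℤ) j) (≡.trans (⊛-scalarʳ c e (u ⊕ v) j) (cong (c ℤ.*_) (⊛-distribˡ e u v j))) ⟩
    (e ⊛ u) j ℤ.+ (constant 1ℤ ⊛ u) j ℤ.+ c ℤ.* ((e ⊛ u) j ℤ.+ u j)
      ≡⟨ cong (λ a → (e ⊛ u) j ℤ.+ a ℤ.+ c ℤ.* ((e ⊛ u) j ℤ.+ u j)) (⊛-constant 1ℤ u j) ⟩
    (e ⊛ u) j ℤ.+ 1ℤ ℤ.* u j ℤ.+ c ℤ.* ((e ⊛ u) j ℤ.+ u j)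
      ≡⟨ lemma c ((e ⊛ u) j) (u j) ⟩
    (1ℤ ℤ.+ c) ℤ.* ((e ⊛ u) j ℤ.+ u j) ∎
    where
    open ≡-Reasoning
    c = + suc k
    u = e ^ˢ suc k
    v = e ^ˢ k
    lemma : ∀ c a b → a ℤ.+ 1ℤ ℤ.* b ℤ.+ c ℤ.* (a ℤ.+ b) ≡ (1ℤ ℤ.+ c) ℤ.* (a ℤ.+ b)
    lemma = ℤ-solve-∀

  stirling : ∀ k j → E (ε ^ᵖ k) j ≡ + (k ! ℕ.* S j k)
  stirling k j = ≡.trans (cong (λ u → u j) (E-^ ε k)) (go k j)
    where
    go : ∀ k j → (e ^ˢ k) j ≡ + (k ! ℕ.* S j k)
    go zero    zero    = ≡.refl
    go zero    (suc j) = ≡.refl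
    go (suc k) zero    = ≡.trans (≡.sym (cong (λ n → + n) (ℕ.*-zeroʳ (suc k !)))) ≡.refl
    go (suc k) (suc j) = begin
      shift (e ^ˢ suc k) j  ≡⟨ shift-e^ k j ⟩
      + suc k ℤ.* ((e ^ˢ suc k) j ℤ.+ (e ^ˢ k) j)  ≡⟨ cong₂ (λ a b → + suc k ℤ.* (a ℤ.+ b)) (go (suc k) j) (go k j) ⟩
      + suc k ℤ.* + (suc k ! ℕ.* S j (suc k) ℕ.+ k ! ℕ.* S j k) ≡⟨ ℤ.pos-* (suc k) _ ⟨
      + (suc k ℕ.* (suc k ! ℕ.* S j (suc k) ℕ.+ k ! ℕ.* S j k))
        ≡⟨ cong (λ n → + n) (lemma (suc k) (k !) (S j (suc k)) (S j k)) ⟩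
      + (suc k ! ℕ.* (suc k ℕ.* S j (suc k) ℕ.+ S j k))  ∎
      where
      open ≡-Reasoning
      lemma : ∀ k f a b → k ℕ.* (k ℕ.* f ℕ.* a ℕ.+ f ℕ.* b) ≡ k ℕ.* f ℕ.* (k ℕ.* a ℕ.+ b)
      lemma = ℕ-solve-∀

S-< : ∀ j k → j ℕ.< k → S j k ≡ 0
S-< zero    (suc k) _         = ≡.refl
S-< (suc j) (suc k) (s≤s j<k) = ≡.trans (cong₂ (λ a b → suc k ℕ.* a ℕ.+ b) (S-< j (suc k) (ℕ.m<n⇒m<1+n j<k)) (S-< j k j<k))
  (≡.trans (ℕ.+-identityʳ _) (ℕ.*-zeroʳ (suc k)))

E-ε^-< : ∀ k j → j ℕ.< k → E (ε ^ᵖ k) j ≡ 0ℤ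
E-ε^-< k j j<k = ≡.trans (stirling k j) (cong (λ n → + n) (≡.trans (cong (k ! ℕ.*_) (S-< j k j<k)) (ℕ.*-zeroʳ (k !))))

-1^odd : ∀ h → (ℤ.- 1ℤ) ℤ.^ suc (h ℕ.+ h) ≡ ℤ.- 1ℤ
-1^odd zero    = ≡.refl
-1^odd (suc h) = ≡.trans (cong (λ n → (ℤ.- 1ℤ) ℤ.* ((ℤ.- 1ℤ) ℤ.* (ℤ.- 1ℤ) ℤ.^ n)) (ℕ.+-suc h h))
  (≡.trans (lemma ((ℤ.- 1ℤ) ℤ.^ suc (h ℕ.+ h))) (-1^odd h))
  where
  lemma : ∀ a → ℤ.- 1ℤ ℤ.* (ℤ.- 1ℤ ℤ.* a) ≡ a
  lemma = ℤ-solve-∀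

geometric : ℕ → Poly
geometric zero    = con 0ℤ
geometric (suc a) = geometric a ⊞ X ^ᵖ a

ε-geometric : ∀ a → ε ⊠ geometric a ℤ[x].≈ X ^ᵖ a ⊞ con (ℤ.- 1ℤ)
ε-geometric zero    = solve 1 (λ e → e :* κ 0ℤ := κ 1ℤ :+ κ (ℤ.- 1ℤ)) refl ε
  where open ℤ[x]
ε-geometric (suc a) = begin
  ε ⊠ (geometric a ⊞ X ^ᵖ a)  ≈⟨ distribˡ ε (geometric a) (X ^ᵖ a) ⟩
  ε ⊠ geometric a ⊞ ε ⊠ X ^ᵖ a  ≈⟨ +-congʳ (ε-geometric a) ⟩
  X ^ᵖ a ⊞ con (ℤ.- 1ℤ) ⊞ ε ⊠ X ^ᵖ a
    ≈⟨ solve 2 (λ x y → y :+ κ (ℤ.- 1ℤ) :+ (x :+ κ (ℤ.- 1ℤ)) :* y := x :* y :+ κ (ℤ.- 1ℤ)) refl X (X ^ᵖ a) ⟩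
  X ⊠ X ^ᵖ a ⊞ con (ℤ.- 1ℤ)  ∎
  where
  open ℤ[x]
  open import Relation.Binary.Reasoning.Setoid setoid

E-geometric-0 : ∀ a → E (geometric a) 0 ≡ + a
E-geometric-0 zero    = ≡.refl
E-geometric-0 (suc a) = ≡.trans (cong₂ ℤ._+_ (E-geometric-0 a) (expo-X^ a 0)) (cong (λ n → + n) (ℕ.+-comm a 1))

-- The Frobenius congruence in ℤ[x]

module OddPrime {p : ℕ} (pr : Prime p) (h : ℕ) (p≡1+2h : p ≡ suc (h ℕ.+ h)) where
  open PrimeMod pr

  -1^p : (ℤ.- 1ℤ) ℤ.^ p ≡ ℤ.- 1ℤ
  -1^p = ≡.trans (cong ((ℤ.- 1ℤ) ℤ.^_) p≡1+2h) (-1^odd h)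

  module _ where
    open ℤ[x]
    open import Relation.Binary.Reasoning.Setoid setoid

    con-^ : ∀ c n → con c ^ᵖ n ≈ con (c ℤ.^ n)
    con-^ c n = sym (ι-^ c n)

    -- Induction on the expression, from `fermat` for constants and `freshman` for sums. The
    -- identity is exact in ℤ[x], so that it survives the passage to exponential coefficients, in
    -- which p is cancelled later.
    frobenius : ∀ f → Σ Poly λ z → f ^ᵖ p ≈ sub p f ⊞ con P ⊠ z
    frobenius (con c) = let r , e = fermat c in con r , (begin
      con c ^ᵖ p  ≈⟨ con-^ c p ⟩
      con (c ℤ.^ p)  ≈⟨ ≡⇒≈ (cong con e) ⟩
      con (c ℤ.+ P ℤ.* r)  ≈⟨ trans (ι-+ c (P ℤ.* r)) (+-congˡ (ι-* P r)) ⟩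
      con c ⊞ con P ⊠ con r  ∎)
    frobenius X = con 0ℤ , solve 2 (λ x q → x := x :+ q :* κ 0ℤ) refl (X ^ᵖ p) (con P)
    frobenius (f ⊞ g) with frobenius f | frobenius g | freshman pr f g
    ... | a , e | b , e′ | c , e″ = a ⊞ b ⊞ c , (begin
      (f ⊞ g) ^ᵖ p  ≈⟨ e″ ⟩
      f ^ᵖ p ⊞ g ^ᵖ p ⊞ con P ⊠ c  ≈⟨ +-congʳ (+-cong e e′) ⟩
      sub p f ⊞ con P ⊠ a ⊞ (sub p g ⊞ con P ⊠ b) ⊞ con P ⊠ c
        ≈⟨ solve 6 (λ x y q a b c → x :+ q :* a :+ (y :+ q :* b) :+ q :* c := x :+ y :+ q :* (a :+ b :+ c)) refl
             (sub p f) (sub p g) (con P) a b c ⟩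
      sub p f ⊞ sub p g ⊞ con P ⊠ (a ⊞ b ⊞ c)  ∎)
    frobenius (f ⊠ g) with frobenius f | frobenius g
    ... | a , e | b , e′ = sub p f ⊠ b ⊞ a ⊠ sub p g ⊞ con P ⊠ a ⊠ b , (begin
      (f ⊠ g) ^ᵖ p  ≈⟨ ^-distrib-* f g p ⟩
      f ^ᵖ p ⊠ g ^ᵖ p  ≈⟨ *-cong e e′ ⟩
      (sub p f ⊞ con P ⊠ a) ⊠ (sub p g ⊞ con P ⊠ b)
        ≈⟨ solve 5 (λ x y q a b → (x :+ q :* a) :* (y :+ q :* b) := x :* y :+ q :* (x :* b :+ a :* y :+ q :* a :* b)) refl
             (sub p f) (sub p g) (con P) a b ⟩
      sub p f ⊠ sub p g ⊞ con P ⊠ (sub p f ⊠ b ⊞ a ⊠ sub p g ⊞ con P ⊠ a ⊠ b) ∎)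

  private
    ε^p = ℤ[x].freshman pr X (con (ℤ.- 1ℤ))

  -- ε^p = x^p - 1 + p g, with g = ε u.
  g u : Poly
  g = proj₁ ε^p
  u = quo g

  ε^p≈ : ε ^ᵖ p ℤ[x].≈ X ^ᵖ p ⊞ con (ℤ.- 1ℤ) ⊞ con P ⊠ g
  ε^p≈ = trans (proj₂ ε^p) (+-congʳ (+-congˡ (trans (con-^ (ℤ.- 1ℤ) p) (≡⇒≈ (cong con -1^p)))))
    where open ℤ[x]

  private
    -- Since (e^z - 1)^p begins with z^p, the coefficients of e^(pz) - 1 + p g(e^z) below p vanish;
    -- this determines those of g(e^z).
    0≡p^j+pg : ∀ j → j ℕ.< p → 0ℤ ≡ P ℤ.^ j ℤ.+ constant (ℤ.- 1ℤ) j ℤ.+ P ℤ.* E g j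
    0≡p^j+pg j j<p = begin
      0ℤ  ≡⟨ E-ε^-< p j j<p ⟨
      E (ε ^ᵖ p) j  ≡⟨ E-cong ε^p≈ j ⟩
      E (X ^ᵖ p) j ℤ.+ constant (ℤ.- 1ℤ) j ℤ.+ (constant P ⊛ E g) j
        ≡⟨ cong₂ (λ a b → a ℤ.+ constant (ℤ.- 1ℤ) j ℤ.+ b) (expo-X^ p j) (⊛-constant P (E g) j) ⟩
      P ℤ.^ j ℤ.+ constant (ℤ.- 1ℤ) j ℤ.+ P ℤ.* E g j  ∎
      where open ≡-Reasoning

    P-cancel : ∀ a b → P ℤ.* a ≡ P ℤ.* b → a ≡ b
    P-cancel a b = ℤ.*-cancelˡ-≡ P a b {{ℕ.>-nonZero (ℕ.<⇒≤ 1<p)}}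

  E-g-0 : E g 0 ≡ 0ℤ
  E-g-0 = P-cancel _ _ (≡.trans (≡.sym (ℤ.+-identityˡ _)) (≡.trans (≡.sym (0≡p^j+pg 0 (ℕ.<⇒≤ 1<p))) (≡.sym (ℤ.*-zeroʳ P))))

  E-g-suc : ∀ j → suc j ℕ.< p → E g (suc j) ≡ ℤ.- (P ℤ.^ j)
  E-g-suc j j<p = P-cancel _ _ (≡.trans (lemma (P ℤ.* E g (suc j)) P (P ℤ.^ j))
    (≡.trans (cong (ℤ._- P ℤ.* P ℤ.^ j) (≡.sym (0≡p^j+pg (suc j) j<p))) (lemma′ P (P ℤ.^ j))))
    where
    lemma : ∀ a p b → a ≡ p ℤ.* b ℤ.+ 0ℤ ℤ.+ a ℤ.- p ℤ.* b
    lemma = ℤ-solve-∀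
    lemma′ : ∀ p b → 0ℤ ℤ.- p ℤ.* b ≡ p ℤ.* ℤ.- b
    lemma′ = ℤ-solve-∀

  g≈εu : g ℤ[x].≈ ε ⊠ u
  g≈εu = begin
    g  ≈⟨ quo-correct g ⟩
    con (E g 0) ⊞ ε ⊠ u  ≈⟨ +-congʳ (≡⇒≈ (cong con E-g-0)) ⟩
    con 0ℤ ⊞ ε ⊠ u  ≈⟨ +-identityˡ (ε ⊠ u) ⟩
    ε ⊠ u  ∎
    where
    open ℤ[x]
    open import Relation.Binary.Reasoning.Setoid setoid

  -- The coefficient of z in g(e^z) = (e^z - 1) u(e^z) is u(1).
  E-u-0 : E u 0 ≡ ℤ.- 1ℤ
  E-u-0 = begin
    E u 0  ≡⟨ lemma (E u 0) (E u 1) ⟩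
    1ℤ ℤ.* E u 0 ℤ.+ 0ℤ ℤ.* E u 1  ≡⟨ E-cong g≈εu 1 ⟨
    E g 1  ≡⟨ E-g-suc 0 1<p ⟩
    ℤ.- 1ℤ  ∎
    where
    open ≡-Reasoning
    lemma : ∀ a b → a ≡ 1ℤ ℤ.* a ℤ.+ 0ℤ ℤ.* b
    lemma = ℤ-solve-∀

-- The functional T

module Trace {p : ℕ} (pr : Prime p) where
  open PrimeMod pr

  indicator : Seq
  indicator i with p ℕ.∣? i
  ... | yes _ = 1ℤ
  ... | no  _ = 0ℤ

  indicator-∣ : ∀ {i} → p ℕ.∣ i → indicator i ≡ 1ℤ
  indicator-∣ {i} d with p ℕ.∣? i
  ... | yes _ = ≡.refl
  ... | no  n = ⊥-elim (n d)

  indicator-∤ : ∀ {i} → ¬ p ℕ.∣ i → indicator i ≡ 0ℤ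
  indicator-∤ {i} n with p ℕ.∣? i
  ... | yes d = ⊥-elim (n d)
  ... | no  _ = ≡.refl

  indicator-⇔ : ∀ {i j} → (p ℕ.∣ i → p ℕ.∣ j) → (p ℕ.∣ j → p ℕ.∣ i) → indicator i ≡ indicator j
  indicator-⇔ {i} {j} to from with p ℕ.∣? i
  ... | yes d = ≡.sym (indicator-∣ (to d))
  ... | no  n = ≡.sym (indicator-∤ (n ∘ from))

  indicator-periodic : Periodic p indicator
  indicator-periodic i = indicator-⇔ (λ d → ℕ.∣m+n∣m⇒∣n d ℕ.∣-refl) (ℕ.∣m∣n⇒∣m+n ℕ.∣-refl)

  indicator-* : ∀ {a} → ¬ p ℕ.∣ a → ∀ i → indicator (a ℕ.* i) ≡ indicator i
  indicator-* {a} n i = indicator-⇔ to (ℕ.∣n⇒∣m*n a)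
    where
    to : p ℕ.∣ a ℕ.* i → p ℕ.∣ i
    to d with euclidsLemma a i pr d
    ... | inj₁ d′ = ⊥-elim (n d′)
    ... | inj₂ d′ = d′

  -- The sum of the coefficients of x^k over the multiples k of p.
  T : Poly → ℤ
  T f = act f indicator 0

  T-cong : ∀ {f g} → Cyclic._≈_ p f g → T f ≡ T g
  T-cong e = Cyclic.on e indicator indicator-periodic 0

  -- The monomial x^k becomes x^(ak), and p divides ak exactly when it divides k.
  T-sub : ∀ {a} → ¬ p ℕ.∣ a → ∀ f → T (sub a f) ≡ T f
  T-sub {a} n f = begin
    act (sub a f) indicator 0  ≡⟨ cong (act (sub a f) indicator) (ℕ.*-zeroʳ a) ⟨
    act (sub a f) indicator (a ℕ.* 0)  ≡⟨ act-sub a f indicator 0 ⟩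
    act f (λ j → indicator (a ℕ.* j)) 0  ≡⟨ act-cong f (indicator-* n) 0 ⟩
    act f indicator 0  ∎
    where open ≡-Reasoning

  -- Because the indicator of p ∣ i is congruent to 1 - i^M.
  T-moment : ∀ m M → (∀ c → p∤ c → c ℤ.^ M ≅ 1ℤ [ m ]) → (∀ c → c ≅ 0ℤ [ P ] → c ℤ.^ M ≅ 0ℤ [ m ]) →
    ∀ f → T f ≅ E f 0 ℤ.- E f M [ m ]
  T-moment m M unit zero′ f = Mod.≅-trans m (act-cong-mod m f indicator≅ 0) (Mod.≡⇒≅ m (begin
    act f (λ i → (+ i) ℤ.^ 0 ℤ.+ ℤ.- 1ℤ ℤ.* (+ i) ℤ.^ M) 0
      ≡⟨ act-+ f (λ i → (+ i) ℤ.^ 0) (λ i → ℤ.- 1ℤ ℤ.* (+ i) ℤ.^ M) 0 ⟩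
    act f (λ i → (+ i) ℤ.^ 0) 0 ℤ.+ act f (λ i → ℤ.- 1ℤ ℤ.* (+ i) ℤ.^ M) 0
      ≡⟨ cong₂ ℤ._+_ (moment f 0) (≡.trans (act-* f (ℤ.- 1ℤ) (λ i → (+ i) ℤ.^ M) 0) (cong (ℤ.- 1ℤ ℤ.*_) (moment f M))) ⟩
    E f 0 ℤ.+ ℤ.- 1ℤ ℤ.* E f M  ≡⟨ cong (λ a → E f 0 ℤ.+ a) (ℤ.-1*i≡-i (E f M)) ⟩
    E f 0 ℤ.- E f M  ∎))
    where
    open ≡-Reasoning
    indicator≅ : ∀ i → indicator i ≅ (+ i) ℤ.^ 0 ℤ.+ ℤ.- 1ℤ ℤ.* (+ i) ℤ.^ M [ m ]
    indicator≅ i with p ℕ.∣? i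
    ... | yes d = Mod.≅-sym m (Mod.+-cong m (Mod.≅-refl m {1ℤ}) (Mod.*-cong m (Mod.≅-refl m {ℤ.- 1ℤ}) (zero′ (+ i) (∣⇒≅0 d))))
    ... | no  n = Mod.≅-sym m (Mod.+-cong m (Mod.≅-refl m {1ℤ}) (Mod.*-cong m (Mod.≅-refl m {ℤ.- 1ℤ}) (unit (+ i) (p∤-ℕ n))))

-- Powers of x - 1 in ℤ[x]/(x^p - 1)

module CyclicPrime {p : ℕ} (pr : Prime p) (h : ℕ) (p≡1+2h : p ≡ suc (h ℕ.+ h)) where
  open PrimeMod pr
  open OddPrime pr h p≡1+2h
  open Cyclic p using () renaming (algebra to cyclic)
  open ℤAlgebra cyclic
  open Alg cyclic
  open import Relation.Binary.Reasoning.Setoid setoid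

  X^p≈1 : X ^ᵖ p ≈ con 1ℤ
  X^p≈1 = Cyclic.⟪ (λ v per i → ≡.trans (act-X^ p v i) (≡.trans (per i) (≡.sym (ℤ.*-identityˡ (v i))))) ⟫

  -- As x^p = 1, the Frobenius image f(x^p) collapses to the constant f(1).
  sub-p : ∀ f → sub p f ≈ con (E f 0)
  sub-p (con c) = refl
  sub-p X       = X^p≈1
  sub-p (f ⊞ g) = trans (+-cong (sub-p f) (sub-p g)) (sym (ι-+ _ _))
  sub-p (f ⊠ g) = trans (*-cong (sub-p f) (sub-p g)) (sym (ι-* _ _))

  frobenius-cyclic : ∀ f → Σ Poly λ z → f ^ᵖ p ≈ con (E f 0) ⊞ con P ⊠ z
  frobenius-cyclic f = let z , e = frobenius f in z , trans (lift e) (+-congʳ (sub-p f))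

  ^-mod : ∀ {f} c z q → f ≈ con c ⊞ con P ⊠ z → Σ Poly λ z′ → f ^ᵖ q ≈ con (c ℤ.^ q) ⊞ con P ⊠ z′
  ^-mod c z zero    e = con 0ℤ , solve 1 (λ q → κ 1ℤ := κ 1ℤ :+ q :* κ 0ℤ) refl (con P)
  ^-mod {f} c z (suc q) e = let z′ , e′ = ^-mod c z q e in con c ⊠ z′ ⊞ z ⊠ con (c ℤ.^ q) ⊞ z ⊠ (con P ⊠ z′) , (begin
    f ⊠ f ^ᵖ q  ≈⟨ *-cong e e′ ⟩
    (con c ⊞ con P ⊠ z) ⊠ (con (c ℤ.^ q) ⊞ con P ⊠ z′)
      ≈⟨ solve 5 (λ c d q z y → (c :+ q :* z) :* (d :+ q :* y) := c :* d :+ q :* (c :* y :+ z :* d :+ z :* (q :* y)))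
           refl (con c) (con (c ℤ.^ q)) (con P) z z′ ⟩
    con c ⊠ con (c ℤ.^ q) ⊞ con P ⊠ (con c ⊠ z′ ⊞ z ⊠ con (c ℤ.^ q) ⊞ z ⊠ (con P ⊠ z′))  ≈⟨ +-congʳ (ι-* c (c ℤ.^ q)) ⟨
    con (c ℤ.^ suc q) ⊞ con P ⊠ (con c ⊠ z′ ⊞ z ⊠ con (c ℤ.^ q) ⊞ z ⊠ (con P ⊠ z′))  ∎)

  ε^p≈Pεu : ε ^ᵖ p ≈ con P ⊠ (ε ⊠ u)
  ε^p≈Pεu = begin
    ε ^ᵖ p  ≈⟨ lift ε^p≈ ⟩
    X ^ᵖ p ⊞ con (ℤ.- 1ℤ) ⊞ con P ⊠ g  ≈⟨ +-cong (+-congʳ X^p≈1) (*-congˡ {con P} (lift g≈εu)) ⟩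
    con 1ℤ ⊞ con (ℤ.- 1ℤ) ⊞ con P ⊠ (ε ⊠ u)
      ≈⟨ solve 2 (λ q x → κ 1ℤ :+ κ (ℤ.- 1ℤ) :+ q :* x := q :* x) refl (con P) (ε ⊠ u) ⟩
    con P ⊠ (ε ⊠ u)  ∎

  -- Each step trades p - 1 factors ε for p u by means of ε^p = p ε u. One factor ε has to remain,
  -- hence the exponent `suc s`: ε is a zero divisor in this ring, and ε^(p-1) = p u is false, as
  -- the values at 1 show.
  ε^-reduce : ∀ s q → ε ^ᵖ (suc s ℕ.+ q ℕ.* l) ≈ con (P ℤ.^ q) ⊠ (ε ^ᵖ suc s ⊠ u ^ᵖ q)
  ε^-reduce s zero    = trans (≡⇒≈ (cong (ε ^ᵖ_) (ℕ.+-identityʳ (suc s))))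
    (sym (trans (*-identityˡ _) (*-identityʳ (ε ^ᵖ suc s))))
  ε^-reduce s (suc q) = begin
    ε ^ᵖ (suc s ℕ.+ (l ℕ.+ q ℕ.* l))  ≈⟨ ≡⇒≈ (cong (ε ^ᵖ_) (lemma (suc s) l (q ℕ.* l))) ⟩
    ε ^ᵖ (l ℕ.+ (suc s ℕ.+ q ℕ.* l))  ≈⟨ ^-homo-* ε l _ ⟩
    ε ^ᵖ l ⊠ ε ^ᵖ (suc s ℕ.+ q ℕ.* l)  ≈⟨ *-congˡ {ε ^ᵖ l} (ε^-reduce s q) ⟩
    ε ^ᵖ l ⊠ (con (P ℤ.^ q) ⊠ ((ε ⊠ ε ^ᵖ s) ⊠ u ^ᵖ q))
      ≈⟨ solve 5 (λ a c e b v → a :* (c :* ((e :* b) :* v)) := (e :* a) :* (c :* (b :* v))) refl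
           (ε ^ᵖ l) (con (P ℤ.^ q)) ε (ε ^ᵖ s) (u ^ᵖ q) ⟩
    ε ^ᵖ suc l ⊠ (con (P ℤ.^ q) ⊠ (ε ^ᵖ s ⊠ u ^ᵖ q))
      ≈⟨ *-congʳ {con (P ℤ.^ q) ⊠ (ε ^ᵖ s ⊠ u ^ᵖ q)} (trans (≡⇒≈ (cong (ε ^ᵖ_) p≡1+l)) ε^p≈Pεu) ⟩
    con P ⊠ (ε ⊠ u) ⊠ (con (P ℤ.^ q) ⊠ (ε ^ᵖ s ⊠ u ^ᵖ q))
      ≈⟨ solve 6 (λ p e u c b v → p :* (e :* u) :* (c :* (b :* v)) := (p :* c) :* ((e :* b) :* (u :* v))) refl
           (con P) ε u (con (P ℤ.^ q)) (ε ^ᵖ s) (u ^ᵖ q) ⟩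
    (con P ⊠ con (P ℤ.^ q)) ⊠ (ε ^ᵖ suc s ⊠ u ^ᵖ suc q)  ≈⟨ *-congʳ {ε ^ᵖ suc s ⊠ u ^ᵖ suc q} (ι-* P (P ℤ.^ q)) ⟨
    con (P ℤ.^ suc q) ⊠ (ε ^ᵖ suc s ⊠ u ^ᵖ suc q)  ∎
    where
    lemma : ∀ a b c → a ℕ.+ (b ℕ.+ c) ≡ b ℕ.+ (a ℕ.+ c)
    lemma = ℕ-solve-∀

  -- The powers of u collect to u^(n+q), and n + q = n_* + qp with n_* = `suc s`. Here u^(n_*)
  -- completes ε^(n_*) to g^(n_*), and u^(qp) ≡ u(1)^q = (-1)^q modulo p by Frobenius.
  ε^[pn] : ∀ s q → let n = suc s ℕ.+ q ℕ.* l in Σ Poly λ z →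
    ε ^ᵖ (n ℕ.* p) ≈ con (P ℤ.^ (n ℕ.+ q)) ⊠ (con ((ℤ.- 1ℤ) ℤ.^ q) ⊠ g ^ᵖ suc s ⊞ con P ⊠ z)
  ε^[pn] s q = let
      z₁ , e₁ = frobenius-cyclic u
      z₂ , e₂ = ^-mod (E u 0) z₁ q e₁
    in g ^ᵖ suc s ⊠ z₂ , (begin
    ε ^ᵖ (n ℕ.* p)  ≈⟨ ^-assoc ε n p ⟩
    (ε ^ᵖ p) ^ᵖ n  ≈⟨ ^-cong n ε^p≈Pεu ⟩
    (con P ⊠ (ε ⊠ u)) ^ᵖ n
      ≈⟨ trans (^-distrib-* (con P) (ε ⊠ u) n) (*-cong (sym (ι-^ P n)) (^-distrib-* ε u n)) ⟩
    con (P ℤ.^ n) ⊠ (ε ^ᵖ n ⊠ u ^ᵖ n)  ≈⟨ *-congˡ {con (P ℤ.^ n)} (*-congʳ {u ^ᵖ n} (ε^-reduce s q)) ⟩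
    con (P ℤ.^ n) ⊠ (con (P ℤ.^ q) ⊠ (ε ^ᵖ suc s ⊠ u ^ᵖ q) ⊠ u ^ᵖ n)
      ≈⟨ solve 5 (λ a b e v w → a :* (b :* (e :* v) :* w) := (a :* b) :* (e :* (w :* v))) refl
           (con (P ℤ.^ n)) (con (P ℤ.^ q)) (ε ^ᵖ suc s) (u ^ᵖ q) (u ^ᵖ n) ⟩
    con (P ℤ.^ n) ⊠ con (P ℤ.^ q) ⊠ (ε ^ᵖ suc s ⊠ (u ^ᵖ n ⊠ u ^ᵖ q))
      ≈⟨ *-cong (trans (sym (ι-* (P ℤ.^ n) (P ℤ.^ q))) (≡⇒≈ (cong con (≡.sym (ℤ.^-distribˡ-+-* P n q)))))
           (*-congˡ {ε ^ᵖ suc s} (begin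
             u ^ᵖ n ⊠ u ^ᵖ q  ≈⟨ ^-homo-* u n q ⟨
             u ^ᵖ (n ℕ.+ q)  ≈⟨ ≡⇒≈ (cong (u ^ᵖ_) n+q) ⟩
             u ^ᵖ (suc s ℕ.+ q ℕ.* p)  ≈⟨ ^-homo-* u (suc s) (q ℕ.* p) ⟩
             u ^ᵖ suc s ⊠ u ^ᵖ (q ℕ.* p)  ≈⟨ *-congˡ {u ^ᵖ suc s} (trans (^-assoc u q p) e₂) ⟩
             u ^ᵖ suc s ⊠ (con (E u 0 ℤ.^ q) ⊞ con P ⊠ z₂) ∎)) ⟩
    con (P ℤ.^ (n ℕ.+ q)) ⊠ (ε ^ᵖ suc s ⊠ (u ^ᵖ suc s ⊠ (con (E u 0 ℤ.^ q) ⊞ con P ⊠ z₂)))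
      ≈⟨ *-congˡ {con (P ℤ.^ (n ℕ.+ q))} (begin
           ε ^ᵖ suc s ⊠ (u ^ᵖ suc s ⊠ (con (E u 0 ℤ.^ q) ⊞ con P ⊠ z₂))
             ≈⟨ *-assoc (ε ^ᵖ suc s) (u ^ᵖ suc s) _ ⟨
           ε ^ᵖ suc s ⊠ u ^ᵖ suc s ⊠ (con (E u 0 ℤ.^ q) ⊞ con P ⊠ z₂)
             ≈⟨ *-cong (trans (sym (^-distrib-* ε u (suc s))) (^-cong (suc s) (sym (lift g≈εu))))
                       (+-congʳ (≡⇒≈ (cong (λ a → con (a ℤ.^ q)) E-u-0))) ⟩
           g ^ᵖ suc s ⊠ (con ((ℤ.- 1ℤ) ℤ.^ q) ⊞ con P ⊠ z₂)
             ≈⟨ solve 4 (λ g c p z → g :* (c :+ p :* z) := c :* g :+ p :* (g :* z)) refl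
                  (g ^ᵖ suc s) (con ((ℤ.- 1ℤ) ℤ.^ q)) (con P) z₂ ⟩
           con ((ℤ.- 1ℤ) ℤ.^ q) ⊠ g ^ᵖ suc s ⊞ con P ⊠ (g ^ᵖ suc s ⊠ z₂) ∎) ⟩
    con (P ℤ.^ (n ℕ.+ q)) ⊠ (con ((ℤ.- 1ℤ) ℤ.^ q) ⊠ g ^ᵖ suc s ⊞ con P ⊠ (g ^ᵖ suc s ⊠ z₂)) ∎)
    where
    n = suc s ℕ.+ q ℕ.* l
    n+q : n ℕ.+ q ≡ suc s ℕ.+ q ℕ.* p
    n+q = ≡.trans (lemma (suc s) q l) (cong (λ m → suc s ℕ.+ q ℕ.* m) p≡1+l)
      where
      lemma : ∀ s q l → s ℕ.+ q ℕ.* l ℕ.+ q ≡ s ℕ.+ q ℕ.* suc l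
      lemma = ℕ-solve-∀

-- The exponent is kept as n = (k+1) p^v with p ∤ k + 1: the theorem divides by n, so the expansion of
-- (a + p w)^n is needed modulo p^(v+2) and not only modulo p².
module PowerExpansion (S : ℤAlgebra) (m h : ℕ) (p≡1+2h : suc (suc m) ≡ suc (h ℕ.+ h)) where
  open ℤAlgebra S
  open Alg S
  open import Relation.Binary.Reasoning.Setoid setoid

  private
    p : ℕ
    p = suc (suc m)
    P : ℤ
    P = + p

  -- Let h = Q (δ w + p r). The quadratic term gains one p from binom(p, 2) and one from h², as p
  -- divides Q; the cubic term gains two from h³. Both are multiples of p² Q and join the error
  -- term.
  step : ∀ {f w} A Q t δ r → Q ≡ P ℤ.* t → f ≈ ι A + ι Q * (ι δ * w + ι P * r) →
    Σ Carrier λ r′ → f ^ p ≈ ι (A ℤ.^ p) + ι (P ℤ.* Q) * (ι (A ℤ.^ suc m ℤ.* δ) * w + ι P * r′)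
  step {f} {w} A Q t δ r Q≡ e = let r₀ , e₀ = taylor₂ m (ι A) H in R r₀ , (begin
    f ^ p  ≈⟨ ^-cong p e ⟩
    (ι A + H) ^ p  ≈⟨ e₀ ⟩
    ι A ^ p + ι P * (ι A ^ suc m * H) + ι (+ triangle m) * (ι A ^ m * (H * H)) + H * (H * H) * r₀
      ≈⟨ +-congʳ (+-congˡ (*-congʳ (trans (≡⇒≈ (cong ι (≡.trans (cong +_ (triangle≡ m h p≡1+2h)) (ℤ.pos-* p h)))) (ι-* P (+ h))))) ⟩
    ι A ^ p + ι P * (ι A ^ suc m * H) + ι P * ι (+ h) * (ι A ^ m * (H * H)) + H * (H * H) * r₀
      ≈⟨ +-cong (+-congˡ (*-congˡ (*-congˡ (*-congˡ Q≈)))) (*-congʳ (*-congˡ (*-cong Q≈ Q≈))) ⟩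
    ι A ^ p + ι P * (ι A ^ suc m * H) + ι P * ι (+ h) * (ι A ^ m * (H * H′)) + H * (H′ * H′) * r₀
      ≈⟨ solve 9 (λ X Y Z P Q t h k r₀ →
            X :+ P :* (Y :* (Q :* k)) :+ P :* h :* (Z :* (Q :* k :* (P :* t :* k))) :+ Q :* k :* (P :* t :* k :* (P :* t :* k)) :* r₀
         := X :+ P :* Q :* (Y :* k :+ P :* (h :* (Z :* (k :* (t :* k))) :+ k :* (t :* k :* (t :* k)) :* r₀)))
           refl (ι A ^ p) (ι A ^ suc m) (ι A ^ m) (ι P) (ι Q) (ι t) (ι (+ h)) k r₀ ⟩
    ι A ^ p + ι P * ι Q * (ι A ^ suc m * (ι δ * w + ι P * r) + ι P * R₁ r₀)
      ≈⟨ +-congˡ (*-congˡ (solve 6 (λ Y δ w P r R → Y :* (δ :* w :+ P :* r) :+ P :* R := Y :* δ :* w :+ P :* (Y :* r :+ R))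
           refl (ι A ^ suc m) (ι δ) w (ι P) r (R₁ r₀))) ⟩
    ι A ^ p + ι P * ι Q * (ι A ^ suc m * ι δ * w + ι P * R r₀)
      ≈⟨ +-cong (ι-^ A p) (*-cong (ι-* P Q) (+-congʳ (*-congʳ (trans (ι-* _ δ) (*-congʳ (ι-^ A (suc m))))))) ⟨
    ι (A ℤ.^ p) + ι (P ℤ.* Q) * (ι (A ℤ.^ suc m ℤ.* δ) * w + ι P * R r₀) ∎)
    where
    k H H′ : Carrier
    k = ι δ * w + ι P * r
    H = ι Q * k
    H′ = ι P * ι t * k
    R₁ R : Carrier → Carrier
    R₁ r₀ = ι (+ h) * (ι A ^ m * (k * (ι t * k))) + k * (ι t * k * (ι t * k)) * r₀
    R r₀ = ι A ^ suc m * r + R₁ r₀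
    Q≈ : H ≈ H′
    Q≈ = *-congʳ (trans (≡⇒≈ (cong ι Q≡)) (ι-* P t))

  -- `δ` stands for a^(p^v - 1); the equation a δ = a^(p^v) expresses this without a subtraction in
  -- the exponent.
  expand-p^ : ∀ a w v → Σ ℤ λ δ → Σ Carrier λ r → (a ℤ.* δ ≡ a ℤ.^ (p ℕ.^ v)) ×
    ((ι a + ι P * w) ^ (p ℕ.^ v) ≈ ι (a ℤ.^ (p ℕ.^ v)) + ι (P ℤ.^ suc v) * (ι δ * w + ι P * r))
  expand-p^ a w zero    = 1ℤ , 0# , ≡.refl , (begin
    (ι a + ι P * w) * 1#
      ≈⟨ trans (*-identityʳ _) (solve 3 (λ a P w → a :+ P :* w := a :+ P :* (κ 1ℤ :* w :+ P :* κ 0ℤ)) refl (ι a) (ι P) w) ⟩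
    ι a + ι P * (ι 1ℤ * w + ι P * ι 0ℤ)
      ≈⟨ +-cong (≡⇒≈ (cong ι (ℤ.*-identityʳ a))) (*-cong (≡⇒≈ (cong ι (ℤ.*-identityʳ P))) (+-congˡ (*-congˡ (sym ι-0)))) ⟨
    ι (a ℤ.* 1ℤ) + ι (P ℤ.* 1ℤ) * (ι 1ℤ * w + ι P * 0#) ∎)
  expand-p^ a w (suc v) = let
      δ , r , aδ , e = expand-p^ a w v
      A = a ℤ.^ (p ℕ.^ v)
      r′ , e′ = step A (P ℤ.^ suc v) (P ℤ.^ v) δ r ≡.refl e
    in A ℤ.^ suc m ℤ.* δ , r′
    , ≡.trans (lemma a (A ℤ.^ suc m) δ) (≡.trans (cong (ℤ._* A ℤ.^ suc m) aδ) (A^p v))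
    , trans (^-assoc (ι a + ι P * w) p (p ℕ.^ v)) (trans e′ (+-congʳ (≡⇒≈ (cong ι (A^p v)))))
    where
    lemma : ∀ a b c → a ℤ.* (b ℤ.* c) ≡ (a ℤ.* c) ℤ.* b
    lemma = ℤ-solve-∀
    A^p : ∀ v → (a ℤ.^ (p ℕ.^ v)) ℤ.^ p ≡ a ℤ.^ (p ℕ.* p ℕ.^ v)
    A^p v = ≡.trans (ℤ.^-*-assoc a (p ℕ.^ v) p) (cong (a ℤ.^_) (ℕ.*-comm (p ℕ.^ v) p))

  -- A product of two corrections is a multiple of Q² = p t Q and joins the error term.
  expand-* : ∀ {f w} A Q t δ r → Q ≡ P ℤ.* t → f ≈ ι A + ι Q * (ι δ * w + ι P * r) → ∀ k →
    Σ Carrier λ r′ → f ^ suc k ≈ ι (A ℤ.^ suc k) + ι Q * (ι (+ suc k ℤ.* (A ℤ.^ k ℤ.* δ)) * w + ι P * r′)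
  expand-* {f} {w} A Q t δ r Q≡ e zero = r , (begin
    f * 1#  ≈⟨ *-identityʳ f ⟩
    f  ≈⟨ e ⟩
    ι A + ι Q * (ι δ * w + ι P * r)
      ≈⟨ +-cong (≡⇒≈ (cong ι (ℤ.*-identityʳ A))) (*-congˡ (+-congʳ (*-congʳ (≡⇒≈ (cong ι (lemma δ)))))) ⟨
    ι (A ℤ.* 1ℤ) + ι Q * (ι (1ℤ ℤ.* (1ℤ ℤ.* δ)) * w + ι P * r) ∎)
    where
    lemma : ∀ δ → 1ℤ ℤ.* (1ℤ ℤ.* δ) ≡ δ
    lemma = ℤ-solve-∀
  expand-* {f} {w} A Q t δ r Q≡ e (suc k) = let
      r′ , e′ = expand-* A Q t δ r Q≡ e k
    in ι A * r′ + r * ι B + ι t * ((ι δ * w + ι P * r) * (ι D * w + ι P * r′)) , (begin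
    f * f ^ suc k  ≈⟨ *-cong e e′ ⟩
    (ι A + ι Q * (ι δ * w + ι P * r)) * (ι B + ι Q * (ι D * w + ι P * r′))
      ≈⟨ solve 6 (λ A B Q δw x y → (A :+ Q :* x) :* (B :+ Q :* y) := A :* B :+ Q :* (A :* y :+ x :* B :+ Q :* (x :* y)))
           refl (ι A) (ι B) (ι Q) w (ι δ * w + ι P * r) (ι D * w + ι P * r′) ⟩
    ι A * ι B + ι Q * (ι A * (ι D * w + ι P * r′) + (ι δ * w + ι P * r) * ι B + ι Q * kk r′)
      ≈⟨ +-congˡ (*-congˡ (+-congˡ (*-congʳ (trans (≡⇒≈ (cong ι Q≡)) (ι-* P t))))) ⟩
    ι A * ι B + ι Q * (ι A * (ι D * w + ι P * r′) + (ι δ * w + ι P * r) * ι B + ι P * ι t * kk r′)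
      ≈⟨ +-congˡ (*-congˡ (solve 10 (λ A B D δ w P r r′ t K →
           A :* (D :* w :+ P :* r′) :+ (δ :* w :+ P :* r) :* B :+ P :* t :* K
           := (A :* D :+ B :* δ) :* w :+ P :* (A :* r′ :+ r :* B :+ t :* K))
           refl (ι A) (ι B) (ι D) (ι δ) w (ι P) r r′ (ι t) (kk r′))) ⟩
    ι A * ι B + ι Q * ((ι A * ι D + ι B * ι δ) * w + ι P * R r′)
      ≈⟨ +-cong (ι-* A B) (*-congˡ (+-congʳ (*-congʳ (trans (≡⇒≈ (cong ι (lemma (+ suc k) A (A ℤ.^ k) δ)))
           (trans (ι-+ _ _) (+-cong (ι-* A D) (ι-* B δ))))))) ⟨
    ι (A ℤ.* B) + ι Q * (ι (+ suc (suc k) ℤ.* (B ℤ.* δ)) * w + ι P * R r′) ∎)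
    where
    B = A ℤ.^ suc k
    D = + suc k ℤ.* (A ℤ.^ k ℤ.* δ)
    kk R : Carrier → Carrier
    kk r′ = (ι δ * w + ι P * r) * (ι D * w + ι P * r′)
    R r′ = ι A * r′ + r * ι B + ι t * kk r′
    lemma : ∀ c A B δ → (1ℤ ℤ.+ c) ℤ.* (A ℤ.* B ℤ.* δ) ≡ A ℤ.* (c ℤ.* (B ℤ.* δ)) ℤ.+ A ℤ.* B ℤ.* δ
    lemma = ℤ-solve-∀

  expand : ∀ a w v k → let n = suc k ℕ.* p ℕ.^ v in Σ ℤ λ δ → Σ Carrier λ r → (a ℤ.* δ ≡ a ℤ.^ n) ×
    ((ι a + ι P * w) ^ n ≈ ι (a ℤ.^ n) + ι (P ℤ.^ suc v) * (ι (+ suc k ℤ.* δ) * w + ι P * r))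
  expand a w v k = let
      δ , r , aδ , e = expand-p^ a w v
      A = a ℤ.^ (p ℕ.^ v)
      r′ , e′ = expand-* A (P ℤ.^ suc v) (P ℤ.^ v) δ r ≡.refl e k
    in A ℤ.^ k ℤ.* δ , r′
    , ≡.trans (lemma a (A ℤ.^ k) δ) (≡.trans (cong (ℤ._* A ℤ.^ k) aδ) A^n)
    , trans (^-assoc _ (suc k) (p ℕ.^ v)) (trans e′ (+-congʳ (≡⇒≈ (cong ι A^n))))
    where
    lemma : ∀ a b c → a ℤ.* (b ℤ.* c) ≡ (a ℤ.* c) ℤ.* b
    lemma = ℤ-solve-∀
    A^n : (a ℤ.^ (p ℕ.^ v)) ℤ.^ suc k ≡ a ℤ.^ (suc k ℕ.* p ℕ.^ v)
    A^n = ≡.trans (ℤ.^-*-assoc a (p ℕ.^ v) (suc k)) (cong (a ℤ.^_) (ℕ.*-comm (p ℕ.^ v) (suc k)))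

-- Invariance under x ↦ x^a

module Galois {m : ℕ} (pr : Prime (suc (suc m))) (h : ℕ) (p≡1+2h : suc (suc m) ≡ suc (h ℕ.+ h)) where
  p : ℕ
  p = suc (suc m)
  open PrimeMod pr
  open OddPrime pr h p≡1+2h
  open Trace pr
  open CyclicPrime pr h p≡1+2h
  open Cyclic p using () renaming (algebra to cyclic)
  open PowerExpansion cyclic m h p≡1+2h using (expand)

  -- The cofactor in A^p = A(x^p) + p w for A = 1 + ... + x^(a-1). It is taken in ℤ[x] for the sake
  -- of its moments; in ℤ[x]/(x^p - 1) the same w satisfies A^p = a + p w.
  w : ℕ → Poly
  w a = proj₁ (frobenius (geometric a))

  -- Invariance of T under x ↦ x^a turns T(ε^N) into T((ε (1 + x + ... + x^(a-1)))^N).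
  galois : ∀ {a} → ¬ p ℕ.∣ a → ∀ s q v k → let n = suc s ℕ.+ q ℕ.* suc m in n ≡ suc k ℕ.* p ℕ.^ v →
    Σ ℤ λ δ → Σ ℤ λ t → ((+ a) ℤ.* δ ≡ (+ a) ℤ.^ n) ×
      ((1ℤ ℤ.- (+ a) ℤ.^ n) ℤ.* T (ε ^ᵖ (n ℕ.* p)) ≡ P ℤ.^ suc v ℤ.* (P ℤ.^ (n ℕ.+ q) ℤ.*
        ((+ suc k) ℤ.* δ ℤ.* (ℤ.- 1ℤ) ℤ.^ q ℤ.* T (g ^ᵖ suc s ⊠ w a) ℤ.+ P ℤ.* t)))
  galois {a} p∤a s q v k n≡ = let
      z , e-ε = ε^[pn] s q
      δ , r , aδ , e-A = expand (+ a) (w a) v k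
      G = con σ ⊠ g ^ᵖ suc s ⊞ con P ⊠ z
      B = con (+ suc k ℤ.* δ) ⊠ w a ⊞ con P ⊠ r
      R = con (+ suc k ℤ.* δ) ⊠ (z ⊠ w a) ⊞ G ⊠ r
      e-A^N : geometric a ^ᵖ (n ℕ.* p) ≈ con ((+ a) ℤ.^ n) ⊞ con (P ℤ.^ suc v) ⊠ B
      e-A^N = begin
        geometric a ^ᵖ (n ℕ.* p)  ≈⟨ ^-assoc (geometric a) n p ⟩
        (geometric a ^ᵖ p) ^ᵖ n  ≈⟨ ^-cong n A^p ⟩
        (con (+ a) ⊞ con P ⊠ w a) ^ᵖ n  ≈⟨ ≡⇒≈ (cong ((con (+ a) ⊞ con P ⊠ w a) ^ᵖ_) n≡) ⟩
        (con (+ a) ⊞ con P ⊠ w a) ^ᵖ (suc k ℕ.* p ℕ.^ v) ≈⟨ e-A ⟩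
        con ((+ a) ℤ.^ (suc k ℕ.* p ℕ.^ v)) ⊞ con (P ℤ.^ suc v) ⊠ B
          ≈⟨ +-congʳ (≡⇒≈ (cong (λ j → con ((+ a) ℤ.^ j)) n≡)) ⟨
        con ((+ a) ℤ.^ n) ⊞ con (P ℤ.^ suc v) ⊠ B ∎
      e-GB : G ⊠ B ≈ con (+ suc k ℤ.* δ ℤ.* σ) ⊠ (g ^ᵖ suc s ⊠ w a) ⊞ con P ⊠ R
      e-GB = begin
        G ⊠ B
          ≈⟨ solve 7 (λ σ g P z c w r → (σ :* g :+ P :* z) :* (c :* w :+ P :* r)
                := (c :* σ) :* (g :* w) :+ P :* (c :* (z :* w) :+ (σ :* g :+ P :* z) :* r)) refl
               (con σ) (g ^ᵖ suc s) (con P) z (con (+ suc k ℤ.* δ)) (w a) r ⟩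
        con (+ suc k ℤ.* δ) ⊠ con σ ⊠ (g ^ᵖ suc s ⊠ w a) ⊞ con P ⊠ R
          ≈⟨ +-congʳ (*-congʳ {g ^ᵖ suc s ⊠ w a} (ι-* (+ suc k ℤ.* δ) σ)) ⟨
        con (+ suc k ℤ.* δ ℤ.* σ) ⊠ (g ^ᵖ suc s ⊠ w a) ⊞ con P ⊠ R ∎
      e-total : sub a (ε ^ᵖ (n ℕ.* p)) ≈ con ((+ a) ℤ.^ n) ⊠ ε ^ᵖ (n ℕ.* p) ⊞ con (P ℤ.^ suc v) ⊠
                  (con (P ℤ.^ (n ℕ.+ q)) ⊠ (con (+ suc k ℤ.* δ ℤ.* σ) ⊠ (g ^ᵖ suc s ⊠ w a) ⊞ con P ⊠ R))
      e-total = begin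
        sub a (ε ^ᵖ (n ℕ.* p))  ≈⟨ ≡⇒≈ (sub-^ a ε (n ℕ.* p)) ⟩
        (X ^ᵖ a ⊞ con (ℤ.- 1ℤ)) ^ᵖ (n ℕ.* p)  ≈⟨ ^-cong (n ℕ.* p) (lift (ε-geometric a)) ⟨
        (ε ⊠ geometric a) ^ᵖ (n ℕ.* p)  ≈⟨ ^-distrib-* ε (geometric a) (n ℕ.* p) ⟩
        ε ^ᵖ (n ℕ.* p) ⊠ geometric a ^ᵖ (n ℕ.* p)  ≈⟨ *-congˡ {ε ^ᵖ (n ℕ.* p)} e-A^N ⟩
        ε ^ᵖ (n ℕ.* p) ⊠ (con ((+ a) ℤ.^ n) ⊞ con (P ℤ.^ suc v) ⊠ B)
          ≈⟨ solve 4 (λ e a p b → e :* (a :+ p :* b) := a :* e :+ p :* (e :* b)) refl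
               (ε ^ᵖ (n ℕ.* p)) (con ((+ a) ℤ.^ n)) (con (P ℤ.^ suc v)) B ⟩
        con ((+ a) ℤ.^ n) ⊠ ε ^ᵖ (n ℕ.* p) ⊞ con (P ℤ.^ suc v) ⊠ (ε ^ᵖ (n ℕ.* p) ⊠ B)
          ≈⟨ +-congˡ (*-congˡ {con (P ℤ.^ suc v)} (begin
               ε ^ᵖ (n ℕ.* p) ⊠ B  ≈⟨ *-congʳ {B} e-ε ⟩
               con (P ℤ.^ (n ℕ.+ q)) ⊠ G ⊠ B  ≈⟨ *-assoc (con (P ℤ.^ (n ℕ.+ q))) G B ⟩
               con (P ℤ.^ (n ℕ.+ q)) ⊠ (G ⊠ B)  ≈⟨ *-congˡ {con (P ℤ.^ (n ℕ.+ q))} e-GB ⟩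
               con (P ℤ.^ (n ℕ.+ q)) ⊠ (con (+ suc k ℤ.* δ ℤ.* σ) ⊠ (g ^ᵖ suc s ⊠ w a) ⊞ con P ⊠ R) ∎)) ⟩
        con ((+ a) ℤ.^ n) ⊠ ε ^ᵖ (n ℕ.* p) ⊞ con (P ℤ.^ suc v) ⊠
                  (con (P ℤ.^ (n ℕ.+ q)) ⊠ (con (+ suc k ℤ.* δ ℤ.* σ) ⊠ (g ^ᵖ suc s ⊠ w a) ⊞ con P ⊠ R)) ∎
    in δ , T R , ≡.trans aδ (cong ((+ a) ℤ.^_) (≡.sym n≡))
    , rearrange (T (ε ^ᵖ (n ℕ.* p))) ((+ a) ℤ.^ n) _ (≡.trans (≡.sym (T-sub p∤a (ε ^ᵖ (n ℕ.* p)))) (T-cong e-total))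
    where
    open ℤAlgebra cyclic
    open Alg cyclic
    open import Relation.Binary.Reasoning.Setoid setoid
    n = suc s ℕ.+ q ℕ.* suc m
    σ = (ℤ.- 1ℤ) ℤ.^ q
    A^p : geometric a ^ᵖ p ≈ con (+ a) ⊞ con P ⊠ w a
    A^p = begin
      geometric a ^ᵖ p  ≈⟨ lift (proj₂ (frobenius (geometric a))) ⟩
      sub p (geometric a) ⊞ con P ⊠ w a  ≈⟨ +-congʳ (sub-p (geometric a)) ⟩
      con (E (geometric a) 0) ⊞ con P ⊠ w a  ≈⟨ +-congʳ (≡⇒≈ (cong con (E-geometric-0 a))) ⟩
      con (+ a) ⊞ con P ⊠ w a  ∎
    rearrange : ∀ y a b → y ≡ a ℤ.* y ℤ.+ b → (1ℤ ℤ.- a) ℤ.* y ≡ b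
    rearrange y a b e = ≡.trans (lemma y a) (≡.trans (cong (ℤ._- a ℤ.* y) e) (lemma′ (a ℤ.* y) b))
      where
      lemma : ∀ y a → (1ℤ ℤ.- a) ℤ.* y ≡ y ℤ.- a ℤ.* y
      lemma = ℤ-solve-∀
      lemma′ : ∀ c b → c ℤ.+ b ℤ.- c ≡ b
      lemma′ = ℤ-solve-∀

-- The moments of `w` modulo p

var : Seq
var 0             = 0ℤ
var 1             = 1ℤ
var (suc (suc j)) = 0ℤ

var-⊛ : ∀ v j → (var ⊛ v) (suc j) ≡ + suc j ℤ.* v j
var-⊛ v j = ≡.trans (cong (ℤ._+ (var ⊛ shift v) j) (shift-var-⊛ v j)) (go v j)
  where
  shift-var : ∀ j → shift var j ≡ constant 1ℤ j
  shift-var zero    = ≡.refl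
  shift-var (suc j) = ≡.refl
  shift-var-⊛ : ∀ v j → (shift var ⊛ v) j ≡ v j
  shift-var-⊛ v j = ≡.trans (⊛-cong shift-var (λ _ → ≡.refl) j) (≡.trans (⊛-constant 1ℤ v j) (ℤ.*-identityˡ _))
  go : ∀ v j → v j ℤ.+ (var ⊛ shift v) j ≡ + suc j ℤ.* v j
  go v zero    = ≡.trans (ℤ.+-identityʳ _) (≡.sym (ℤ.*-identityˡ _))
  go v (suc j) = ≡.trans (cong (λ a → v (suc j) ℤ.+ a) (var-⊛ (shift v) j)) (lemma (v (suc j)) (+ suc j))
    where
    lemma : ∀ a c → a ℤ.+ c ℤ.* a ≡ (1ℤ ℤ.+ c) ℤ.* a
    lemma = ℤ-solve-∀

shift-^ : ∀ u n j → shift (u ^ˢ suc n) j ≡ + suc n ℤ.* (u ^ˢ n ⊛ shift u) j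
shift-^ u zero j = begin
  (shift u ⊛ constant 1ℤ) j ℤ.+ (u ⊛ shift (constant 1ℤ)) j
    ≡⟨ cong₂ ℤ._+_ (⊛-comm (shift u) _ j) (≡.trans (⊛-comm u _ j) (⊛-zeroˡ u (λ _ → ≡.refl) j)) ⟩
  (constant 1ℤ ⊛ shift u) j ℤ.+ 0ℤ  ≡⟨ ℤ.+-identityʳ _ ⟩
  (constant 1ℤ ⊛ shift u) j  ≡⟨ ℤ.*-identityˡ _ ⟨
  1ℤ ℤ.* (constant 1ℤ ⊛ shift u) j  ∎
  where open ≡-Reasoning
shift-^ u (suc n) j = begin
  (shift u ⊛ u ^ˢ suc n) j ℤ.+ (u ⊛ shift (u ^ˢ suc n)) j
    ≡⟨ cong₂ ℤ._+_ (⊛-comm (shift u) _ j) (⊛-cong {u = u} (λ _ → ≡.refl) (shift-^ u n) j) ⟩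
  (u ^ˢ suc n ⊛ shift u) j ℤ.+ (u ⊛ (λ i → c ℤ.* (u ^ˢ n ⊛ shift u) i)) j
    ≡⟨ cong (λ a → (u ^ˢ suc n ⊛ shift u) j ℤ.+ a) (≡.trans (⊛-scalarʳ c u (u ^ˢ n ⊛ shift u) j)
         (cong (c ℤ.*_) (≡.sym (⊛-assoc u (u ^ˢ n) (shift u) j)))) ⟩
  (u ^ˢ suc n ⊛ shift u) j ℤ.+ c ℤ.* (u ^ˢ suc n ⊛ shift u) j
    ≡⟨ lemma ((u ^ˢ suc n ⊛ shift u) j) c ⟩
  (1ℤ ℤ.+ c) ℤ.* (u ^ˢ suc n ⊛ shift u) j ∎
  where
  open ≡-Reasoning
  c = + suc n
  lemma : ∀ a c → a ℤ.+ c ℤ.* a ≡ (1ℤ ℤ.+ c) ℤ.* a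
  lemma = ℤ-solve-∀

-- With e = e^z - 1, f = e^{az} - 1 and A = f/e, the series D = a A′/A satisfies
-- z D = a ((a - 1) z + β(az) - β(z)), where β(z) = z/(e^z - 1); cleared of denominators.
module LogDerivative (S : ℤAlgebra) where
  open ℤAlgebra S
  open Alg S
  open import Relation.Binary.Reasoning.Setoid setoid

  log-derivative : ∀ c {x y A A′ D β βₐ z} →
    (x - ι 1ℤ) * A ≈ y - ι 1ℤ → x * A + (x - ι 1ℤ) * A′ ≈ c * y → A * D ≈ c * A′ →
    (x - ι 1ℤ) * β ≈ z → (y - ι 1ℤ) * βₐ ≈ c * z →
    z * (z * (c * (c * ((c - ι 1ℤ) * z + (βₐ - β)) - z * D))) ≈ 0#
  log-derivative c {x} {y} {A} {A′} {D} {β} {βₐ} {z} eA eA′ AD eβ fβₐ = begin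
    -- The factors z and cz are replaced by e β and f βₐ: then e and f clear the denominators of β,
    -- βₐ and D.
    z * (z * (c * Y))  ≈⟨ solve 3 (λ z c Y → z :* (z :* (c :* Y)) := (c :* z) :* (z :* Y)) refl z c Y ⟩
    (c * z) * (z * Y)  ≈⟨ *-cong fβₐ (*-congʳ eβ) ⟨
    (f * βₐ) * ((e * β) * Y)
      ≈⟨ solve 9 (λ e f β βₐ c z D A Y →
           (f :* βₐ) :* ((e :* β) :* (c :* ((c :- κ 1ℤ) :* z :+ (βₐ :- β)) :- z :* D)) :=
           (βₐ :* β) :* (c :* ((c :- κ 1ℤ) :* z :* (e :* f) :+ (e :* (f :* βₐ) :- f :* (e :* β))) :- z :* (e :* (f :* D))))
           refl e f β βₐ c z D A Y ⟩
    (βₐ * β) * (c * ((c - ι 1ℤ) * z * (e * f) + (e * (f * βₐ) - f * (e * β))) - z * (e * (f * D)))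
      ≈⟨ *-congˡ (+-cong (*-congˡ (+-congˡ (+-cong (*-congˡ fβₐ) (-‿cong (*-congˡ eβ))))) (-‿cong (*-congˡ (*-congˡ fD)))) ⟩
    (βₐ * β) * (c * ((c - ι 1ℤ) * z * (e * f) + (e * (c * z) - f * z)) - z * (e * (c * (c * y - x * A))))
      ≈⟨ *-congˡ (+-congˡ (-‿cong (solve 6 (λ z e c y x A →
           z :* (e :* (c :* (c :* y :- x :* A))) := z :* (c :* (c :* (e :* y) :- x :* (e :* A)))) refl z e c y x A))) ⟩
    (βₐ * β) * (c * ((c - ι 1ℤ) * z * (e * f) + (e * (c * z) - f * z)) - z * (c * (c * (e * y) - x * (e * A))))
      ≈⟨ *-congˡ (+-congˡ (-‿cong (*-congˡ (*-congˡ (+-congˡ (-‿cong (*-congˡ eA))))))) ⟩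
    (βₐ * β) * (c * ((c - ι 1ℤ) * z * (e * f) + (e * (c * z) - f * z)) - z * (c * (c * (e * y) - x * f)))
      ≈⟨ solve 5 (λ B c z x y → B :* (c :* ((c :- κ 1ℤ) :* z :* ((x :- κ 1ℤ) :* (y :- κ 1ℤ))
              :+ ((x :- κ 1ℤ) :* (c :* z) :- (y :- κ 1ℤ) :* z)) :-
            z :* (c :* (c :* ((x :- κ 1ℤ) :* y) :- x :* (y :- κ 1ℤ)))) := κ 0ℤ) refl (βₐ * β) c z x y ⟩
    ι 0ℤ  ≈⟨ ι-0 ⟩
    0# ∎
    where
    e = x - ι 1ℤ
    f = y - ι 1ℤ
    Y = c * ((c - ι 1ℤ) * z + (βₐ - β)) - z * D
    fD : f * D ≈ c * (c * y - x * A)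
    fD = begin
      f * D  ≈⟨ *-congʳ eA ⟨
      e * A * D  ≈⟨ trans (*-assoc e A D) (*-congˡ AD) ⟩
      e * (c * A′)  ≈⟨ solve 4 (λ e c A′ u → e :* (c :* A′) := c :* (u :+ e :* A′ :- u)) refl e c A′ (x * A) ⟩
      c * (x * A + e * A′ - x * A)  ≈⟨ *-congˡ (+-congʳ eA′) ⟩
      c * (c * y - x * A) ∎

module Moments {m : ℕ} (pr : Prime (suc (suc m))) (h : ℕ) (p≡1+2h : suc (suc m) ≡ suc (h ℕ.+ h)) where
  open Galois pr h p≡1+2h using (p; w)
  open PrimeMod pr
  open OddPrime pr h p≡1+2h
  open Trace pr
  open Hurwitz P p using (⟪_⟫; at) renaming (algebra to hurwitz; ≡⇒≈ to pointwise)
  module 𝓗 where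
    open ℤAlgebra hurwitz public
    open Alg hurwitz public

  E-g : E g 𝓗.≈ (𝓗.- var)
  E-g = ⟪ go ⟫
    where
    go : ∀ j → j ℕ.< p → E g j ≅ ℤ.- var j [ P ]
    go 0 _ = Mod.≡⇒≅ P E-g-0
    go 1 j<p = Mod.≡⇒≅ P (E-g-suc 0 j<p)
    go (suc (suc j)) j<p = ℤ.- (P ℤ.^ j) , ≡.trans (E-g-suc (suc j) j<p) (lemma P (P ℤ.^ j))
      where
      lemma : ∀ p a → ℤ.- (p ℤ.* a) ≡ 0ℤ ℤ.+ p ℤ.* ℤ.- a
      lemma = ℤ-solve-∀

  -- Each factor E g ≡ -z multiplies the coefficient by -(s+k+1), and -(s+k+1) ≡ t + 1 as s + k + 1 + t + 1 = p.
  E-g^ : ∀ v s k t → s ℕ.+ k ℕ.+ t ≡ suc m →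
    (E g ^ˢ s ⊛ v) (s ℕ.+ k) ℤ.* + (t !) ≅ + ((s ℕ.+ t) !) ℤ.* v k [ P ]
  E-g^ v zero    k t e = Mod.≡⇒≅ P (≡.trans (cong (ℤ._* + (t !)) (≡.trans (⊛-constant 1ℤ v k) (ℤ.*-identityˡ (v k)))) (ℤ.*-comm (v k) _))
  E-g^ v (suc s) k t e = begin
    (E g ⊛ E g ^ˢ s ⊛ v) (suc (s ℕ.+ k)) ℤ.* + (t !)
      ≈⟨ *-congʳ (≡⇒≈ (⊛-assoc (E g) (E g ^ˢ s) v (suc (s ℕ.+ k)))) ⟩
    (E g ⊛ V) (suc (s ℕ.+ k)) ℤ.* + (t !)
      ≈⟨ *-congʳ (at (𝓗.*-congʳ {V} E-g) (suc (s ℕ.+ k)) j<p) ⟩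
    ((λ j → ℤ.- var j) ⊛ V) (suc (s ℕ.+ k)) ℤ.* + (t !)
      ≈⟨ *-congʳ (≡⇒≈ (≡.trans (⊛-cong (λ j → ≡.sym (ℤ.-1*i≡-i (var j))) (λ _ → ≡.refl) (suc (s ℕ.+ k)))
           (≡.trans (⊛-scalarˡ (ℤ.- 1ℤ) var V (suc (s ℕ.+ k))) (cong (ℤ.- 1ℤ ℤ.*_) (var-⊛ V (s ℕ.+ k)))))) ⟩
    ℤ.- 1ℤ ℤ.* (+ suc (s ℕ.+ k) ℤ.* V (s ℕ.+ k)) ℤ.* + (t !)
      ≈⟨ ℤ.- V (s ℕ.+ k) ℤ.* + (t !) , ≡.trans (lemma (+ suc (s ℕ.+ k)) (+ suc t) (V (s ℕ.+ k)) (+ (t !)))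
           (cong (λ c → V (s ℕ.+ k) ℤ.* (+ suc t ℤ.* + (t !)) ℤ.+ + c ℤ.* (ℤ.- V (s ℕ.+ k) ℤ.* + (t !))) sum≡p) ⟩
    V (s ℕ.+ k) ℤ.* (+ suc t ℤ.* + (t !))
      ≈⟨ *-congˡ {V (s ℕ.+ k)} (≡⇒≈ (≡.sym (ℤ.pos-* (suc t) (t !)))) ⟩
    V (s ℕ.+ k) ℤ.* + (suc t !)
      ≈⟨ E-g^ v s k (suc t) (≡.trans (ℕ.+-suc (s ℕ.+ k) t) e) ⟩
    + ((s ℕ.+ suc t) !) ℤ.* v k
      ≈⟨ ≡⇒≈ (cong (λ n → + (n !) ℤ.* v k) (ℕ.+-suc s t)) ⟩
    + ((suc s ℕ.+ t) !) ℤ.* v k ∎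
    where
    open ℤ/p
    V = E g ^ˢ s ⊛ v
    j<p : suc (s ℕ.+ k) ℕ.< p
    j<p = s≤s (ℕ.≤-trans (ℕ.m≤m+n (suc (s ℕ.+ k)) t) (ℕ.≤-reflexive e))
    sum≡p : suc (s ℕ.+ k) ℕ.+ suc t ≡ p
    sum≡p = ≡.trans (ℕ.+-suc (suc (s ℕ.+ k)) t) (cong suc e)
    lemma : ∀ j t v f → ℤ.- 1ℤ ℤ.* (j ℤ.* v) ℤ.* f ≡ v ℤ.* (t ℤ.* f) ℤ.+ (j ℤ.+ t) ℤ.* (ℤ.- v ℤ.* f)
    lemma = ℤ-solve-∀

  -- By Fermat `T-moment` applies with exponent p - 1. The coefficient of index 0 vanishes with
  -- g(1), and the one of index p - 1 is the case t = 0 of `E-g^`.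
  T-g^ : ∀ f s k → suc s ℕ.+ k ≡ suc m → T (g ^ᵖ suc s ⊠ f) ≅ ℤ.- (+ (suc s !) ℤ.* E f k) [ P ]
  T-g^ f s k e = begin
    T (g ^ᵖ suc s ⊠ f)  ≈⟨ T-moment P (suc m) (λ c → fermat′) zero^ (g ^ᵖ suc s ⊠ f) ⟩
    E g 0 ℤ.* E (g ^ᵖ s) 0 ℤ.* E f 0 ℤ.- (E (g ^ᵖ suc s) ⊛ E f) (suc m)
      ≈⟨ +-cong (≡⇒≈ (cong (λ a → a ℤ.* E (g ^ᵖ s) 0 ℤ.* E f 0) E-g-0)) (-‿cong top) ⟩
    0ℤ ℤ.- + (suc s !) ℤ.* E f k  ≈⟨ ≡⇒≈ (ℤ.+-identityˡ _) ⟩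
    ℤ.- (+ (suc s !) ℤ.* E f k)  ∎
    where
    open ℤ/p
    zero^ : ∀ c → c ≅ 0ℤ [ P ] → c ℤ.^ suc m ≅ 0ℤ [ P ]
    zero^ c e = trans (*-congʳ {c ℤ.^ m} e) (≡⇒≈ (ℤ.*-zeroˡ (c ℤ.^ m)))
    top : (E (g ^ᵖ suc s) ⊛ E f) (suc m) ≅ + (suc s !) ℤ.* E f k [ P ]
    top = begin
      (E (g ^ᵖ suc s) ⊛ E f) (suc m)
        ≈⟨ ≡⇒≈ (cong₂ (λ u j → (u ⊛ E f) j) (E-^ g (suc s)) (≡.sym e)) ⟩
      (E g ^ˢ suc s ⊛ E f) (suc s ℕ.+ k)  ≈⟨ ≡⇒≈ (ℤ.*-identityʳ _) ⟨
      (E g ^ˢ suc s ⊛ E f) (suc s ℕ.+ k) ℤ.* 1ℤ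
        ≈⟨ E-g^ (E f) (suc s) k 0 (≡.trans (ℕ.+-identityʳ _) e) ⟩
      + ((suc s ℕ.+ 0) !) ℤ.* E f k  ≈⟨ ≡⇒≈ (cong (λ n → + (n !) ℤ.* E f k) (ℕ.+-identityʳ (suc s))) ⟩
      + (suc s !) ℤ.* E f k  ∎

  module _ (β : Seq) (εβ≈z : (E ε ⊛ β) 𝓗.≈ var) (a : ℕ) (p∤a : p∤ (+ a)) where
    private
      c : ℤ
      c = + a
      A D : Seq
      A = E (geometric a)
      D = A ^ˢ suc m ⊛ shift A

    p-th-power : ∀ j → (A ^ˢ p) j ≡ P ℤ.^ j ℤ.* A j ℤ.+ P ℤ.* E (w a) j
    p-th-power j = begin
      (A ^ˢ p) j  ≡⟨ cong (λ u → u j) (E-^ (geometric a) p) ⟨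
      E (geometric a ^ᵖ p) j  ≡⟨ E-cong (proj₂ (frobenius (geometric a))) j ⟩
      E (sub p (geometric a)) j ℤ.+ (constant P ⊛ E (w a)) j
        ≡⟨ cong₂ ℤ._+_ (E-sub p (geometric a) j) (⊛-constant P (E (w a)) j) ⟩
      P ℤ.^ j ℤ.* A j ℤ.+ P ℤ.* E (w a) j  ∎
      where open ≡-Reasoning

    -- Differentiate A^p = A(x^p) + p w at x = e^z and divide by p: this leaves w′ ≡ A^(p-1) A′. The
    -- contribution of A(x^p) at index j is p^(j-1) A_j, which vanishes modulo p from j = 2 on.
    E-w : ∀ k → E (w a) (suc (suc k)) ≅ D (suc k) [ P ]
    E-w k = ℤ.- (P ℤ.^ k ℤ.* A (suc (suc k))) , ℤ.*-cancelˡ-≡ P _ _ (begin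
      P ℤ.* E (w a) (suc (suc k))  ≡⟨ lemma (P ℤ.* (P ℤ.* P ℤ.^ k) ℤ.* A (suc (suc k))) (P ℤ.* E (w a) (suc (suc k))) ⟩
      P ℤ.* (P ℤ.* P ℤ.^ k) ℤ.* A (suc (suc k)) ℤ.+ P ℤ.* E (w a) (suc (suc k)) ℤ.- P ℤ.* (P ℤ.* P ℤ.^ k) ℤ.* A (suc (suc k))
        ≡⟨ cong (ℤ._- P ℤ.* (P ℤ.* P ℤ.^ k) ℤ.* A (suc (suc k))) (p-th-power (suc (suc k))) ⟨
      (A ^ˢ p) (suc (suc k)) ℤ.- P ℤ.* (P ℤ.* P ℤ.^ k) ℤ.* A (suc (suc k))
        ≡⟨ cong (ℤ._- P ℤ.* (P ℤ.* P ℤ.^ k) ℤ.* A (suc (suc k))) (shift-^ A (suc m) (suc k)) ⟩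
      P ℤ.* D (suc k) ℤ.- P ℤ.* (P ℤ.* P ℤ.^ k) ℤ.* A (suc (suc k))
        ≡⟨ lemma′ P (P ℤ.^ k) (D (suc k)) (A (suc (suc k))) ⟩
      P ℤ.* (D (suc k) ℤ.+ P ℤ.* ℤ.- (P ℤ.^ k ℤ.* A (suc (suc k)))) ∎)
      where
      open ≡-Reasoning
      lemma : ∀ a b → b ≡ a ℤ.+ b ℤ.- a
      lemma = ℤ-solve-∀
      lemma′ : ∀ p q d a → p ℤ.* d ℤ.- p ℤ.* (p ℤ.* q) ℤ.* a ≡ p ℤ.* (d ℤ.+ p ℤ.* ℤ.- (q ℤ.* a))
      lemma′ = ℤ-solve-∀

    private
      e≈ : ∀ b j → (expo b 𝓗.- constant 1ℤ) j ≡ (expo b ⊕ constant (ℤ.- 1ℤ)) j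
      e≈ b zero    = ≡.refl
      e≈ b (suc j) = ≡.refl

      eA : (expo 1ℤ 𝓗.- constant 1ℤ) ⊛ A 𝓗.≈ expo c 𝓗.- constant 1ℤ
      eA = pointwise λ j → ≡.trans (⊛-cong (e≈ 1ℤ) (λ _ → ≡.refl) j) (≡.trans (E-cong (ε-geometric a) j)
        (≡.trans (cong (ℤ._+ constant (ℤ.- 1ℤ) j) (expo-X^ a j)) (≡.sym (e≈ c j))))

      eA′ : expo 1ℤ ⊛ A ⊕ (expo 1ℤ 𝓗.- constant 1ℤ) ⊛ shift A 𝓗.≈ constant c ⊛ expo c
      eA′ = pointwise λ j → begin
        (expo 1ℤ ⊛ A) j ℤ.+ ((expo 1ℤ 𝓗.- constant 1ℤ) ⊛ shift A) j
          ≡⟨ cong₂ ℤ._+_ (⊛-cong shift-ε (λ _ → ≡.refl) j) (⊛-cong (e≈ 1ℤ) (λ _ → ≡.refl) j) ⟩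
        (E ε ⊛ A) (suc j)  ≡⟨ E-cong (ε-geometric a) (suc j) ⟩
        E (X ^ᵖ a) (suc j) ℤ.+ 0ℤ  ≡⟨ ≡.trans (ℤ.+-identityʳ _) (expo-X^ a (suc j)) ⟩
        c ℤ.* expo c j  ≡⟨ ⊛-constant c (expo c) j ⟨
        (constant c ⊛ expo c) j  ∎
        where
        open ≡-Reasoning
        shift-ε : ∀ j → expo 1ℤ j ≡ shift (E ε) j
        shift-ε j = ≡.sym (≡.trans (ℤ.+-identityʳ _) (ℤ.*-identityˡ _))

      -- A D = A^p A′, and A^p ≡ a modulo p; so D represents a A′/A although no division by A is
      -- carried out.
      AD : A ⊛ D 𝓗.≈ constant c ⊛ shift A
      AD = 𝓗.trans (𝓗.sym (𝓗.*-assoc A (A ^ˢ suc m) (shift A))) (𝓗.*-congʳ {shift A} ⟪ go ⟫)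
        where
        go : ∀ j → j ℕ.< p → (A ^ˢ p) j ≅ constant c j [ P ]
        go zero    _ = E (w a) 0 , ≡.trans (p-th-power 0)
          (cong (ℤ._+ P ℤ.* E (w a) 0) (≡.trans (ℤ.*-identityˡ (A 0)) (E-geometric-0 a)))
        go (suc j) _ = P ℤ.^ j ℤ.* A (suc j) ℤ.+ E (w a) (suc j) ,
          ≡.trans (p-th-power (suc j)) (lemma P (P ℤ.^ j) (A (suc j)) (E (w a) (suc j)))
          where
          lemma : ∀ p q a w → p ℤ.* q ℤ.* a ℤ.+ p ℤ.* w ≡ 0ℤ ℤ.+ p ℤ.* (q ℤ.* a ℤ.+ w)
          lemma = ℤ-solve-∀

      fβₐ : (expo c 𝓗.- constant 1ℤ) ⊛ scale c β 𝓗.≈ constant c ⊛ var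
      fβₐ = ⟪ (λ j j<p → begin
        ((expo c 𝓗.- constant 1ℤ) ⊛ scale c β) j  ≈⟨ ≡⇒≈ (⊛-cong scale-e (λ _ → ≡.refl) j) ⟩
        (scale c (E ε) ⊛ scale c β) j  ≈⟨ ≡⇒≈ (scale-⊛ c (E ε) β j) ⟨
        c ℤ.^ j ℤ.* (E ε ⊛ β) j  ≈⟨ *-congˡ {c ℤ.^ j} (at εβ≈z j j<p) ⟩
        c ℤ.^ j ℤ.* var j  ≈⟨ ≡⇒≈ (scale-var j) ⟩
        c ℤ.* var j  ≈⟨ ≡⇒≈ (⊛-constant c var j) ⟨
        (constant c ⊛ var) j  ∎) ⟫
        where
        open ℤ/p
        scale-e : ∀ j → (expo c 𝓗.- constant 1ℤ) j ≡ scale c (E ε) j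
        scale-e zero    = ≡.refl
        scale-e (suc j) = ≡.trans (≡.trans (ℤ.+-identityʳ (c ℤ.^ suc j)) (≡.sym (ℤ.*-identityʳ (c ℤ.^ suc j))))
          (cong (c ℤ.^ suc j ℤ.*_) (≡.sym (≡.trans (ℤ.+-identityʳ (1ℤ ℤ.^ suc j)) (ℤ.^-zeroˡ (suc j)))))
        scale-var : ∀ j → c ℤ.^ j ℤ.* var j ≡ c ℤ.* var j
        scale-var 0 = ≡.sym (ℤ.*-zeroʳ c)
        scale-var 1 = cong (ℤ._* 1ℤ) (ℤ.*-identityʳ c)
        scale-var (suc (suc j)) = ≡.trans (ℤ.*-zeroʳ (c ℤ.^ suc (suc j))) (≡.sym (ℤ.*-zeroʳ c))

    private
      G Y : Seq
      G = constant c ⊛ ((constant c 𝓗.- constant 1ℤ) ⊛ var ⊕ (scale c β 𝓗.- β))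
      Y = G 𝓗.- var ⊛ D

      zzcY : var ⊛ (var ⊛ (constant c ⊛ Y)) 𝓗.≈ constant 0ℤ
      zzcY = LogDerivative.log-derivative hurwitz (constant c) {expo 1ℤ} {expo c} {A} {shift A} {D} {β} {scale c β} {var}
        eA eA′ AD (𝓗.trans (𝓗.*-congʳ {β} (pointwise (e≈ 1ℤ))) εβ≈z) fβₐ

      -- Multiplication by z moves index k to k + 1 with a factor k + 1. Undoing it twice divides by
      -- (k + 2)(k + 1), which is invertible as long as k + 2 < p.
      Y≅0 : ∀ k → suc (suc k) ℕ.< p → Y k ≅ 0ℤ [ P ]
      Y≅0 k k<p = cancel _ _ (p∤-* (p∤-* (<⇒p∤ (s≤s z≤n) k<p) (<⇒p∤ (s≤s z≤n) (ℕ.<⇒≤ k<p))) p∤a) (begin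
        + suc (suc k) ℤ.* + suc k ℤ.* c ℤ.* Y k  ≈⟨ ≡⇒≈ (lemma (+ suc (suc k)) (+ suc k) c (Y k)) ⟩
        + suc (suc k) ℤ.* (+ suc k ℤ.* (c ℤ.* Y k))
          ≈⟨ ≡⇒≈ (≡.trans (var-⊛ (var ⊛ (constant c ⊛ Y)) (suc k)) (cong (λ b → + suc (suc k) ℤ.* b)
               (≡.trans (var-⊛ (constant c ⊛ Y) k) (cong (λ b → + suc k ℤ.* b) (⊛-constant c Y k))))) ⟨
        (var ⊛ (var ⊛ (constant c ⊛ Y))) (suc (suc k)) ≈⟨ at zzcY (suc (suc k)) k<p ⟩
        0ℤ  ≈⟨ ≡⇒≈ (ℤ.*-zeroʳ (+ suc (suc k) ℤ.* + suc k ℤ.* c)) ⟨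
        + suc (suc k) ℤ.* + suc k ℤ.* c ℤ.* 0ℤ  ∎)
        where
        open ℤ/p
        lemma : ∀ a b c d → a ℤ.* b ℤ.* c ℤ.* d ≡ a ℤ.* (b ℤ.* (c ℤ.* d))
        lemma = ℤ-solve-∀

    -- The coefficient of z D at index j is j D_(j-1), that is j w_j. On the other side (a - 1) z is
    -- invisible from index 2 on, and β(az) - β(z) yields the factor a^j - 1.
    moment-w : ∀ k → let j = suc (suc k) in suc (suc j) ℕ.< p →
      + j ℤ.* E (w a) j ≅ c ℤ.* ((c ℤ.^ j ℤ.- 1ℤ) ℤ.* β j) [ P ]
    moment-w k j<p = begin
      + j ℤ.* E (w a) j  ≈⟨ *-congˡ {+ j} (E-w k) ⟩
      + j ℤ.* D (suc k)  ≈⟨ ≡⇒≈ (var-⊛ D (suc k)) ⟨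
      (var ⊛ D) j  ≈⟨ -≅0⇒≅ {a = G j} {b = (var ⊛ D) j} (Y≅0 j j<p) ⟨
      G j  ≈⟨ ≡⇒≈ G≡ ⟩
      c ℤ.* ((c ℤ.^ j ℤ.- 1ℤ) ℤ.* β j)  ∎
      where
      open ℤ/p
      j = suc (suc k)
      constant-minus : ∀ i → (constant c 𝓗.- constant 1ℤ) i ≡ constant (c ℤ.- 1ℤ) i
      constant-minus zero    = ≡.refl
      constant-minus (suc i) = ≡.refl
      lemma : ∀ x b → x ℤ.* b ℤ.- b ≡ (x ℤ.- 1ℤ) ℤ.* b
      lemma = ℤ-solve-∀
      G≡ : G j ≡ c ℤ.* ((c ℤ.^ j ℤ.- 1ℤ) ℤ.* β j)
      G≡ = ≡.trans (⊛-constant c _ j) (cong (c ℤ.*_) (≡.trans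
        (cong (ℤ._+ (c ℤ.^ j ℤ.* β j ℤ.- β j)) (≡.trans (⊛-cong constant-minus (λ _ → ≡.refl) j)
          (≡.trans (⊛-constant (c ℤ.- 1ℤ) var j) (ℤ.*-zeroʳ (c ℤ.- 1ℤ)))))
        (≡.trans (ℤ.+-identityˡ _) (lemma (c ℤ.^ j) (β j)))))

-- The Fleck quotient modulo p

+≡⇒< : ∀ s k {l} → s ℕ.+ suc (suc k) ≡ l → s ℕ.< l
+≡⇒< s k e = ℕ.≤-trans (ℕ.m≤m+n (suc s) (suc k)) (ℕ.≤-reflexive (≡.trans (≡.sym (ℕ.+-suc s (suc k))) e))

infix 4 _≅?_[_]
_≅?_[_] : ∀ a b m → Dec (a ≅ b [ + m ])
a ≅? b [ m ] with m ℕ.∣? ℤ.∣ a ℤ.- b ∣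
... | yes d = yes (-≅0⇒≅ (∣⇒≅0 d))
... | no  n = no (n ∘ ≅0⇒∣ ∘ ≅⇒-≅0)

module QuotientAlgebra (S : ℤAlgebra) where
  open ℤAlgebra S
  open Alg S
  open import Relation.Binary.Reasoning.Setoid setoid

  -- N is n_* + 1 ≡ -j, which matches the factor j of `moment-w`. As c δ = c^n and c^n c^j ≡ 1, the
  -- product c δ (c^j - 1) becomes 1 - c^n, the factor on the left of `galois`.
  combine : ∀ N j I δ σ f W w c cʲ cⁿ b x → N ≈ - j → W ≈ - (f * w) → x ≈ 0# →
    j * w ≈ c * ((cʲ - ι 1ℤ) * b) → c * δ ≈ cⁿ → cⁿ * cʲ ≈ ι 1ℤ →
    N * (I * δ * σ * W + x) ≈ (I * σ) * (ι 1ℤ - cⁿ) * (f * b)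
  combine N j I δ σ f W w c cʲ cⁿ b x N≈ W≈ x≈ jw cδ cc = begin
    N * (I * δ * σ * W + x)
      ≈⟨ *-cong N≈ (trans (+-cong (*-congˡ W≈) x≈) (+-identityʳ _)) ⟩
    - j * (I * δ * σ * - (f * w))
      ≈⟨ solve 6 (λ j I δ σ f w → :- j :* (I :* δ :* σ :* (:- (f :* w))) := (I :* σ :* f :* δ) :* (j :* w)) refl j I δ σ f w ⟩
    (I * σ * f * δ) * (j * w)  ≈⟨ *-congˡ jw ⟩
    (I * σ * f * δ) * (c * ((cʲ - ι 1ℤ) * b))
      ≈⟨ solve 7 (λ I σ f δ c x b → (I :* σ :* f :* δ) :* (c :* ((x :- κ 1ℤ) :* b)) := I :* σ :* ((c :* δ) :* x :- c :* δ) :* (f :* b))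
           refl I σ f δ c cʲ b ⟩
    I * σ * ((c * δ) * cʲ - c * δ) * (f * b)  ≈⟨ *-congʳ (*-congˡ (+-cong (*-congʳ cδ) (-‿cong cδ))) ⟩
    I * σ * (cⁿ * cʲ - cⁿ) * (f * b)  ≈⟨ *-congʳ (*-congˡ (+-congʳ cc)) ⟩
    (I * σ) * (ι 1ℤ - cⁿ) * (f * b)  ∎

module Conclusion {m : ℕ} (pr : Prime (suc (suc m))) (h : ℕ) (p≡1+2h : suc (suc m) ≡ suc (h ℕ.+ h)) where
  open Galois pr h p≡1+2h using (p; w; galois)
  open PrimeMod pr
  open OddPrime pr h p≡1+2h
  open Trace pr
  open Moments pr h p≡1+2h
  open Hurwitz P p using (⟪_⟫; at)

  ^-reduce : ∀ {c} → p∤ c → ∀ s q → c ℤ.^ (s ℕ.+ q ℕ.* suc m) ≅ c ℤ.^ s [ P ]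
  ^-reduce {c} p∤c s q = begin
    c ℤ.^ (s ℕ.+ q ℕ.* suc m)  ≈⟨ ≡⇒≈ (ℤ.^-distribˡ-+-* c s (q ℕ.* suc m)) ⟩
    c ℤ.^ s ℤ.* c ℤ.^ (q ℕ.* suc m)
      ≈⟨ *-congˡ {c ℤ.^ s} (≡⇒≈ (≡.trans (cong (c ℤ.^_) (ℕ.*-comm q (suc m))) (≡.sym (ℤ.^-*-assoc c (suc m) q)))) ⟩
    c ℤ.^ s ℤ.* (c ℤ.^ suc m) ℤ.^ q
      ≈⟨ *-congˡ {c ℤ.^ s} (trans (ι-^ (c ℤ.^ suc m) q) (trans (^-cong q (fermat′ p∤c)) (1^ q))) ⟩
    c ℤ.^ s ℤ.* 1ℤ  ≈⟨ ≡⇒≈ (ℤ.*-identityʳ (c ℤ.^ s)) ⟩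
    c ℤ.^ s  ∎
    where open ℤ/p

  ^-complement : ∀ {c} → p∤ c → ∀ s q j → s ℕ.+ j ≡ suc m → c ℤ.^ (s ℕ.+ q ℕ.* suc m) ℤ.* c ℤ.^ j ≅ 1ℤ [ P ]
  ^-complement {c} p∤c s q j e = begin
    c ℤ.^ (s ℕ.+ q ℕ.* suc m) ℤ.* c ℤ.^ j  ≈⟨ *-congʳ {c ℤ.^ j} (^-reduce p∤c s q) ⟩
    c ℤ.^ s ℤ.* c ℤ.^ j  ≈⟨ ≡⇒≈ (ℤ.^-distribˡ-+-* c s j) ⟨
    c ℤ.^ (s ℕ.+ j)  ≈⟨ ≡⇒≈ (cong (c ℤ.^_) e) ⟩
    c ℤ.^ suc m  ≈⟨ fermat′ p∤c ⟩
    1ℤ  ∎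
    where open ℤ/p

  complement : ∀ s j → s ℕ.+ j ≡ p → + s ≅ ℤ.- (+ j) [ P ]
  complement s j e = 1ℤ , ≡.trans (lemma (+ s) (+ j)) (cong (λ b → ℤ.- (+ j) ℤ.+ + b ℤ.* 1ℤ) e)
    where
    lemma : ∀ s j → s ≡ ℤ.- j ℤ.+ (s ℤ.+ j) ℤ.* 1ℤ
    lemma = ℤ-solve-∀

  module _ (β : Seq) (εβ≈z : (E ε ⊛ β) 𝓗.≈ var) where

    -- The coefficients of 1 + e^z + ... + e^((p-1)z) are the power sums. Times e^z - 1 this series
    -- is e^(pz) - 1 ≡ 0; a further factor β turns e^z - 1 into z, which can be removed below degree
    -- p.
    power-sum : ∀ s → suc s ℕ.< p → E (geometric p) s ≅ 0ℤ [ P ]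
    power-sum s s<p = cancel _ _ (<⇒p∤ (s≤s z≤n) s<p) (begin
      + suc s ℤ.* A s  ≈⟨ ≡⇒≈ (var-⊛ A s) ⟨
      (var ⊛ A) (suc s)  ≈⟨ at (𝓗.trans (𝓗.*-congʳ {A} (𝓗.sym εβ≈z)) rest) (suc s) s<p ⟩
      0ℤ  ≈⟨ ≡⇒≈ (ℤ.*-zeroʳ (+ suc s)) ⟨
      + suc s ℤ.* 0ℤ  ∎)
      where
      open ℤ/p
      A = E (geometric p)
      εA≈0 : E ε ⊛ A 𝓗.≈ constant 0ℤ
      εA≈0 = ⟪ (λ j _ → go j) ⟫
        where
        go : ∀ j → (E ε ⊛ A) j ≅ constant 0ℤ j [ P ]
        go zero = ≡⇒≈ (≡.trans (E-cong (ε-geometric p) 0) (cong (ℤ._+ ℤ.- 1ℤ) (expo-X^ p 0)))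
        go (suc j) = P ℤ.^ j , ≡.trans (E-cong (ε-geometric p) (suc j)) (≡.trans (ℤ.+-identityʳ _)
          (≡.trans (expo-X^ p (suc j)) (≡.sym (ℤ.+-identityˡ _))))
      rest : E ε ⊛ β ⊛ A 𝓗.≈ constant 0ℤ
      rest = 𝓗.trans (𝓗.*-congʳ {A} (𝓗.*-comm (E ε) β)) (𝓗.trans (𝓗.*-assoc β (E ε) A)
        (𝓗.trans (𝓗.*-congˡ {β} εA≈0) (𝓗.zeroʳ β)))

    -- If every a from 1 to p - 1 had a^s ≡ 1, the power sum would be p - 1 and not 0 modulo p.
    non-root : ∀ s → 0 ℕ.< s → suc s ℕ.< p → Σ ℕ λ a → 0 ℕ.< a × a ℕ.< p × ¬ ((+ a) ℤ.^ s ≅ 1ℤ [ P ])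
    non-root s 0<s s<p with search (suc m)
      where
      search : ∀ n → (Σ ℕ λ a → 0 ℕ.< a × a ℕ.< suc n × ¬ ((+ a) ℤ.^ s ≅ 1ℤ [ P ])) ⊎ E (geometric (suc n)) s ≅ + n [ P ]
      -- The term 0^s of the power sum is 0 because s is positive.
      search zero = inj₂ (Mod.≡⇒≅ P (zero-s s 0<s))
        where
        zero-s : ∀ s → 0 ℕ.< s → E (geometric 1) s ≡ 0ℤ
        zero-s (suc s) _ = ≡.refl
      search (suc n) with search n
      ... | inj₁ (a , 0<a , a<n , e) = inj₁ (a , 0<a , ℕ.m<n⇒m<1+n a<n , e)
      ... | inj₂ e with (+ suc n) ℤ.^ s ≅? 1ℤ [ p ]
      ...   | no  ne = inj₁ (suc n , s≤s z≤n , ℕ.≤-refl , ne)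
      ...   | yes e′ = inj₂ (Mod.≅-trans P (Mod.+-cong P e (Mod.≅-trans P (Mod.≡⇒≅ P (expo-X^ (suc n) s)) e′))
                (Mod.≡⇒≅ P (cong (λ j → + j) (ℕ.+-comm n 1))))
    ... | inj₁ r = r
    ... | inj₂ e = ⊥-elim (<⇒p∤ (s≤s z≤n) ℕ.≤-refl (Mod.≅-trans P (Mod.≅-sym P e) (power-sum s s<p)))

    -- Here n_* = s + 2 and `U` = 1 - a^n for the a found by `non-root`. `K` is what remains of U
    -- T((x - 1)^(pn)) once the powers of p are split off; as U occurs in both relations, a can be
    -- eliminated.
    fleck-quotient : ∀ s q v i k →
      let n = suc (suc s) ℕ.+ q ℕ.* suc m ; j = suc (suc k) in
      n ≡ suc i ℕ.* p ℕ.^ v → suc (suc s) ℕ.+ j ≡ suc m →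
      Σ ℤ λ U → Σ ℤ λ K → p∤ U
        × U ℤ.* T (ε ^ᵖ (n ℕ.* p)) ≡ P ℤ.^ suc v ℤ.* (P ℤ.^ (n ℕ.+ q) ℤ.* K)
        × (+ suc (suc (suc s)) ℤ.* K ≅ (+ suc i ℤ.* (ℤ.- 1ℤ) ℤ.^ q) ℤ.* U ℤ.* (+ (suc (suc s) !) ℤ.* β j) [ P ])
    fleck-quotient s q v i k n≡ s+j≡ = let
        a , 0<a , a<p , a^s = non-root (suc (suc s)) (s≤s z≤n) s<p
        δ , t , aδ , eq = galois {a} (λ d → ℕ.<⇒≱ a<p (ℕ.∣⇒≤ {{ℕ.>-nonZero 0<a}} d)) (suc s) q v i n≡
        p∤a = <⇒p∤ 0<a a<p
      in 1ℤ ℤ.- (+ a) ℤ.^ n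
        , (+ suc i) ℤ.* δ ℤ.* (ℤ.- 1ℤ) ℤ.^ q ℤ.* T (g ^ᵖ suc (suc s) ⊠ w a) ℤ.+ P ℤ.* t
        -- Modulo p, a^n is a^(n_*), which differs from 1 by the choice of a.
        , (λ d → a^s (trans (sym (^-reduce p∤a (suc (suc s)) q)) (sym (-≅0⇒≅ d))))
        , eq
        , QuotientAlgebra.combine (Mod.algebra P) (+ suc (suc (suc s))) (+ j) (+ suc i) δ ((ℤ.- 1ℤ) ℤ.^ q) (+ (suc (suc s) !))
            (T (g ^ᵖ suc (suc s) ⊠ w a)) (E (w a) j) (+ a) ((+ a) ℤ.^ j) ((+ a) ℤ.^ n) (β j) (P ℤ.* t)
            (complement (suc (suc (suc s))) j (cong suc s+j≡)) (T-g^ (w a) (suc s) j s+j≡) (t , ≡.sym (ℤ.+-identityˡ (P ℤ.* t)))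
            (moment-w β εβ≈z a p∤a k j+2<p) (≡⇒≈ aδ) (^-complement p∤a (suc (suc s)) q j s+j≡)
      where
      open ℤ/p
      n = suc (suc s) ℕ.+ q ℕ.* suc m
      j = suc (suc k)
      s<p : suc (suc (suc s)) ℕ.< p
      s<p = s≤s (+≡⇒< (suc (suc s)) k s+j≡)
      j+2<p : suc (suc j) ℕ.< p
      j+2<p = s≤s (ℕ.≤-trans (ℕ.m≤n+m (suc (suc j)) s) (ℕ.≤-reflexive (≡.trans (lemma s j) s+j≡)))
        where
        lemma : ∀ s j → s ℕ.+ suc (suc j) ≡ suc (suc s) ℕ.+ j
        lemma = ℕ-solve-∀

-- Finite sums

Σ-cong : ∀ n {f g} → (∀ k → k ℕ.< n → f k ≡ g k) → Σℤ< n f ≡ Σℤ< n g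
Σ-cong zero    e = ≡.refl
Σ-cong (suc n) e = cong₂ ℤ._+_ (Σ-cong n (λ k k<n → e k (ℕ.m<n⇒m<1+n k<n))) (e n ℕ.≤-refl)

Σ-+ : ∀ n f g → Σℤ< n (λ k → f k ℤ.+ g k) ≡ Σℤ< n f ℤ.+ Σℤ< n g
Σ-+ zero    f g = ≡.refl
Σ-+ (suc n) f g = ≡.trans (cong (ℤ._+ (f n ℤ.+ g n)) (Σ-+ n f g)) (lemma (Σℤ< n f) (Σℤ< n g) (f n) (g n))
  where
  lemma : ∀ a b c d → a ℤ.+ b ℤ.+ (c ℤ.+ d) ≡ a ℤ.+ c ℤ.+ (b ℤ.+ d)
  lemma = ℤ-solve-∀

Σ-* : ∀ n c f → Σℤ< n (λ k → c ℤ.* f k) ≡ c ℤ.* Σℤ< n f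
Σ-* zero    c f = ≡.sym (ℤ.*-zeroʳ c)
Σ-* (suc n) c f = ≡.trans (cong (ℤ._+ c ℤ.* f n) (Σ-* n c f)) (≡.sym (ℤ.*-distribˡ-+ c (Σℤ< n f) (f n)))

Σ-head : ∀ n f → Σℤ< (suc n) f ≡ f 0 ℤ.+ Σℤ< n (f ∘ suc)
Σ-head zero    f = ℤ.+-comm 0ℤ (f 0)
Σ-head (suc n) f = ≡.trans (cong (ℤ._+ f (suc n)) (Σ-head n f)) (ℤ.+-assoc (f 0) _ (f (suc n)))

binomialSum : ℕ → Seq → ℤ
binomialSum n v = Σℤ< (suc n) (λ k → + (n C k) ℤ.* v k)

binomialSum-suc : ∀ n v → binomialSum (suc n) v ≡ binomialSum n v ℤ.+ binomialSum n (shift v)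
binomialSum-suc n v = begin
  Σℤ< (suc (suc n)) (λ k → + (suc n C k) ℤ.* v k)  ≡⟨ Σ-head (suc n) _ ⟩
  1ℤ ℤ.* v 0 ℤ.+ Σℤ< (suc n) (λ k → + (suc n C suc k) ℤ.* v (suc k))
    ≡⟨ cong (λ a → 1ℤ ℤ.* v 0 ℤ.+ a) (Σ-cong (suc n) (λ k _ → pascal k)) ⟩
  1ℤ ℤ.* v 0 ℤ.+ Σℤ< (suc n) (λ k → + (n C suc k) ℤ.* v (suc k) ℤ.+ + (n C k) ℤ.* v (suc k))
    ≡⟨ cong (λ a → 1ℤ ℤ.* v 0 ℤ.+ a) (Σ-+ (suc n) _ _) ⟩
  1ℤ ℤ.* v 0 ℤ.+ (Σℤ< (suc n) (λ k → + (n C suc k) ℤ.* v (suc k)) ℤ.+ binomialSum n (shift v))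
    ≡⟨ ℤ.+-assoc (1ℤ ℤ.* v 0) _ _ ⟨
  1ℤ ℤ.* v 0 ℤ.+ Σℤ< (suc n) (λ k → + (n C suc k) ℤ.* v (suc k)) ℤ.+ binomialSum n (shift v)
    ≡⟨ cong (ℤ._+ binomialSum n (shift v)) (Σ-head (suc n) (λ k → + (n C k) ℤ.* v k)) ⟨
  binomialSum n v ℤ.+ + (n C suc n) ℤ.* v (suc n) ℤ.+ binomialSum n (shift v)
    ≡⟨ cong (λ c → binomialSum n v ℤ.+ + c ℤ.* v (suc n) ℤ.+ binomialSum n (shift v)) (k>n⇒nCk≡0 (ℕ.n<1+n n)) ⟩
  binomialSum n v ℤ.+ 0ℤ ℤ.* v (suc n) ℤ.+ binomialSum n (shift v)
    ≡⟨ cong (ℤ._+ binomialSum n (shift v)) (ℤ.+-identityʳ (binomialSum n v)) ⟩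
  binomialSum n v ℤ.+ binomialSum n (shift v) ∎
  where
  open ≡-Reasoning
  pascal : ∀ k → + (suc n C suc k) ℤ.* v (suc k) ≡ + (n C suc k) ℤ.* v (suc k) ℤ.+ + (n C k) ℤ.* v (suc k)
  pascal k = ≡.trans (cong (λ c → + c ℤ.* v (suc k)) (≡.trans (≡.sym (nCk+nC[k+1]≡[n+1]C[k+1] n k)) (ℕ.+-comm (n C k) _)))
    (ℤ.*-distribʳ-+ (v (suc k)) (+ (n C suc k)) (+ (n C k)))

expo-1-⊛ : ∀ v j → (expo 1ℤ ⊛ v) j ≡ binomialSum j v
expo-1-⊛ v zero    = ≡.sym (ℤ.+-identityˡ _)
expo-1-⊛ v (suc j) = ≡.trans (cong₂ ℤ._+_
  (≡.trans (⊛-cong (λ i → ℤ.*-identityˡ (1ℤ ℤ.^ i)) (λ _ → ≡.refl) j) (expo-1-⊛ v j)) (expo-1-⊛ (shift v) j))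
  (≡.sym (binomialSum-suc j v))

act-ε^ : ∀ n u i → act (ε ^ᵖ n) u i ≡ sgn n ℤ.* binomialSum n (λ k → sgn k ℤ.* u (i ℕ.+ k))
act-ε^ zero    u i = ≡.trans (cong (λ j → 1ℤ ℤ.* u j) (≡.sym (ℕ.+-identityʳ i))) (lemma (u (i ℕ.+ 0)))
  where
  lemma : ∀ a → 1ℤ ℤ.* a ≡ 1ℤ ℤ.* (0ℤ ℤ.+ 1ℤ ℤ.* (1ℤ ℤ.* a))
  lemma = ℤ-solve-∀
act-ε^ (suc n) u i = begin
  act (ε ^ᵖ n) u (suc i) ℤ.+ (ℤ.- 1ℤ) ℤ.* act (ε ^ᵖ n) u i
    ≡⟨ cong₂ (λ a b → a ℤ.+ (ℤ.- 1ℤ) ℤ.* b) (act-ε^ n u (suc i)) (act-ε^ n u i) ⟩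
  sgn n ℤ.* binomialSum n (v (suc i)) ℤ.+ (ℤ.- 1ℤ) ℤ.* (sgn n ℤ.* binomialSum n (v i))
    ≡⟨ lemma (sgn n) (binomialSum n (v (suc i))) (binomialSum n (v i)) ⟩
  (ℤ.- 1ℤ ℤ.* sgn n) ℤ.* (binomialSum n (v i) ℤ.+ ℤ.- 1ℤ ℤ.* binomialSum n (v (suc i)))
    ≡⟨ cong (λ a → (ℤ.- 1ℤ ℤ.* sgn n) ℤ.* (binomialSum n (v i) ℤ.+ a))
         (≡.trans (≡.sym (Σ-* (suc n) (ℤ.- 1ℤ) _)) (Σ-cong (suc n) (λ k _ → negate k))) ⟩
  (ℤ.- 1ℤ ℤ.* sgn n) ℤ.* (binomialSum n (v i) ℤ.+ binomialSum n (shift (v i)))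
    ≡⟨ cong ((ℤ.- 1ℤ ℤ.* sgn n) ℤ.*_) (binomialSum-suc n (v i)) ⟨
  sgn (suc n) ℤ.* binomialSum (suc n) (v i) ∎
  where
  open ≡-Reasoning
  v : ℕ → Seq
  v i k = sgn k ℤ.* u (i ℕ.+ k)
  lemma : ∀ s a b → s ℤ.* a ℤ.+ (ℤ.- 1ℤ) ℤ.* (s ℤ.* b) ≡ (ℤ.- 1ℤ ℤ.* s) ℤ.* (b ℤ.+ ℤ.- 1ℤ ℤ.* a)
  lemma = ℤ-solve-∀
  lemma′ : ∀ c s a → ℤ.- 1ℤ ℤ.* (c ℤ.* (s ℤ.* a)) ≡ c ℤ.* (ℤ.- 1ℤ ℤ.* s ℤ.* a)
  lemma′ = ℤ-solve-∀
  negate : ∀ k → ℤ.- 1ℤ ℤ.* (+ (n C k) ℤ.* v (suc i) k) ≡ + (n C k) ℤ.* shift (v i) k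
  negate k = ≡.trans (lemma′ (+ (n C k)) (sgn k) (u (suc i ℕ.+ k)))
    (cong (λ j → + (n C k) ℤ.* (sgn (suc k) ℤ.* u j)) (≡.sym (ℕ.+-suc i k)))

-- Rational numbers

-- Opaque, so that the normalisation of fractions is not unfolded; the properties of `ιℚ` are
-- derived through `toℚᵘ-ιℚ` instead.
opaque
  ιℚ : ℤ → ℚ
  ιℚ z = z ℚ./ 1

  ιℚ≡/1 : ∀ z → z ℚ./ 1 ≡ ιℚ z
  ιℚ≡/1 z = ≡.refl

  toℚᵘ-ιℚ : ∀ z → toℚᵘ (ιℚ z) ℚᵘ.≃ mkℚᵘ z 0
  toℚᵘ-ιℚ z = ℚ.toℚᵘ-fromℚᵘ (mkℚᵘ z 0)

ℕ→ℚ≡ιℚ : ∀ n → ℕ→ℚ n ≡ ιℚ (+ n)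
ℕ→ℚ≡ιℚ n = ιℚ≡/1 (+ n)

ιℚ-injective : ∀ {a b} → ιℚ a ≡ ιℚ b → a ≡ b
ιℚ-injective {a} {b} e with ℚᵘ.≃-trans (ℚᵘ.≃-sym (toℚᵘ-ιℚ a)) (ℚᵘ.≃-trans (ℚᵘ.≃-reflexive (cong toℚᵘ e)) (toℚᵘ-ιℚ b))
... | *≡* eq = ≡.trans (≡.sym (ℤ.*-identityʳ a)) (≡.trans eq (ℤ.*-identityʳ b))

ιℚ-+ : ∀ a b → ιℚ (a ℤ.+ b) ≡ ιℚ a ℚ.+ ιℚ b
ιℚ-+ a b = ℚ.toℚᵘ-injective (ℚᵘ.≃-trans (toℚᵘ-ιℚ (a ℤ.+ b)) (ℚᵘ.≃-trans (*≡* (lemma a b))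
  (ℚᵘ.≃-sym (ℚᵘ.≃-trans (ℚ.toℚᵘ-homo-+ (ιℚ a) (ιℚ b)) (ℚᵘ.+-cong (toℚᵘ-ιℚ a) (toℚᵘ-ιℚ b))))))
  where
  lemma : ∀ a b → (a ℤ.+ b) ℤ.* 1ℤ ≡ (a ℤ.* 1ℤ ℤ.+ b ℤ.* 1ℤ) ℤ.* 1ℤ
  lemma = ℤ-solve-∀

ιℚ-* : ∀ a b → ιℚ (a ℤ.* b) ≡ ιℚ a ℚ.* ιℚ b
ιℚ-* a b = ℚ.toℚᵘ-injective (ℚᵘ.≃-trans (toℚᵘ-ιℚ (a ℤ.* b)) (ℚᵘ.≃-sym
  (ℚᵘ.≃-trans (ℚ.toℚᵘ-homo-* (ιℚ a) (ιℚ b)) (ℚᵘ.*-cong (toℚᵘ-ιℚ a) (toℚᵘ-ιℚ b)))))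

ιℚ-neg : ∀ a → ιℚ (ℤ.- a) ≡ ℚ.- ιℚ a
ιℚ-neg a = ℚ.toℚᵘ-injective (ℚᵘ.≃-trans (toℚᵘ-ιℚ (ℤ.- a)) (ℚᵘ.≃-sym
  (ℚᵘ.≃-trans (ℚ.toℚᵘ-homo‿- (ιℚ a)) (ℚᵘ.-‿cong (toℚᵘ-ιℚ a)))))

ℚ-algebra : ℤAlgebra
ℚ-algebra = record
  { commutativeRing = ℚ.+-*-commutativeRing
  ; ι = ιℚ ; ι-+ = ιℚ-+ ; ι-* = ιℚ-* ; ι-neg = ιℚ-neg ; ι-0 = ≡.sym (ιℚ≡/1 0ℤ) ; ι-1 = ≡.sym (ιℚ≡/1 1ℤ) }

numerator-eq : ∀ q → q ℚ.* ιℚ (ℚ.↧ q) ≡ ιℚ (ℚ.↥ q)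
numerator-eq q = ℚ.toℚᵘ-injective (ℚᵘ.≃-trans (ℚ.toℚᵘ-homo-* q (ιℚ (ℚ.↧ q)))
  (ℚᵘ.≃-trans (ℚᵘ.*-cong (ℚᵘ.≃-refl {toℚᵘ q}) (toℚᵘ-ιℚ (ℚ.↧ q)))
  (ℚᵘ.≃-trans (cancel q) (ℚᵘ.≃-sym (toℚᵘ-ιℚ (ℚ.↥ q))))))
  where
  cancel : ∀ q → toℚᵘ q ℚᵘ.* mkℚᵘ (ℚ.↧ q) 0 ℚᵘ.≃ mkℚᵘ (ℚ.↥ q) 0
  cancel (mkℚ n d _) = *≡* (≡.trans (ℤ.*-identityʳ _) (cong (λ e → n ℤ.* + e) (≡.sym (ℕ.*-identityʳ (suc d)))))

inv-inverse : ∀ q → q ≢ 0ℚ → inv q ℚ.* q ≡ 1ℚ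
inv-inverse q@(mkℚ +[1+ n ] _ _) _ = ℚ.*-inverseˡ q
inv-inverse q@(mkℚ -[1+ n ] _ _) _ = ℚ.*-inverseˡ q
inv-inverse q@(mkℚ (+ zero) d c) q≢0 = ⊥-elim (q≢0 (ℚ.↥p≡0⇒p≡0 q ≡.refl))

ιℚ≢0 : ∀ {z} → z ≢ 0ℤ → ιℚ z ≢ 0ℚ
ιℚ≢0 {z} n e = n (ιℚ-injective {z} {0ℤ} (≡.trans e (ιℚ≡/1 0ℤ)))

inv-ιℚ : ∀ {z} → z ≢ 0ℤ → inv (ιℚ z) ℚ.* ιℚ z ≡ 1ℚ
inv-ιℚ {z} n = inv-inverse (ιℚ z) (ιℚ≢0 n)

recursion : ℕ → (ℕ → ℚ) → ℚ
recursion m b = ℚ.- (inv (ℕ→ℚ (suc (suc m))) ℚ.* Σℚ< (suc m) (λ k → ℕ→ℚ (suc (suc m) C k) ℚ.* b k))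

-- The local function of bernVec cannot be named from outside; unification recovers it.
mutual
  earlier : ℕ → ℕ → ℚ
  earlier = _

  bernoulli-unfold : ∀ m → bernoulli (suc m) ≡ recursion m (earlier m)
  bernoulli-unfold m = ≡.refl

lookup-bernVec : ∀ m (i : Fin (suc m)) → lookup (bernVec m) i ≡ bernoulli (m ℕ.∸ toℕ i)
lookup-bernVec zero    Fin.zero    = ≡.refl
lookup-bernVec (suc m) Fin.zero    = ≡.refl
lookup-bernVec (suc m) (Fin.suc i) = lookup-bernVec m i

earlier≡bernoulli : ∀ m k → k ℕ.< suc m → earlier m k ≡ bernoulli k
earlier≡bernoulli m k k<m with k ℕ.<? suc m
... | no  n = ⊥-elim (n k<m)
... | yes _ = ≡.trans (lookup-bernVec m (fromℕ< (s≤s (ℕ.m∸n≤m m k))))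
    (cong bernoulli (≡.trans (cong (m ℕ.∸_) (Fin.toℕ-fromℕ< (s≤s (ℕ.m∸n≤m m k)))) (ℕ.m∸[m∸n]≡n (ℕ.≤-pred k<m))))

Σℚ-cong : ∀ n {f g} → (∀ k → k ℕ.< n → f k ≡ g k) → Σℚ< n f ≡ Σℚ< n g
Σℚ-cong zero    e = ≡.refl
Σℚ-cong (suc n) e = cong₂ ℚ._+_ (Σℚ-cong n (λ k k<n → e k (ℕ.m<n⇒m<1+n k<n))) (e n ℕ.≤-refl)

recursion-cong : ∀ m b b′ → (∀ k → k ℕ.< suc m → b k ≡ b′ k) → recursion m b ≡ recursion m b′
recursion-cong m b b′ e = cong (λ s → ℚ.- (inv (ℕ→ℚ (suc (suc m))) ℚ.* s))
  (Σℚ-cong (suc m) {λ k → ℕ→ℚ (suc (suc m) C k) ℚ.* b k} {λ k → ℕ→ℚ (suc (suc m) C k) ℚ.* b′ k}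
    (λ k k<m → cong (λ x → ℕ→ℚ (suc (suc m) C k) ℚ.* x) (e k k<m)))

bernoulli-suc : ∀ m → bernoulli (suc m) ≡ recursion m bernoulli
bernoulli-suc m = ≡.trans (bernoulli-unfold m) (recursion-cong m (earlier m) bernoulli (earlier≡bernoulli m))

-- Calculations with fractions, over an abstract algebra so that rational arithmetic never unfolds.
module Fractions (S : ℤAlgebra) where
  open ℤAlgebra S
  open Alg S using (≡⇒≈; solve; _:=_; _:+_; _:*_; _:-_; :-_; κ)
  open import Relation.Binary.Reasoning.Setoid setoid

  fraction-+ : ∀ q q′ d x d′ x′ → q * ι d ≈ ι x → q′ * ι d′ ≈ ι x′ → (q + q′) * ι (d ℤ.* d′) ≈ ι (x ℤ.* d′ ℤ.+ x′ ℤ.* d)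
  fraction-+ q q′ d x d′ x′ e e′ = begin
    (q + q′) * ι (d ℤ.* d′)  ≈⟨ *-congˡ (ι-* d d′) ⟩
    (q + q′) * (ι d * ι d′)
      ≈⟨ solve 4 (λ q q′ d d′ → (q :+ q′) :* (d :* d′) := q :* d :* d′ :+ q′ :* d′ :* d) refl q q′ (ι d) (ι d′) ⟩
    q * ι d * ι d′ + q′ * ι d′ * ι d  ≈⟨ +-cong (*-congʳ e) (*-congʳ e′) ⟩
    ι x * ι d′ + ι x′ * ι d  ≈⟨ +-cong (ι-* x d′) (ι-* x′ d) ⟨
    ι (x ℤ.* d′) + ι (x′ ℤ.* d)  ≈⟨ ι-+ (x ℤ.* d′) (x′ ℤ.* d) ⟨
    ι (x ℤ.* d′ ℤ.+ x′ ℤ.* d)  ∎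

  fraction-* : ∀ q q′ d x d′ x′ → q * ι d ≈ ι x → q′ * ι d′ ≈ ι x′ → (q * q′) * ι (d ℤ.* d′) ≈ ι (x ℤ.* x′)
  fraction-* q q′ d x d′ x′ e e′ = begin
    (q * q′) * ι (d ℤ.* d′)  ≈⟨ *-congˡ (ι-* d d′) ⟩
    (q * q′) * (ι d * ι d′)
      ≈⟨ solve 4 (λ q q′ d d′ → (q :* q′) :* (d :* d′) := (q :* d) :* (q′ :* d′)) refl q q′ (ι d) (ι d′) ⟩
    (q * ι d) * (q′ * ι d′)  ≈⟨ *-cong e e′ ⟩
    ι x * ι x′  ≈⟨ ι-* x x′ ⟨
    ι (x ℤ.* x′)  ∎

  fraction-cross : ∀ q d x d′ x′ → q * ι d ≈ ι x → q * ι d′ ≈ ι x′ → ι (x ℤ.* d′) ≈ ι (x′ ℤ.* d)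
  fraction-cross q d x d′ x′ e e′ = begin
    ι (x ℤ.* d′)  ≈⟨ ι-* x d′ ⟩
    ι x * ι d′  ≈⟨ *-congʳ e ⟨
    q * ι d * ι d′  ≈⟨ solve 3 (λ q d d′ → q :* d :* d′ := q :* d′ :* d) refl q (ι d) (ι d′) ⟩
    q * ι d′ * ι d  ≈⟨ *-congʳ e′ ⟩
    ι x′ * ι d  ≈⟨ ι-* x′ d ⟨
    ι (x′ ℤ.* d)  ∎

  fraction-assoc : ∀ q q′ m d x → q * ι m ≈ q′ → q′ * ι d ≈ ι x → q * ι (m ℤ.* d) ≈ ι x
  fraction-assoc q q′ m d x e e′ = begin
    q * ι (m ℤ.* d)  ≈⟨ *-congˡ (ι-* m d) ⟩
    q * (ι m * ι d)  ≈⟨ *-assoc q (ι m) (ι d) ⟨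
    q * ι m * ι d  ≈⟨ *-congʳ e ⟩
    q′ * ι d  ≈⟨ e′ ⟩
    ι x  ∎

  fraction-difference : ∀ q q′ i p d x d′ x′ → i * ι p ≈ 1# → q * ι d ≈ ι x → q′ * ι d′ ≈ ι x′ →
    (q - q′) * i * ι (d ℤ.* d′) * ι p ≈ ι (x ℤ.* d′ ℤ.- x′ ℤ.* d)
  fraction-difference q q′ i p d x d′ x′ ip e e′ = begin
    (q - q′) * i * ι (d ℤ.* d′) * ι p  ≈⟨ *-congʳ (*-congˡ (ι-* d d′)) ⟩
    (q - q′) * i * (ι d * ι d′) * ι p
      ≈⟨ solve 6 (λ q q′ i d d′ p → (q :- q′) :* i :* (d :* d′) :* p := i :* p :* (q :* d :* d′ :- q′ :* d′ :* d))
           refl q q′ i (ι d) (ι d′) (ι p) ⟩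
    i * ι p * (q * ι d * ι d′ - q′ * ι d′ * ι d)  ≈⟨ *-cong ip (+-cong (*-congʳ e) (-‿cong (*-congʳ e′))) ⟩
    1# * (ι x * ι d′ - ι x′ * ι d)  ≈⟨ *-identityˡ _ ⟩
    ι x * ι d′ - ι x′ * ι d  ≈⟨ +-cong (ι-* x d′) (trans (ι-neg _) (-‿cong (ι-* x′ d))) ⟨
    ι (x ℤ.* d′) + ι (ℤ.- (x′ ℤ.* d))  ≈⟨ ι-+ (x ℤ.* d′) (ℤ.- (x′ ℤ.* d)) ⟨
    ι (x ℤ.* d′ ℤ.- x′ ℤ.* d)  ∎

  fraction-cancel : ∀ a b i z → i * ι z ≈ 1# → a * ι z ≈ b * ι z → a ≈ b
  fraction-cancel a b i z iz e = begin
    a  ≈⟨ *-identityʳ a ⟨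
    a * 1#  ≈⟨ *-congˡ iz ⟨
    a * (i * ι z)  ≈⟨ solve 3 (λ a i z → a :* (i :* z) := a :* z :* i) refl a i (ι z) ⟩
    a * ι z * i  ≈⟨ *-congʳ e ⟩
    b * ι z * i  ≈⟨ solve 3 (λ a i z → a :* (i :* z) := a :* z :* i) refl b i (ι z) ⟨
    b * (i * ι z)  ≈⟨ *-congˡ iz ⟩
    b * 1#  ≈⟨ *-identityʳ b ⟩
    b  ∎

  solve-linear : ∀ q i n s → i * ι n ≈ 1# → q ≈ - (i * s) → q * ι n ≈ ι (ℤ.- 1ℤ) * s
  solve-linear q i n s e e′ = begin
    q * ι n  ≈⟨ *-congʳ e′ ⟩
    - (i * s) * ι n
      ≈⟨ solve 3 (λ i s n → (:- (i :* s)) :* n := i :* n :* (κ (ℤ.- 1ℤ) :* s)) refl i s (ι n) ⟩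
    i * ι n * (ι (ℤ.- 1ℤ) * s)  ≈⟨ trans (*-congʳ e) (*-identityˡ _) ⟩
    ι (ℤ.- 1ℤ) * s  ∎

  linear-vanish : ∀ n s b → b * ι n ≈ ι (ℤ.- 1ℤ) * s → s + ι n * b ≈ 0#
  linear-vanish n s b e = begin
    s + ι n * b  ≈⟨ +-congˡ (trans (*-comm (ι n) b) e) ⟩
    s + ι (ℤ.- 1ℤ) * s  ≈⟨ solve 1 (λ s → s :+ κ (ℤ.- 1ℤ) :* s := κ 0ℤ) refl s ⟩
    ι 0ℤ  ≈⟨ ι-0 ⟩
    0#  ∎

  fraction-reduce : ∀ q a x u d k r i → i * ι r ≈ 1# → q * ι a ≈ ι x → a ℤ.* u ≡ d ℤ.* r → x ℤ.* u ≡ k ℤ.* r → q * ι d ≈ ι k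
  fraction-reduce q a x u d k r i ir e au xu = fraction-cancel (q * ι d) (ι k) i r ir (begin
    q * ι d * ι r  ≈⟨ trans (*-assoc q (ι d) (ι r)) (*-congˡ (sym (ι-* d r))) ⟩
    q * ι (d ℤ.* r)  ≈⟨ *-congˡ (≡⇒≈ (≡.cong ι au)) ⟨
    q * ι (a ℤ.* u)  ≈⟨ trans (*-congˡ (ι-* a u)) (sym (*-assoc q (ι a) (ι u))) ⟩
    q * ι a * ι u  ≈⟨ *-congʳ e ⟩
    ι x * ι u  ≈⟨ ι-* x u ⟨
    ι (x ℤ.* u)  ≈⟨ ≡⇒≈ (≡.cong ι xu) ⟩
    ι (k ℤ.* r)  ≈⟨ ι-* k r ⟩
    ι k * ι r  ∎)

  clear-mid : ∀ i j w n c → i * ι w ≈ 1# → j * ι n ≈ 1# → i * ι c * j * ι (n ℤ.* w) ≈ ι c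
  clear-mid i j w n c iw jn = begin
    i * ι c * j * ι (n ℤ.* w)  ≈⟨ *-congˡ (ι-* n w) ⟩
    i * ι c * j * (ι n * ι w)
      ≈⟨ solve 5 (λ i c j n w → i :* c :* j :* (n :* w) := (i :* w) :* ((j :* n) :* c)) refl i (ι c) j (ι n) (ι w) ⟩
    (i * ι w) * ((j * ι n) * ι c)  ≈⟨ *-cong iw (*-congʳ jn) ⟩
    1# * (1# * ι c)  ≈⟨ trans (*-identityˡ _) (*-identityˡ _) ⟩
    ι c  ∎

  clear-X : ∀ i j w n t a → i * ι w ≈ 1# → j * ι n ≈ 1# → ι t * j * (ι a * i) * ι (n ℤ.* w) ≈ ι (t ℤ.* a)
  clear-X i j w n t a iw jn = begin
    ι t * j * (ι a * i) * ι (n ℤ.* w) ≈⟨ *-congˡ (ι-* n w) ⟩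
    ι t * j * (ι a * i) * (ι n * ι w)
      ≈⟨ solve 6 (λ i t a j n w → t :* j :* (a :* i) :* (n :* w) := (i :* w) :* ((j :* n) :* (t :* a))) refl i (ι t) (ι a) j (ι n) (ι w) ⟩
    (i * ι w) * ((j * ι n) * (ι t * ι a)) ≈⟨ *-cong iw (*-cong jn (sym (ι-* t a))) ⟩
    1# * (1# * ι (t ℤ.* a))  ≈⟨ trans (*-identityˡ _) (*-identityˡ _) ⟩
    ι (t ℤ.* a)  ∎

  clear-Y : ∀ i w n a → i * ι w ≈ 1# → - (ι a * i) * ι (n ℤ.* w) ≈ ι (ℤ.- (n ℤ.* a))
  clear-Y i w n a iw = begin
    - (ι a * i) * ι (n ℤ.* w)  ≈⟨ *-congˡ (ι-* n w) ⟩
    - (ι a * i) * (ι n * ι w)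
      ≈⟨ solve 4 (λ i a n w → (:- (a :* i)) :* (n :* w) := (i :* w) :* (:- (n :* a))) refl i (ι a) (ι n) (ι w) ⟩
    (i * ι w) * - (ι n * ι a)  ≈⟨ *-cong iw (-‿cong (sym (ι-* n a))) ⟩
    1# * - ι (n ℤ.* a)  ≈⟨ trans (*-identityˡ _) (sym (ι-neg _)) ⟩
    ι (ℤ.- (n ℤ.* a))  ∎

  clear-lhs : ∀ i v t z → i * ι v ≈ 1# → ι t * ι z * i * ι v ≈ ι (t ℤ.* z)
  clear-lhs i v t z iv = begin
    ι t * ι z * i * ι v  ≈⟨ *-assoc (ι t * ι z) i (ι v) ⟩
    ι t * ι z * (i * ι v)  ≈⟨ *-congˡ iv ⟩
    ι t * ι z * 1#  ≈⟨ trans (*-identityʳ _) (sym (ι-* t z)) ⟩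
    ι (t ℤ.* z)  ∎

  clear-rhs : ∀ i f n b → i * ι n ≈ 1# → f * i * b * ι n ≈ f * b
  clear-rhs i f n b e = begin
    f * i * b * ι n  ≈⟨ solve 4 (λ f i b n → f :* i :* b :* n := (i :* n) :* (f :* b)) refl f i b (ι n) ⟩
    (i * ι n) * (f * b)  ≈⟨ trans (*-congʳ e) (*-identityˡ _) ⟩
    f * b  ∎

open Fractions ℚ-algebra

-- Residues of p-integral rationals

reduced : ∀ r → Coprimality.Coprime ℤ.∣ ℚ.↥ r ∣ (ℚ.denominatorℕ r)
reduced (mkℚ _ _ coprime) = Coprimality.recompute coprime

module Reduction {p : ℕ} (pr : Prime p) where
  open PrimeMod pr

  -- q is p-integral with residue z.
  infix 4 _~_
  record _~_ (q : ℚ) (z : ℤ) : Set where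
    constructor reduces
    field
      d c  : ℤ
      p∤d  : p∤ d
      frac : q ℚ.* ιℚ d ≡ ιℚ (d ℤ.* z ℤ.+ P ℤ.* c)

  P≢0 : P ≢ 0ℤ
  P≢0 e with ℤ.+-injective e
  ... | ≡.refl = ℕ.<⇒≱ 1<p z≤n

  p∤1 : p∤ 1ℤ
  p∤1 = <⇒p∤ (s≤s z≤n) 1<p

  ~-ιℚ : ∀ z → ιℚ z ~ z
  ~-ιℚ z = reduces 1ℤ 0ℤ p∤1 (≡.trans (≡.sym (ιℚ-* z 1ℤ)) (cong ιℚ (lemma z P)))
    where
    lemma : ∀ z p → z ℤ.* 1ℤ ≡ 1ℤ ℤ.* z ℤ.+ p ℤ.* 0ℤ
    lemma = ℤ-solve-∀

  ~-ℕ : ∀ n → ℕ→ℚ n ~ + n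
  ~-ℕ n = subst (_~ + n) (≡.sym (ℕ→ℚ≡ιℚ n)) (~-ιℚ (+ n))

  ~-cong : ∀ {q z z′} → z ≅ z′ [ P ] → q ~ z → q ~ z′
  ~-cong {z′ = z′} (t , ≡.refl) (reduces d c n e) = reduces d (d ℤ.* t ℤ.+ c) n (≡.trans e (cong ιℚ (lemma d z′ t P c)))
    where
    lemma : ∀ d z t p c → d ℤ.* (z ℤ.+ p ℤ.* t) ℤ.+ p ℤ.* c ≡ d ℤ.* z ℤ.+ p ℤ.* (d ℤ.* t ℤ.+ c)
    lemma = ℤ-solve-∀

  ~-+ : ∀ {q q′ z z′} → q ~ z → q′ ~ z′ → q ℚ.+ q′ ~ z ℤ.+ z′
  ~-+ {q} {q′} {z} {z′} (reduces d c n e) (reduces d′ c′ n′ e′) = reduces (d ℤ.* d′) (c ℤ.* d′ ℤ.+ c′ ℤ.* d) (p∤-* n n′)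
    (≡.trans (fraction-+ q q′ d (d ℤ.* z ℤ.+ P ℤ.* c) d′ (d′ ℤ.* z′ ℤ.+ P ℤ.* c′) e e′) (cong ιℚ (lemma d z c d′ z′ c′ P)))
    where
    lemma : ∀ d z c d′ z′ c′ p → (d ℤ.* z ℤ.+ p ℤ.* c) ℤ.* d′ ℤ.+ (d′ ℤ.* z′ ℤ.+ p ℤ.* c′) ℤ.* d
      ≡ d ℤ.* d′ ℤ.* (z ℤ.+ z′) ℤ.+ p ℤ.* (c ℤ.* d′ ℤ.+ c′ ℤ.* d)
    lemma = ℤ-solve-∀

  ~-* : ∀ {q q′ z z′} → q ~ z → q′ ~ z′ → q ℚ.* q′ ~ z ℤ.* z′
  ~-* {q} {q′} {z} {z′} (reduces d c n e) (reduces d′ c′ n′ e′) = reduces (d ℤ.* d′)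
    (c ℤ.* d′ ℤ.* z′ ℤ.+ d ℤ.* z ℤ.* c′ ℤ.+ P ℤ.* c ℤ.* c′) (p∤-* n n′)
    (≡.trans (fraction-* q q′ d (d ℤ.* z ℤ.+ P ℤ.* c) d′ (d′ ℤ.* z′ ℤ.+ P ℤ.* c′) e e′) (cong ιℚ (lemma d z c d′ z′ c′ P)))
    where
    lemma : ∀ d z c d′ z′ c′ p → (d ℤ.* z ℤ.+ p ℤ.* c) ℤ.* (d′ ℤ.* z′ ℤ.+ p ℤ.* c′)
      ≡ d ℤ.* d′ ℤ.* (z ℤ.* z′) ℤ.+ p ℤ.* (c ℤ.* d′ ℤ.* z′ ℤ.+ d ℤ.* z ℤ.* c′ ℤ.+ p ℤ.* c ℤ.* c′)
    lemma = ℤ-solve-∀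

  ~-unique : ∀ {q z z′} → q ~ z → q ~ z′ → z ≅ z′ [ P ]
  ~-unique {q} {z} {z′} (reduces d c n e) (reduces d′ c′ n′ e′) =
    cancel z z′ (p∤-* n n′) (c′ ℤ.* d ℤ.- c ℤ.* d′ , ≡.trans (lemma₁ d z c d′ P) (≡.trans
      (cong (ℤ._- P ℤ.* (c ℤ.* d′)) cross) (lemma₂ d c d′ z′ c′ P)))
    where
    cross : (d ℤ.* z ℤ.+ P ℤ.* c) ℤ.* d′ ≡ (d′ ℤ.* z′ ℤ.+ P ℤ.* c′) ℤ.* d
    cross = ιℚ-injective {(d ℤ.* z ℤ.+ P ℤ.* c) ℤ.* d′} {(d′ ℤ.* z′ ℤ.+ P ℤ.* c′) ℤ.* d}
      (fraction-cross q d (d ℤ.* z ℤ.+ P ℤ.* c) d′ (d′ ℤ.* z′ ℤ.+ P ℤ.* c′) e e′)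
    lemma₁ : ∀ d z c d′ p → d ℤ.* d′ ℤ.* z ≡ (d ℤ.* z ℤ.+ p ℤ.* c) ℤ.* d′ ℤ.- p ℤ.* (c ℤ.* d′)
    lemma₁ = ℤ-solve-∀
    lemma₂ : ∀ d c d′ z′ c′ p → (d′ ℤ.* z′ ℤ.+ p ℤ.* c′) ℤ.* d ℤ.- p ℤ.* (c ℤ.* d′)
      ≡ d ℤ.* d′ ℤ.* z′ ℤ.+ p ℤ.* (c′ ℤ.* d ℤ.- c ℤ.* d′)
    lemma₂ = ℤ-solve-∀

  inverse : ∀ m → p∤ m → Σ ℤ λ i → m ℤ.* i ≅ 1ℤ [ P ]
  inverse m n = go p 1<p (fermat′ n)
    where
    go : ∀ p → 1 ℕ.< p → m ℤ.^ (p ℕ.∸ 1) ≅ 1ℤ [ P ] → Σ ℤ λ i → m ℤ.* i ≅ 1ℤ [ P ]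
    go (suc zero) (s≤s ()) _
    go (suc (suc p)) _ e = m ℤ.^ p , e

  ~-divide : ∀ {q q′ z′} m → p∤ m → q ℚ.* ιℚ m ≡ q′ → q′ ~ z′ → Σ ℤ λ z → q ~ z × m ℤ.* z ≅ z′ [ P ]
  ~-divide {q} {q′} {z′} m n eq (reduces d c n′ e) = z , reduces-z (Mod.≅-sym P mz) , mz
    where
    i = proj₁ (inverse m n)
    z = i ℤ.* z′
    mz : m ℤ.* z ≅ z′ [ P ]
    mz = Mod.≅-trans P (Mod.≡⇒≅ P (≡.sym (ℤ.*-assoc m i z′)))
      (Mod.≅-trans P (Mod.*-cong P (proj₂ (inverse m n)) (Mod.≅-refl P {z′})) (Mod.≡⇒≅ P (ℤ.*-identityˡ z′)))
    reduces-z : z′ ≅ m ℤ.* z [ P ] → q ~ z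
    reduces-z (t , z′≡) = reduces (m ℤ.* d) (d ℤ.* t ℤ.+ c) (p∤-* n n′)
      (≡.trans (fraction-assoc q q′ m d (d ℤ.* z′ ℤ.+ P ℤ.* c) eq e)
        (cong ιℚ (≡.trans (cong (λ x → d ℤ.* x ℤ.+ P ℤ.* c) z′≡) (lemma d m z P t c))))
      where
      lemma : ∀ d m z p t c → d ℤ.* (m ℤ.* z ℤ.+ p ℤ.* t) ℤ.+ p ℤ.* c ≡ m ℤ.* d ℤ.* z ℤ.+ p ℤ.* (d ℤ.* t ℤ.+ c)
      lemma = ℤ-solve-∀

  cross-multiply : ∀ r d c → r ℚ.* ιℚ d ≡ ιℚ c → ℚ.↥ r ℤ.* d ≡ c ℤ.* ℚ.↧ r
  cross-multiply r d c e = ιℚ-injective {ℚ.↥ r ℤ.* d} {c ℤ.* ℚ.↧ r} (fraction-cross r (ℚ.↧ r) (ℚ.↥ r) d c (numerator-eq r) e)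

  -- By cross multiplication numerator · d = c · denominator. If p divided the reduced denominator
  -- it would divide the numerator as well, because it does not divide d.
  p∤denominator : ∀ r d c → p∤ d → r ℚ.* ιℚ d ≡ ιℚ c → ¬ (p ℕ.∣ ℚ.denominatorℕ r)
  p∤denominator r d c p∤d e p∣D = ℕ.<⇒≢ 1<p (≡.sym (reduced r (p∣n , p∣D)))
    where
    p∣n : p ℕ.∣ ℤ.∣ ℚ.↥ r ∣
    p∣n = [ ≅0⇒∣ , (λ h → ⊥-elim (p∤d h)) ]′ (euclid (ℚ.↥ r) d (∣⇒≅0 (subst (p ℕ.∣_)
      (≡.sym (≡.trans (cong ℤ.∣_∣ (cross-multiply r d c e)) (ℤ.abs-* c (ℚ.↧ r)))) (ℕ.∣n⇒∣m*n ℤ.∣ c ∣ p∣D))))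

  -- Over the common denominator d d′ the parts d d′ z cancel, and a multiple of p is left in the
  -- numerator.
  ~⇒≡ : ∀ {q q′ z} → q ~ z → q′ ~ z → q ≡ q′ [modℚ p ]
  ~⇒≡ {q} {q′} {z} (reduces d c n e) (reduces d′ c′ n′ e′) =
    subst (λ x → ¬ (p ℕ.∣ ℚ.denominatorℕ ((q ℚ.- q′) ℚ.* inv x))) (≡.sym (ℕ→ℚ≡ιℚ p))
    (p∤denominator ((q ℚ.- q′) ℚ.* inv (ιℚ P)) (d ℤ.* d′)
    (c ℤ.* d′ ℤ.- c′ ℤ.* d) (p∤-* n n′)
    (fraction-cancel ((q ℚ.- q′) ℚ.* inv (ιℚ P) ℚ.* ιℚ (d ℤ.* d′)) (ιℚ (c ℤ.* d′ ℤ.- c′ ℤ.* d)) (inv (ιℚ P)) P (inv-ιℚ P≢0)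
      (≡.trans (fraction-difference q q′ (inv (ιℚ P)) P d (d ℤ.* z ℤ.+ P ℤ.* c) d′ (d′ ℤ.* z ℤ.+ P ℤ.* c′) (inv-ιℚ P≢0) e e′)
      (≡.trans (cong ιℚ (lemma d z c d′ c′ P)) (ιℚ-* (c ℤ.* d′ ℤ.- c′ ℤ.* d) P)))))
    where
    lemma : ∀ d z c d′ c′ p → (d ℤ.* z ℤ.+ p ℤ.* c) ℤ.* d′ ℤ.- (d′ ℤ.* z ℤ.+ p ℤ.* c′) ℤ.* d ≡ (c ℤ.* d′ ℤ.- c′ ℤ.* d) ℤ.* p
    lemma = ℤ-solve-∀

  ~-Σ : ∀ n {f : ℕ → ℚ} {g : Seq} → (∀ k → k ℕ.< n → f k ~ g k) → Σℚ< n f ~ Σℤ< n g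
  ~-Σ zero    h = ~-ℕ 0
  ~-Σ (suc n) h = ~-+ (~-Σ n (λ k k<n → h k (ℕ.m<n⇒m<1+n k<n))) (h n ℕ.≤-refl)

  -- The recursion for B_j divides only by j + 1, which stays below p, so by induction p enters no
  -- denominator.
  bernoulli-integral : ∀ j → suc j ℕ.< p → Σ ℤ λ b → bernoulli j ~ b
  bernoulli-integral = <-rec _ go
    where
    go : ∀ j → (∀ {i} → i ℕ.< j → suc i ℕ.< p → Σ ℤ λ b → bernoulli i ~ b) → suc j ℕ.< p → Σ ℤ λ b → bernoulli j ~ b
    go zero    _   _   = 1ℤ , subst (_~ 1ℤ) (≡.sym (ℕ→ℚ≡ιℚ 1)) (~-ιℚ 1ℤ)
    go (suc j) rec j<p = let b , b~ , _ = ~-divide {q = bernoulli (suc j)} (+ n) (<⇒p∤ (s≤s z≤n) j<p) eq (~-* (~-ιℚ (ℤ.- 1ℤ)) sum~)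
                         in b , b~
      where
      n = suc (suc j)
      choose : ∀ k → k ℕ.< suc j → Σ ℤ λ b → bernoulli k ~ b
      choose k k<j = rec k<j (ℕ.<-trans (s≤s k<j) j<p)
      -- The decision is an argument, so that `term` can match on it and recover the bound on which
      -- the residue depends.
      residueOf : ∀ k → Dec (k ℕ.< suc j) → ℤ
      residueOf k (yes k<j) = + (n C k) ℤ.* proj₁ (choose k k<j)
      residueOf k (no  _)   = 0ℤ
      residue : Seq
      residue k = residueOf k (k ℕ.<? suc j)
      partial : ℕ → ℚ
      partial k = ℕ→ℚ (n C k) ℚ.* bernoulli k
      term : ∀ k d → k ℕ.< suc j → partial k ~ residueOf k d
      term k (yes k<j) _   = ~-* (~-ℕ (n C k)) (proj₂ (choose k k<j))
      term k (no  k≮j) k<j = ⊥-elim (k≮j k<j)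
      sum~ : Σℚ< (suc j) partial ~ Σℤ< (suc j) residue
      sum~ = ~-Σ (suc j) {partial} {residue} (λ k → term k (k ℕ.<? suc j))
      eq : bernoulli (suc j) ℚ.* ιℚ (+ n) ≡ ιℚ (ℤ.- 1ℤ) ℚ.* Σℚ< (suc j) partial
      eq = solve-linear (bernoulli (suc j)) (inv (ιℚ (+ n))) (+ n) (Σℚ< (suc j) partial) (inv-ιℚ {+ n} (λ ()))
        (≡.trans (bernoulli-suc j) (cong (λ x → ℚ.- (inv x ℚ.* Σℚ< (suc j) partial)) (ℕ→ℚ≡ιℚ n)))

-- Bernoulli numbers modulo p

E-ε-⊛ : ∀ v j → (E ε ⊛ v) j ≡ Σℤ< j (λ k → + (j C k) ℤ.* v k)
E-ε-⊛ v j = begin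
  (E ε ⊛ v) j  ≡⟨ ⊛-distribʳ v (expo 1ℤ) (constant (ℤ.- 1ℤ)) j ⟩
  (expo 1ℤ ⊛ v) j ℤ.+ (constant (ℤ.- 1ℤ) ⊛ v) j  ≡⟨ cong₂ ℤ._+_ (expo-1-⊛ v j) (⊛-constant (ℤ.- 1ℤ) v j) ⟩
  s ℤ.+ + (j C j) ℤ.* v j ℤ.+ ℤ.- 1ℤ ℤ.* v j  ≡⟨ cong (λ c → s ℤ.+ + c ℤ.* v j ℤ.+ ℤ.- 1ℤ ℤ.* v j) (nCn≡1 j) ⟩
  s ℤ.+ 1ℤ ℤ.* v j ℤ.+ ℤ.- 1ℤ ℤ.* v j  ≡⟨ lemma s (v j) ⟩
  s  ∎
  where
  open ≡-Reasoning
  s = Σℤ< j (λ k → + (j C k) ℤ.* v k)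
  lemma : ∀ s a → s ℤ.+ 1ℤ ℤ.* a ℤ.+ ℤ.- 1ℤ ℤ.* a ≡ s
  lemma = ℤ-solve-∀

[1+n]Cn : ∀ n → suc n C n ≡ suc n
[1+n]Cn n = ≡.trans (nCk≡nC[n∸k] (ℕ.n≤1+n n)) (≡.trans (cong (suc n C_) (ℕ.m+n∸n≡m 1 n)) (nC1≡n (suc n)))

bernoulli-sum : ∀ m → Σℚ< (suc (suc m)) (λ k → ℕ→ℚ (suc (suc m) C k) ℚ.* bernoulli k) ≡ 0ℚ
bernoulli-sum m = ≡.trans
  (cong (λ c → s ℚ.+ c ℚ.* bernoulli (suc m)) (≡.trans (cong ℕ→ℚ ([1+n]Cn (suc m))) (ℕ→ℚ≡ιℚ n)))
  (vanish s (bernoulli (suc m)) (solve-linear (bernoulli (suc m)) (inv (ιℚ (+ n))) (+ n) s (inv-ιℚ {+ n} (λ ()))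
    (≡.trans (bernoulli-suc m) (cong (λ x → ℚ.- (inv x ℚ.* s)) (ℕ→ℚ≡ιℚ n)))))
  where
  n = suc (suc m)
  s = Σℚ< (suc m) (λ k → ℕ→ℚ (n C k) ℚ.* bernoulli k)
  vanish : ∀ s b → b ℚ.* ιℚ (+ n) ≡ ιℚ (ℤ.- 1ℤ) ℚ.* s → s ℚ.+ ιℚ (+ n) ℚ.* b ≡ 0ℚ
  vanish = linear-vanish (+ n)

module BernoulliResidue {p : ℕ} (pr : Prime p) where
  open PrimeMod pr
  open Reduction pr

  -- B_(p-1) is not p-integral. From index p - 1 on the value 0 is a filler, which does not enter
  -- the coefficients of (e^z - 1) β below degree p.
  residueOf : ∀ j → Dec (suc j ℕ.< p) → ℤ
  residueOf j (yes j<p) = proj₁ (bernoulli-integral j j<p)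
  residueOf j (no  _)   = 0ℤ

  β : Seq
  β j = residueOf j (suc j ℕ.<? p)

  bernoulli~β : ∀ j → suc j ℕ.< p → bernoulli j ~ β j
  bernoulli~β j j<p = go (suc j ℕ.<? p)
    where
    go : ∀ d → bernoulli j ~ residueOf j d
    go (yes j<p′) = proj₂ (bernoulli-integral j j<p′)
    go (no  j≮p)  = ⊥-elim (j≮p j<p)

  -- From index 2 on, the recursion of the Bernoulli numbers states that a rational sum is 0; so 0
  -- has the sum of the residues as a residue, and residues are unique. Index 1 expresses B_0 = 1.
  εβ≈z : Hurwitz._≈_ P p (E ε ⊛ β) var
  εβ≈z = Hurwitz.⟪ (λ j j<p → Mod.≅-trans P (Mod.≡⇒≅ P (E-ε-⊛ β j)) (go j j<p)) ⟫
    where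
    go : ∀ j → j ℕ.< p → Σℤ< j (λ k → + (j C k) ℤ.* β k) ≅ var j [ P ]
    go 0 _ = Mod.≅-refl P
    go 1 j<p = Mod.≅-trans P (Mod.≡⇒≅ P (lemma (β 0))) (~-unique (bernoulli~β 0 j<p) (~-ℕ 1))
      where
      lemma : ∀ b → 0ℤ ℤ.+ 1ℤ ℤ.* b ≡ b
      lemma = ℤ-solve-∀
    go (suc (suc m)) j<p = ~-unique {q = 0ℚ} (subst (_~ sum) (bernoulli-sum m)
      (~-Σ (suc (suc m)) (λ k k<m → ~-* (~-ℕ (suc (suc m) C k)) (bernoulli~β k (ℕ.≤-trans (s≤s k<m) j<p))))) (~-ℕ 0)
      where
      sum = Σℤ< (suc (suc m)) (λ k → + (suc (suc m) C k) ℤ.* β k)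

-- Euler's function at a prime power

-- The local function of φ cannot be named from outside; unification recovers it.
mutual
  count : ℕ → ℕ → ℕ
  count = _

  φ-unfold : ∀ m → φ (suc m) ≡ count (suc m) m ℕ.+ (if ⌊ gcd (suc m) (suc m) ℕ.≟ 1 ⌋ then 1 else 0)
  -- Abstracting the last summand and then `suc m` leaves the unknown `count` applied to two
  -- distinct variables, which determines it.
  φ-unfold m with gcd (suc m) (suc m)
  ... | _ with suc m
  ... | _ = ≡.refl

module Totient {p : ℕ} (pr : Prime p) (b : ℕ) where
  open PrimeMod pr using (1<p; l; p≡1+l)

  private
    q = p ℕ.^ suc b

  p∣p^ : p ℕ.∣ q
  p∣p^ = ℕ.m∣m*n (p ℕ.^ b)

  ∣p^⇒p∣ : ∀ b d → d ℕ.∣ p ℕ.^ b → d ≢ 1 → p ℕ.∣ d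
  ∣p^⇒p∣ zero    d d∣1 d≢1 = ⊥-elim (d≢1 (ℕ.∣1⇒≡1 d∣1))
  ∣p^⇒p∣ (suc b) d (ℕ.divides c eq) d≢1 with euclidsLemma c d pr (subst (p ℕ.∣_) eq (ℕ.m∣m*n (p ℕ.^ b)))
  ... | inj₂ p∣d = p∣d
  ... | inj₁ (ℕ.divides c′ c≡) = ∣p^⇒p∣ b d (ℕ.divides c′ (ℕ.*-cancelˡ-≡ (p ℕ.^ b) (c′ ℕ.* d) p {{ℕ.>-nonZero (ℕ.<⇒≤ 1<p)}}
    (≡.trans eq (≡.trans (cong (ℕ._* d) c≡) (lemma c′ p d))))) d≢1
    where
    lemma : ∀ c p d → c ℕ.* p ℕ.* d ≡ p ℕ.* (c ℕ.* d)
    lemma = ℕ-solve-∀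

  weight : ℕ → ℕ
  weight i = if ⌊ gcd i q ℕ.≟ 1 ⌋ then 1 else 0

  weight-∣ : ∀ i → p ℕ.∣ i → weight i ≡ 0
  weight-∣ i p∣i with gcd i q ℕ.≟ 1
  ... | no  _ = ≡.refl
  ... | yes e = ⊥-elim (ℕ.<⇒≢ 1<p (≡.sym (ℕ.∣1⇒≡1 (subst (p ℕ.∣_) e (gcd-greatest p∣i p∣p^)))))

  weight-∤ : ∀ i → ¬ p ℕ.∣ i → weight i ≡ 1
  weight-∤ i p∤i with gcd i q ℕ.≟ 1
  ... | yes _ = ≡.refl
  ... | no  n = ⊥-elim (p∤i (ℕ.∣-trans (∣p^⇒p∣ (suc b) (gcd i q) (gcd[m,n]∣n i q) n) (gcd[m,n]∣m i q)))

  -- Numbers strictly between two consecutive multiples of p are prime to p, so each counts once.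
  count-block : ∀ k i → i ℕ.< p → count q (k ℕ.* p ℕ.+ i) ≡ count q (k ℕ.* p) ℕ.+ i
  count-block k zero    _   = ≡.trans (cong (count q) (ℕ.+-identityʳ (k ℕ.* p))) (≡.sym (ℕ.+-identityʳ (count q (k ℕ.* p))))
  count-block k (suc i) i<p = begin
    count q (k ℕ.* p ℕ.+ suc i)  ≡⟨ cong (count q) (ℕ.+-suc (k ℕ.* p) i) ⟩
    count q (k ℕ.* p ℕ.+ i) ℕ.+ weight (suc (k ℕ.* p ℕ.+ i)) ≡⟨ cong₂ ℕ._+_ (count-block k i (ℕ.<-trans (ℕ.n<1+n i) i<p)) (weight-∤ _ p∤) ⟩
    count q (k ℕ.* p) ℕ.+ i ℕ.+ 1  ≡⟨ ≡.trans (ℕ.+-assoc _ i 1) (cong (count q (k ℕ.* p) ℕ.+_) (ℕ.+-comm i 1)) ⟩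
    count q (k ℕ.* p) ℕ.+ suc i  ∎
    where
    open ≡-Reasoning
    p∤ : ¬ p ℕ.∣ suc (k ℕ.* p ℕ.+ i)
    p∤ d = ℕ.<⇒≱ i<p (ℕ.∣⇒≤ (ℕ.∣m+n∣m⇒∣n (subst (p ℕ.∣_) (≡.sym (ℕ.+-suc (k ℕ.* p) i)) d) (ℕ.n∣m*n k)))

  count-multiple : ∀ k → count q (k ℕ.* p) ≡ k ℕ.* l
  count-multiple zero    = ≡.refl
  count-multiple (suc k) = begin
    count q (p ℕ.+ k ℕ.* p)  ≡⟨ cong (count q) last ⟩
    count q (k ℕ.* p ℕ.+ l) ℕ.+ weight (suc (k ℕ.* p ℕ.+ l))
      ≡⟨ cong₂ ℕ._+_ (count-block k l (ℕ.≤-reflexive p≡1+l)) (weight-∣ _ (subst (p ℕ.∣_) last (ℕ.n∣m*n (suc k)))) ⟩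
    count q (k ℕ.* p) ℕ.+ l ℕ.+ 0  ≡⟨ ≡.trans (ℕ.+-identityʳ _) (cong (ℕ._+ l) (count-multiple k)) ⟩
    k ℕ.* l ℕ.+ l  ≡⟨ ℕ.+-comm (k ℕ.* l) l ⟩
    l ℕ.+ k ℕ.* l  ∎
    where
    open ≡-Reasoning
    last : p ℕ.+ k ℕ.* p ≡ suc (k ℕ.* p ℕ.+ l)
    last = ≡.trans (ℕ.+-comm p (k ℕ.* p)) (≡.trans (cong (k ℕ.* p ℕ.+_) (≡.sym p≡1+l)) (ℕ.+-suc (k ℕ.* p) l))

  φ-prime-power : φ (p ℕ.^ suc b) ≡ l ℕ.* p ℕ.^ b
  φ-prime-power = ≡.trans (cong (count q) (ℕ.*-comm p (p ℕ.^ b))) (≡.trans (count-multiple (p ℕ.^ b)) (ℕ.*-comm (p ℕ.^ b) l))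

-- Alternating binomial sums and Stirling numbers

sgn-even : ∀ h → sgn (h ℕ.+ h) ≡ 1ℤ
sgn-even h = ℤ.*-cancelˡ-≡ (ℤ.- 1ℤ) _ _ (-1^odd h)

sgn-+ : ∀ a b → sgn (a ℕ.+ b) ≡ sgn a ℤ.* sgn b
sgn-+ = ℤ.^-distribˡ-+-* (ℤ.- 1ℤ)

module Sums {p : ℕ} (pr : Prime p) (h : ℕ) (p≡1+2h : p ≡ suc (h ℕ.+ h)) where
  open PrimeMod pr
  open Trace pr
  open CyclicPrime pr h p≡1+2h using (X^p≈1)

  Cp≡ : ∀ n → Cp p n (+ 0) ≡ binomialSum n (λ k → sgn k ℤ.* indicator k)
  Cp≡ n = Σ-cong (suc n) (λ k _ → term k)
    where
    term : ∀ k → (if ⌊ P ℤ∣.∣? (+ k ℤ.- + 0) ⌋ then + (n C k) ℤ.* sgn k else + 0) ≡ + (n C k) ℤ.* (sgn k ℤ.* indicator k)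
    term k with P ℤ∣.∣? (+ k ℤ.- + 0)
    ... | yes d = ≡.sym (cong (+ (n C k) ℤ.*_) (≡.trans
      (cong (sgn k ℤ.*_) (indicator-∣ (subst (λ c → p ℕ.∣ ℤ.∣ c ∣) (ℤ.+-identityʳ (+ k)) (ℤ∣.∣⇒∣ᵤ d)))) (ℤ.*-identityʳ (sgn k))))
    ... | no ∤k = ≡.sym (≡.trans (cong (+ (n C k) ℤ.*_) (≡.trans
      (cong (sgn k ℤ.*_) (indicator-∤ (λ d → ∤k (ℤ∣.∣ᵤ⇒∣ (subst (λ c → p ℕ.∣ ℤ.∣ c ∣) (≡.sym (ℤ.+-identityʳ (+ k))) d)))))
      (ℤ.*-zeroʳ (sgn k)))) (ℤ.*-zeroʳ (+ (n C k))))

  T-ε^ : ∀ n → T (ε ^ᵖ n) ≡ sgn n ℤ.* Cp p n (+ 0)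
  T-ε^ n = ≡.trans (act-ε^ n indicator 0) (cong (sgn n ℤ.*_) (≡.sym (Cp≡ n)))

  sgn-p* : ∀ j → sgn (p ℕ.* j) ≡ sgn j
  sgn-p* j = ≡.trans (cong (λ a → sgn (a ℕ.* j)) p≡1+2h) (≡.trans (cong sgn (lemma h j))
    (≡.trans (sgn-+ (h ℕ.* j ℕ.+ h ℕ.* j) j) (≡.trans (cong (ℤ._* sgn j) (sgn-even (h ℕ.* j))) (ℤ.*-identityˡ (sgn j)))))
    where
    lemma : ∀ h j → suc (h ℕ.+ h) ℕ.* j ≡ h ℕ.* j ℕ.+ h ℕ.* j ℕ.+ j
    lemma = ℕ-solve-∀

  Σ-append : ∀ a b (f : Seq) → Σℤ< (a ℕ.+ b) f ≡ Σℤ< a f ℤ.+ Σℤ< b (λ i → f (a ℕ.+ i))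
  Σ-append a zero    f = ≡.trans (cong (λ c → Σℤ< c f) (ℕ.+-identityʳ a)) (≡.sym (ℤ.+-identityʳ _))
  Σ-append a (suc b) f = ≡.trans (cong (λ c → Σℤ< c f) (ℕ.+-suc a b)) (≡.trans (cong (ℤ._+ f (a ℕ.+ b)) (Σ-append a b f))
    (ℤ.+-assoc (Σℤ< a f) _ (f (a ℕ.+ b))))

  Σ-zero : ∀ n (f : Seq) → (∀ k → k ℕ.< n → f k ≡ 0ℤ) → Σℤ< n f ≡ 0ℤ
  Σ-zero zero    f h = ≡.refl
  Σ-zero (suc n) f h = cong₂ ℤ._+_ (Σ-zero n f (λ k k<n → h k (ℕ.m<n⇒m<1+n k<n))) (h n ℕ.≤-refl)

  -- In each block of p consecutive indices only the last one, k = p(j + 1) - 1, has p ∣ k + 1.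
  Σ-sieve : ∀ n (f : Seq) → Σℤ< (n ℕ.* p) (λ k → f k ℤ.* indicator (suc k)) ≡ Σℤ< n (λ j → f (p ℕ.* suc j ℕ.∸ 1))
  Σ-sieve zero    f = ≡.refl
  Σ-sieve (suc n) f = begin
    Σℤ< (p ℕ.+ n ℕ.* p) F  ≡⟨ cong (λ c → Σℤ< c F) (ℕ.+-comm p (n ℕ.* p)) ⟩
    Σℤ< (n ℕ.* p ℕ.+ p) F  ≡⟨ Σ-append (n ℕ.* p) p F ⟩
    Σℤ< (n ℕ.* p) F ℤ.+ Σℤ< p (λ i → F (n ℕ.* p ℕ.+ i))  ≡⟨ cong₂ ℤ._+_ (Σ-sieve n f) block ⟩
    Σℤ< n (λ j → f (p ℕ.* suc j ℕ.∸ 1)) ℤ.+ f (p ℕ.* suc n ℕ.∸ 1) ∎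
    where
    open ≡-Reasoning
    F : Seq
    F k = f k ℤ.* indicator (suc k)
    last : n ℕ.* p ℕ.+ l ≡ p ℕ.* suc n ℕ.∸ 1
    last = cong (ℕ._∸ 1) (≡.trans (≡.sym (ℕ.+-suc (n ℕ.* p) l)) (≡.trans (cong (n ℕ.* p ℕ.+_) p≡1+l) (lemma n p)))
      where
      lemma : ∀ n p → n ℕ.* p ℕ.+ p ≡ p ℕ.* suc n
      lemma = ℕ-solve-∀
    block : Σℤ< p (λ i → F (n ℕ.* p ℕ.+ i)) ≡ f (p ℕ.* suc n ℕ.∸ 1)
    block = begin
      Σℤ< p (λ i → F (n ℕ.* p ℕ.+ i))  ≡⟨ cong (λ c → Σℤ< c (λ i → F (n ℕ.* p ℕ.+ i))) p≡1+l ⟨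
      Σℤ< l (λ i → F (n ℕ.* p ℕ.+ i)) ℤ.+ F (n ℕ.* p ℕ.+ l)
        ≡⟨ cong₂ ℤ._+_ (Σ-zero l _ (λ i i<l →
             ≡.trans (cong (f (n ℕ.* p ℕ.+ i) ℤ.*_) (indicator-∤ (∤next i i<l))) (ℤ.*-zeroʳ (f (n ℕ.* p ℕ.+ i)))))
             (≡.trans (cong (f (n ℕ.* p ℕ.+ l) ℤ.*_) (indicator-∣ ∣next)) (ℤ.*-identityʳ (f (n ℕ.* p ℕ.+ l)))) ⟩
      0ℤ ℤ.+ f (n ℕ.* p ℕ.+ l)  ≡⟨ ≡.trans (ℤ.+-identityˡ _) (cong f last) ⟩
      f (p ℕ.* suc n ℕ.∸ 1)  ∎
      where
      ∤next : ∀ i → i ℕ.< l → ¬ p ℕ.∣ suc (n ℕ.* p ℕ.+ i)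
      ∤next i i<l d = ℕ.<⇒≱ (ℕ.≤-trans (s≤s i<l) (ℕ.≤-reflexive p≡1+l))
        (ℕ.∣⇒≤ (ℕ.∣m+n∣m⇒∣n (subst (p ℕ.∣_) (≡.sym (ℕ.+-suc (n ℕ.* p) i)) d) (ℕ.n∣m*n n)))
      ∣next : p ℕ.∣ suc (n ℕ.* p ℕ.+ l)
      ∣next = subst (p ℕ.∣_) (≡.trans (≡.cong₂ ℕ._+_ (≡.refl {x = n ℕ.* p}) (≡.sym p≡1+l)) (ℕ.+-suc (n ℕ.* p) l))
        (ℕ.∣m∣n⇒∣m+n (ℕ.n∣m*n n) ℕ.∣-refl)

  -- The reflection x ↦ x^(p-1) = x^(-1).
  T-reflect : ∀ j → T (ε ^ᵖ suc (j ℕ.+ j)) ≡ sgn (suc (j ℕ.+ j)) ℤ.* T (X ^ᵖ (l ℕ.* suc (j ℕ.+ j)) ⊠ ε ^ᵖ suc (j ℕ.+ j))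
  T-reflect j = ≡.trans (≡.sym (T-sub p∤l (ε ^ᵖ M))) (T-cong (begin
    sub l (ε ^ᵖ M)  ≈⟨ ≡⇒≈ (sub-^ l ε M) ⟩
    (X ^ᵖ l ⊞ con (ℤ.- 1ℤ)) ^ᵖ M  ≈⟨ ^-cong M base ⟩
    (con (ℤ.- 1ℤ) ⊠ (X ^ᵖ l ⊠ ε)) ^ᵖ M  ≈⟨ ^-distrib-* (con (ℤ.- 1ℤ)) (X ^ᵖ l ⊠ ε) M ⟩
    con (ℤ.- 1ℤ) ^ᵖ M ⊠ (X ^ᵖ l ⊠ ε) ^ᵖ M  ≈⟨ *-cong (sym (ι-^ (ℤ.- 1ℤ) M)) (^-distrib-* (X ^ᵖ l) ε M) ⟩
    con (sgn M) ⊠ ((X ^ᵖ l) ^ᵖ M ⊠ ε ^ᵖ M)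
      ≈⟨ *-congˡ {con (sgn M)} (*-congʳ {ε ^ᵖ M} (trans (sym (^-assoc X M l)) (≡⇒≈ (cong (X ^ᵖ_) (ℕ.*-comm M l))))) ⟩
    con (sgn M) ⊠ (X ^ᵖ (l ℕ.* M) ⊠ ε ^ᵖ M)  ∎))
    where
    open Cyclic p using (algebra)
    open ℤAlgebra algebra
    open Alg algebra
    open import Relation.Binary.Reasoning.Setoid setoid
    M = suc (j ℕ.+ j)
    p∤l : ¬ p ℕ.∣ l
    p∤l d = ℕ.<⇒≱ (ℕ.≤-reflexive p≡1+l) (ℕ.∣⇒≤ {{ℕ.>-nonZero 0<l}} d)
    base : X ^ᵖ l ⊞ con (ℤ.- 1ℤ) ≈ con (ℤ.- 1ℤ) ⊠ (X ^ᵖ l ⊠ ε)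
    base = begin
      X ^ᵖ l ⊞ con (ℤ.- 1ℤ)
        ≈⟨ solve 1 (λ y → y :+ κ (ℤ.- 1ℤ) := y :- κ 1ℤ) refl (X ^ᵖ l) ⟩
      X ^ᵖ l ⊞ con (ℤ.- 1ℤ) ⊠ con 1ℤ  ≈⟨ +-congˡ (*-congˡ {con (ℤ.- 1ℤ)} (trans (sym X^p≈1) (≡⇒≈ (cong (X ^ᵖ_) (≡.sym p≡1+l))))) ⟩
      X ^ᵖ l ⊞ con (ℤ.- 1ℤ) ⊠ (X ⊠ X ^ᵖ l)
        ≈⟨ solve 2 (λ x y → y :- x :* y := κ (ℤ.- 1ℤ) :* (y :* (x :+ κ (ℤ.- 1ℤ)))) refl X (X ^ᵖ l) ⟩
      con (ℤ.- 1ℤ) ⊠ (X ^ᵖ l ⊠ ε)  ∎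

  periodic-* : ∀ {u} → Periodic p u → ∀ t i → u (t ℕ.* p ℕ.+ i) ≡ u i
  periodic-* {u} per zero    i = ≡.refl
  periodic-* {u} per (suc t) i = ≡.trans (cong u (ℕ.+-assoc p (t ℕ.* p) i)) (≡.trans (per (t ℕ.* p ℕ.+ i)) (periodic-* per t i))

  module _ (j n : ℕ) (N≡ : suc (suc (j ℕ.+ j)) ≡ n ℕ.* p) where
    private
      M = suc (j ℕ.+ j)
      f = ε ^ᵖ M

    -- `T-reflect` produces the factor x^((p-1)M), and (p - 1)M ≡ 1 modulo p because M + 1 = np. The
    -- sign appears because M is odd.
    T-X-ε^ : T f ≡ ℤ.- T (X ⊠ f)
    T-X-ε^ = begin
      T f  ≡⟨ T-reflect j ⟩
      sgn M ℤ.* act (X ^ᵖ (l ℕ.* M)) (act f indicator) 0  ≡⟨ cong₂ ℤ._*_ (-1^odd j) (act-X^ (l ℕ.* M) (act f indicator) 0) ⟩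
      ℤ.- 1ℤ ℤ.* act f indicator (l ℕ.* M ℕ.+ 0)  ≡⟨ cong (λ i → ℤ.- 1ℤ ℤ.* act f indicator i) (≡.trans (ℕ.+-identityʳ (l ℕ.* M)) lM≡) ⟩
      ℤ.- 1ℤ ℤ.* act f indicator (t ℕ.* p ℕ.+ 1)  ≡⟨ cong (ℤ.- 1ℤ ℤ.*_) (periodic-* (act-periodic f indicator-periodic) t 1) ⟩
      ℤ.- 1ℤ ℤ.* T (X ⊠ f)  ≡⟨ ℤ.-1*i≡-i (T (X ⊠ f)) ⟩
      ℤ.- T (X ⊠ f)  ∎
      where
      open ≡-Reasoning
      t = M ℕ.∸ n
      n≤M : n ℕ.≤ M
      n≤M = ℕ.≤-pred (lemma n N≡)
        where
        lemma : ∀ n → suc M ≡ n ℕ.* p → suc n ℕ.≤ suc M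
        lemma (suc n) e = ℕ.≤-trans (ℕ.m<m*n (suc n) p 1<p) (ℕ.≤-reflexive (≡.sym e))
      lM≡ : l ℕ.* M ≡ t ℕ.* p ℕ.+ 1
      lM≡ = ℕ.+-cancelʳ-≡ (suc M) _ _ (begin
        l ℕ.* M ℕ.+ suc M  ≡⟨ lemma₁ l M ⟩
        suc l ℕ.* M ℕ.+ 1  ≡⟨ cong (λ p → p ℕ.* M ℕ.+ 1) p≡1+l ⟩
        p ℕ.* M ℕ.+ 1  ≡⟨ cong (λ m → p ℕ.* m ℕ.+ 1) (ℕ.m∸n+n≡m n≤M) ⟨
        p ℕ.* (t ℕ.+ n) ℕ.+ 1  ≡⟨ lemma₂ p t n ⟩
        t ℕ.* p ℕ.+ 1 ℕ.+ n ℕ.* p  ≡⟨ cong (t ℕ.* p ℕ.+ 1 ℕ.+_) N≡ ⟨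
        t ℕ.* p ℕ.+ 1 ℕ.+ suc M  ∎)
        where
        lemma₁ : ∀ l m → l ℕ.* m ℕ.+ suc m ≡ suc l ℕ.* m ℕ.+ 1
        lemma₁ = ℕ-solve-∀
        lemma₂ : ∀ p t n → p ℕ.* (t ℕ.+ n) ℕ.+ 1 ≡ t ℕ.* p ℕ.+ 1 ℕ.+ n ℕ.* p
        lemma₂ = ℕ-solve-∀

    -- T((x - 1) f) = T(x f) - T(f), and the two terms agree by `T-X-ε^`.
    Cp≡-2T : Cp p (suc M) (+ 0) ≡ ℤ.- (+ 2 ℤ.* T f)
    Cp≡-2T = begin
      Cp p (suc M) (+ 0)  ≡⟨ ℤ.*-identityˡ _ ⟨
      1ℤ ℤ.* Cp p (suc M) (+ 0)  ≡⟨ cong (ℤ._* Cp p (suc M) (+ 0)) sgn-N ⟨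
      sgn (suc M) ℤ.* Cp p (suc M) (+ 0)  ≡⟨ T-ε^ (suc M) ⟨
      T (X ⊠ f) ℤ.+ ℤ.- 1ℤ ℤ.* T f  ≡⟨ lemma (T (X ⊠ f)) (T f) ⟩
      ℤ.- (ℤ.- T (X ⊠ f)) ℤ.- T f  ≡⟨ cong (λ a → ℤ.- a ℤ.- T f) T-X-ε^ ⟨
      ℤ.- T f ℤ.- T f  ≡⟨ lemma′ (T f) ⟩
      ℤ.- (+ 2 ℤ.* T f)  ∎
      where
      open ≡-Reasoning
      sgn-N : sgn (suc M) ≡ 1ℤ
      sgn-N = cong (ℤ.- 1ℤ ℤ.*_) (-1^odd j)
      lemma : ∀ a b → a ℤ.+ ℤ.- 1ℤ ℤ.* b ≡ ℤ.- (ℤ.- a) ℤ.- b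
      lemma = ℤ-solve-∀
      lemma′ : ∀ a → ℤ.- a ℤ.- a ≡ ℤ.- (+ 2 ℤ.* a)
      lemma′ = ℤ-solve-∀

    T-X≡Σ : T (X ⊠ f) ≡ Σℤ< n (λ j → + (M C (p ℕ.* suc j ℕ.∸ 1)) ℤ.* sgn (suc j))
    T-X≡Σ = begin
      act f indicator 1  ≡⟨ act-ε^ M indicator 1 ⟩
      sgn M ℤ.* binomialSum M (λ k → sgn k ℤ.* indicator (suc k))
        ≡⟨ cong (ℤ._* binomialSum M (λ k → sgn k ℤ.* indicator (suc k))) (-1^odd j) ⟩
      ℤ.- 1ℤ ℤ.* Σℤ< (suc M) (λ k → + (M C k) ℤ.* (sgn k ℤ.* indicator (suc k)))
        ≡⟨ cong (ℤ.- 1ℤ ℤ.*_) (≡.trans (Σ-cong (suc M) (λ k _ → ≡.sym (ℤ.*-assoc (+ (M C k)) (sgn k) (indicator (suc k)))))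
             (≡.trans (cong (λ m → Σℤ< m (λ k → g k ℤ.* indicator (suc k))) N≡) (Σ-sieve n g))) ⟩
      ℤ.- 1ℤ ℤ.* Σℤ< n (λ j → g (p ℕ.* suc j ℕ.∸ 1))  ≡⟨ Σ-* n (ℤ.- 1ℤ) (λ j → g (p ℕ.* suc j ℕ.∸ 1)) ⟨
      Σℤ< n (λ j → ℤ.- 1ℤ ℤ.* g (p ℕ.* suc j ℕ.∸ 1))  ≡⟨ Σ-cong n (λ i _ → sign i) ⟩
      Σℤ< n (λ j → + (M C (p ℕ.* suc j ℕ.∸ 1)) ℤ.* sgn (suc j))  ∎
      where
      open ≡-Reasoning
      g : Seq
      g k = + (M C k) ℤ.* sgn k
      sign : ∀ i → ℤ.- 1ℤ ℤ.* g (p ℕ.* suc i ℕ.∸ 1) ≡ + (M C (p ℕ.* suc i ℕ.∸ 1)) ℤ.* sgn (suc i)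
      sign i = ≡.trans (lemma (+ (M C (p ℕ.* suc i ℕ.∸ 1))) (sgn (p ℕ.* suc i ℕ.∸ 1)))
        (cong (+ (M C (p ℕ.* suc i ℕ.∸ 1)) ℤ.*_) (≡.trans
          (cong sgn (ℕ.m+[n∸m]≡n {1} {p ℕ.* suc i} (ℕ.≤-trans (ℕ.<⇒≤ 1<p) (ℕ.m≤m*n p (suc i)))))
          (sgn-p* (suc i))))
        where
        lemma : ∀ c s → ℤ.- 1ℤ ℤ.* (c ℤ.* s) ≡ c ℤ.* (ℤ.- 1ℤ ℤ.* s)
        lemma = ℤ-solve-∀

  n<p^n : ∀ n → n ℕ.< p ℕ.^ n
  n<p^n zero    = s≤s z≤n
  n<p^n (suc n) = ℕ.≤-trans (s≤s (n<p^n n)) (ℕ.≤-trans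
    (ℕ.m<m*n (p ℕ.^ n) p {{ℕ.>-nonZero (ℕ.≤-trans (s≤s z≤n) (n<p^n n))}} 1<p) (ℕ.≤-reflexive (ℕ.*-comm (p ℕ.^ n) p)))

  -- `T-moment` applies modulo p^(b+1): to units by Euler, to multiples of p because M is large. The
  -- moment of (x - 1)^(k+1) at index 0 vanishes, and the one at index M is given by `stirling`.
  T-stirling : ∀ b m k → 1 ℕ.≤ m → T (ε ^ᵖ suc k) ≅ ℤ.- (+ (suc k ! ℕ.* S (m ℕ.* φ (p ℕ.^ suc b)) (suc k))) [ P ℤ.^ suc b ]
  T-stirling b m k 1≤m = Mod.≅-trans q (T-moment q M unit vanish (ε ^ᵖ suc k)) (Mod.≡⇒≅ q (begin
    E (ε ^ᵖ suc k) 0 ℤ.- E (ε ^ᵖ suc k) M  ≡⟨ cong₂ ℤ._-_ (E-ε^-< (suc k) 0 (s≤s z≤n)) (stirling (suc k) M) ⟩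
    0ℤ ℤ.- + (suc k ! ℕ.* S M (suc k))  ≡⟨ ℤ.+-identityˡ _ ⟩
    ℤ.- + (suc k ! ℕ.* S M (suc k))  ∎))
    where
    open ≡-Reasoning
    q = P ℤ.^ suc b
    M = m ℕ.* φ (p ℕ.^ suc b)
    M≡ : M ≡ m ℕ.* (l ℕ.* p ℕ.^ b)
    M≡ = cong (m ℕ.*_) (Totient.φ-prime-power pr b)
    unit : ∀ c → p∤ c → c ℤ.^ M ≅ 1ℤ [ q ]
    unit c n = subst (λ e → c ℤ.^ e ≅ 1ℤ [ q ]) (≡.sym M≡) (euler-multiple n b m)
    -- Since M ≥ p^b > b, the M-th power of a multiple of p is divisible by p^(b+1).
    b<M : suc b ℕ.≤ M
    b<M = ℕ.≤-trans (n<p^n b) (ℕ.≤-trans (ℕ.≤-trans (ℕ.m≤n*m (p ℕ.^ b) l {{ℕ.>-nonZero 0<l}})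
      (ℕ.m≤n*m (l ℕ.* p ℕ.^ b) m {{ℕ.>-nonZero 1≤m}})) (ℕ.≤-reflexive (≡.sym M≡)))
    vanish : ∀ c → c ≅ 0ℤ [ P ] → c ℤ.^ M ≅ 0ℤ [ q ]
    vanish c (t , ≡.refl) = t ℤ.^ suc b ℤ.* (0ℤ ℤ.+ P ℤ.* t) ℤ.^ (M ℕ.∸ suc b) , (begin
      (0ℤ ℤ.+ P ℤ.* t) ℤ.^ M  ≡⟨ cong ((0ℤ ℤ.+ P ℤ.* t) ℤ.^_) (ℕ.m+[n∸m]≡n b<M) ⟨
      (0ℤ ℤ.+ P ℤ.* t) ℤ.^ (suc b ℕ.+ (M ℕ.∸ suc b))  ≡⟨ ℤ.^-distribˡ-+-* (0ℤ ℤ.+ P ℤ.* t) (suc b) (M ℕ.∸ suc b) ⟩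
      (0ℤ ℤ.+ P ℤ.* t) ℤ.^ suc b ℤ.* r  ≡⟨ cong (ℤ._* r) (cong (ℤ._^ suc b) (ℤ.+-identityˡ (P ℤ.* t))) ⟩
      (P ℤ.* t) ℤ.^ suc b ℤ.* r  ≡⟨ cong (ℤ._* r) (*-^ P t (suc b)) ⟩
      P ℤ.^ suc b ℤ.* t ℤ.^ suc b ℤ.* r  ≡⟨ lemma (P ℤ.^ suc b) (t ℤ.^ suc b) r ⟩
      0ℤ ℤ.+ P ℤ.^ suc b ℤ.* (t ℤ.^ suc b ℤ.* r)  ∎)
      where
      r = (0ℤ ℤ.+ P ℤ.* t) ℤ.^ (M ℕ.∸ suc b)
      lemma : ∀ a b c → a ℤ.* b ℤ.* c ≡ 0ℤ ℤ.+ a ℤ.* (b ℤ.* c)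
      lemma = ℤ-solve-∀
      *-^ : ∀ a b n → (a ℤ.* b) ℤ.^ n ≡ a ℤ.^ n ℤ.* b ℤ.^ n
      *-^ a b zero    = ≡.refl
      *-^ a b (suc n) = ≡.trans (cong (a ℤ.* b ℤ.*_) (*-^ a b n)) (swap a b (a ℤ.^ n) (b ℤ.^ n))
        where
        swap : ∀ a b c d → a ℤ.* b ℤ.* (c ℤ.* d) ≡ a ℤ.* c ℤ.* (b ℤ.* d)
        swap = ℤ-solve-∀

-- The quotients of the theorem modulo p

-^-sgn : ∀ a e → (ℤ.- a) ℤ.^ e ≡ sgn e ℤ.* a ℤ.^ e
-^-sgn a zero    = ≡.refl
-^-sgn a (suc e) = ≡.trans (cong (ℤ.- a ℤ.*_) (-^-sgn a e)) (lemma a (sgn e) (a ℤ.^ e))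
  where
  lemma : ∀ a s b → ℤ.- a ℤ.* (s ℤ.* b) ≡ ℤ.- 1ℤ ℤ.* s ℤ.* (a ℤ.* b)
  lemma = ℤ-solve-∀

^-pos : ∀ a n → + (a ℕ.^ n) ≡ (+ a) ℤ.^ n
^-pos a zero    = ≡.refl
^-pos a (suc n) = ≡.trans (ℤ.pos-* a (a ℕ.^ n)) (cong ((+ a) ℤ.*_) (^-pos a n))

module Residue {m : ℕ} (pr : Prime (suc (suc m))) (h : ℕ) (p≡1+2h : suc (suc m) ≡ suc (h ℕ.+ h)) where
  p : ℕ
  p = suc (suc m)
  open PrimeMod pr
  open Trace pr
  open Reduction pr
  open BernoulliResidue pr
  open Conclusion pr h p≡1+2h using (fleck-quotient)

  p∤-sgn : ∀ q → p∤ sgn q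
  p∤-sgn q d = p∤1 (Mod.≅-trans P (Mod.≡⇒≅ P (≡.trans (≡.sym (sgn-even q)) (sgn-+ q q)))
    (Mod.≅-trans P (Mod.*-cong P d (Mod.≅-refl P {sgn q})) (Mod.≡⇒≅ P (ℤ.*-zeroˡ (sgn q)))))

  -P^≢0 : ∀ e → (ℤ.- P) ℤ.^ e ≢ 0ℤ
  -P^≢0 e eq = P≢0 (ℤ.neg-injective (ℤ.i^n≡0⇒i≡0 (ℤ.- P) e eq))

  P^≢0 : ∀ e → P ℤ.^ e ≢ 0ℤ
  P^≢0 e eq = P≢0 (ℤ.i^n≡0⇒i≡0 P e eq)

  -- The error added to τ has one factor p more than R, so it does not change the residue. This
  -- tolerance is what allows C_p(pn, 0) to be replaced by Stirling numbers congruent to it.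
  clear-powers : ∀ U τ K τ′ c t R a b →
    U ℤ.* τ ≡ P ℤ.^ a ℤ.* (P ℤ.^ b ℤ.* K) → τ′ ≡ τ ℤ.+ P ℤ.^ a ℤ.* P ℤ.^ b ℤ.* (P ℤ.* t) ℤ.* c → R ≡ P ℤ.^ a ℤ.* P ℤ.^ b →
    τ′ ℤ.* U ≡ (K ℤ.+ P ℤ.* (t ℤ.* c ℤ.* U)) ℤ.* R
  clear-powers U τ K τ′ c t R a b UC ≡.refl ≡.refl = ≡.trans (lemma₁ τ U (P ℤ.^ a) (P ℤ.^ b) P t c)
    (≡.trans (cong (λ x → x ℤ.+ P ℤ.^ a ℤ.* P ℤ.^ b ℤ.* (P ℤ.* (t ℤ.* c ℤ.* U))) UC) (lemma₂ K (P ℤ.^ a) (P ℤ.^ b) (P ℤ.* (t ℤ.* c ℤ.* U))))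
    where
    lemma₁ : ∀ τ U A B P t c → (τ ℤ.+ A ℤ.* B ℤ.* (P ℤ.* t) ℤ.* c) ℤ.* U ≡ U ℤ.* τ ℤ.+ A ℤ.* B ℤ.* (P ℤ.* (t ℤ.* c ℤ.* U))
    lemma₁ = ℤ-solve-∀
    lemma₂ : ∀ K A B x → A ℤ.* (B ℤ.* K) ℤ.+ A ℤ.* B ℤ.* x ≡ (K ℤ.+ x) ℤ.* (A ℤ.* B)
    lemma₂ = ℤ-solve-∀

  -- z is any solution of (n_* + 1) z = n_*! B_{p-1-n_*} mod p.
  quotient~ : ∀ s q v i k →
    let n = suc (suc s) ℕ.+ q ℕ.* suc m ; j = suc (suc k) ; e = n ℕ.+ q in
    n ≡ suc i ℕ.* p ℕ.^ v → suc (suc s) ℕ.+ j ≡ suc m → ¬ p ℕ.∣ suc i → sgn n ≡ 1ℤ →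
    ∀ z → + suc (suc (suc s)) ℤ.* z ≅ + (suc (suc s) !) ℤ.* β j [ P ] →
    ∀ r C′ t c → r ℚ.* ιℚ (+ (n ℕ.* p) ℤ.* (ℤ.- P) ℤ.^ e) ≡ ιℚ C′ →
    C′ ≡ T (ε ^ᵖ (n ℕ.* p)) ℤ.+ P ℤ.^ suc v ℤ.* P ℤ.^ e ℤ.* (P ℤ.* t) ℤ.* c → r ~ z
  quotient~ s q v i k n≡ s+j≡ p∤i sgn-n z z≅ r C′ t c r≡ C′≡ = let
      U , K , p∤U , UC , K≅ = fleck-quotient β εβ≈z s q v i k n≡ s+j≡
      D = + suc i ℤ.* sgn q ℤ.* U
      p∤D = p∤-* (p∤-* (p∤-ℕ p∤i) (p∤-sgn q)) p∤U
      K′ = K ℤ.+ P ℤ.* (t ℤ.* c ℤ.* U)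
      eq : r ℚ.* ιℚ D ≡ ιℚ K′
      eq = fraction-reduce r (+ (n ℕ.* p) ℤ.* (ℤ.- P) ℤ.^ e) C′ U D K′ R (inv (ιℚ R)) (inv-ιℚ R≢0) r≡
        (denominator U) (clear-powers U (T (ε ^ᵖ (n ℕ.* p))) K C′ c t R (suc v) e UC C′≡ ≡.refl)
      z′ , r~z′ , Dz′ = ~-divide {r} {ιℚ K′} {K′} D p∤D eq (~-ιℚ K′)
    in ~-cong (unique D K′ K z′ p∤D Dz′ (t ℤ.* c ℤ.* U , ≡.refl) K≅) r~z′
    where
    n = suc (suc s) ℕ.+ q ℕ.* suc m
    j = suc (suc k)
    e = n ℕ.+ q
    R = P ℤ.^ suc v ℤ.* P ℤ.^ e
    f = + (suc (suc s) !) ℤ.* β j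
    R≢0 : R ≢ 0ℤ
    R≢0 eq = [ P^≢0 (suc v) , P^≢0 e ]′ (ℤ.i*j≡0⇒i≡0∨j≡0 (P ℤ.^ suc v) eq)
    sgn-e : sgn e ≡ sgn q
    sgn-e = ≡.trans (sgn-+ n q) (≡.trans (cong (ℤ._* sgn q) sgn-n) (ℤ.*-identityˡ (sgn q)))
    -- For e = n + q the sign of (-p)^e is (-1)^q, as n is even. The congruence for `K` has the same
    -- sign, and the two cancel in `unique`.
    denominator : ∀ U → + (n ℕ.* p) ℤ.* (ℤ.- P) ℤ.^ e ℤ.* U ≡ + suc i ℤ.* sgn q ℤ.* U ℤ.* R
    denominator U = ≡.trans (cong₂ (λ a b → a ℤ.* b ℤ.* U) np≡ (≡.trans (-^-sgn P e) (cong (ℤ._* P ℤ.^ e) sgn-e)))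
      (lemma (+ suc i) (P ℤ.^ v) P (sgn q) (P ℤ.^ e) U)
      where
      np≡ : + (n ℕ.* p) ≡ + suc i ℤ.* P ℤ.^ v ℤ.* P
      np≡ = ≡.trans (ℤ.pos-* n p) (cong (ℤ._* P)
        (≡.trans (cong (λ a → + a) n≡) (≡.trans (ℤ.pos-* (suc i) (p ℕ.^ v)) (cong (+ suc i ℤ.*_) (^-pos p v)))))
      lemma : ∀ I V P σ E U → I ℤ.* V ℤ.* P ℤ.* (σ ℤ.* E) ℤ.* U ≡ I ℤ.* σ ℤ.* U ℤ.* (P ℤ.* V ℤ.* E)
      lemma = ℤ-solve-∀
    p∤s : p∤ (+ suc (suc (suc s)))
    p∤s = <⇒p∤ (s≤s z≤n) (s≤s (+≡⇒< (suc (suc s)) k s+j≡))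
    unique : ∀ D K′ K z′ → p∤ D → D ℤ.* z′ ≅ K′ [ P ] → K′ ≅ K [ P ] → + suc (suc (suc s)) ℤ.* K ≅ D ℤ.* f [ P ] → z′ ≅ z [ P ]
    unique D K′ K z′ p∤D Dz′ K′≅K K≅ = cancel z′ z p∤s (cancel _ _ p∤D (begin
      D ℤ.* (N ℤ.* z′)  ≈⟨ ≡⇒≈ (swap D N z′) ⟩
      N ℤ.* (D ℤ.* z′)  ≈⟨ *-congˡ {N} (trans Dz′ K′≅K) ⟩
      N ℤ.* K  ≈⟨ K≅ ⟩
      D ℤ.* f  ≈⟨ *-congˡ {D} z≅ ⟨
      D ℤ.* (N ℤ.* z)  ∎))
      where
      open ℤ/p
      N = + suc (suc (suc s))
      swap : ∀ a b c → a ℤ.* (b ℤ.* c) ≡ b ℤ.* (a ℤ.* c)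
      swap = ℤ-solve-∀

sumQuotient fleckQuotient bernoulliQuotient : ℕ → ℕ → ℚ
sumQuotient p n =
  (ℕ→ℚ 2 ℚ.* (Σℤ< n (λ j → (+ ((p ℕ.* n ℕ.∸ 1) C (p ℕ.* suc j ℕ.∸ 1))) ℤ.* sgn (suc j)) ℚ./ 1))
  ℚ.* inv (((ℚ.- ℕ→ℚ p) ^ℤ ⌊ (+ n) ℤ.- (+ 2) / p ℕ.∸ 1 ⌋) ℚ.* ((ℕ→ℚ p ^ℚ suc n) ℚ.* ℕ→ℚ n))
fleckQuotient p n = Fp p (p ℕ.* n) (+ 0) ℚ.* inv (ℕ→ℚ (p ℕ.* n))
bernoulliQuotient p n = (ℕ→ℚ (nstar p n !) ℚ.* inv (ℕ→ℚ (suc (nstar p n)))) ℚ.* bernoulli (p ℕ.∸ 1 ℕ.∸ nstar p n)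

stirlingX stirlingY : ℕ → ℕ → ℕ → ℕ → ℚ
stirlingX p n b m = (ℕ→ℚ 2 ℚ.* inv (ℕ→ℚ (p ℕ.* n))) ℚ.*
  (ℕ→ℚ ((p ℕ.* n ℕ.∸ 1) ! ℕ.* S (m ℕ.* φ (p ℕ.^ b)) (p ℕ.* n ℕ.∸ 1)) ℚ.* inv ((ℚ.- ℕ→ℚ p) ^ℤ ⌊ (+ (p ℕ.* n)) ℤ.- (+ 2) / p ℕ.∸ 1 ⌋))
stirlingY p n b m =
  ℚ.- (ℕ→ℚ ((p ℕ.* n ℕ.∸ 1) ! ℕ.* S (m ℕ.* φ (p ℕ.^ b)) (p ℕ.* n)) ℚ.* inv ((ℚ.- ℕ→ℚ p) ^ℤ ⌊ (+ (p ℕ.* n)) ℤ.- (+ 1) / p ℕ.∸ 1 ⌋))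

-- The conclusion of the theorem as a predicate on n, to be transported along n = n_* + q(p - 1).
Claim : ℕ → ℕ → Set
Claim p n = (sumQuotient p n ≡ fleckQuotient p n) × (fleckQuotient p n ≡ bernoulliQuotient p n [modℚ p ]) ×
  ((b m : ℕ) → 1 ℕ.≤ b → 1 ℕ.≤ m → (+ 2) ℤ.* ⌊ (+ (p ℕ.* n)) ℤ.- (+ 1) / p ℕ.∸ 1 ⌋ ℤ.< + b →
    (stirlingX p n b m ≡ stirlingY p n b m [modℚ p ]) × (stirlingY p n b m ≡ bernoulliQuotient p n [modℚ p ]))

floor≡ : ∀ m r e → r ℕ.< suc m → ⌊ + (r ℕ.+ e ℕ.* suc m) / suc m ⌋ ≡ + e
floor≡ m r e r<l = cong (λ a → + a) (≡.trans (ℕ.+-distrib-/-∣ʳ r (ℕ.n∣m*n e))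
  (cong₂ ℕ._+_ (ℕ.m<n⇒m/n≡0 r<l) (ℕ.m*n/n≡m e (suc m))))

^ℚ-ι : ∀ {q z} → q ≡ ιℚ z → ∀ k → q ^ℚ k ≡ ιℚ (z ℤ.^ k)
^ℚ-ι     e zero    = ιℚ≡/1 1ℤ
^ℚ-ι {z = z} e (suc k) = ≡.trans (cong₂ ℚ._*_ e (^ℚ-ι e k)) (≡.sym (ιℚ-* z (z ℤ.^ k)))

-p≡ι : ∀ p → ℚ.- ℕ→ℚ p ≡ ιℚ (ℤ.- + p)
-p≡ι p = ≡.trans (cong ℚ.-_ (ℕ→ℚ≡ιℚ p)) (≡.sym (ιℚ-neg (+ p)))

^ℤ-ι : ∀ p {x} e → x ≡ + e → (ℚ.- ℕ→ℚ p) ^ℤ x ≡ ιℚ ((ℤ.- + p) ℤ.^ e)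
^ℤ-ι p e ≡.refl = ^ℚ-ι (-p≡ι p) e

-- The data of n: n_* = s + 2, p - 1 - n_* = k + 2, the exact power p^v in n with cofactor i + 1,
-- and n = 2(x + 1).
module Assembly {m : ℕ} (pr : Prime (suc (suc m))) (h : ℕ) (p≡1+2h : suc (suc m) ≡ suc (h ℕ.+ h))
  (s q v i k x : ℕ)
  (n≡ip^v : suc (suc s) ℕ.+ q ℕ.* suc m ≡ suc i ℕ.* suc (suc m) ℕ.^ v)
  (s+j≡l : suc (suc s) ℕ.+ suc (suc k) ≡ suc m)
  (p∤i : ¬ suc (suc m) ℕ.∣ suc i)
  (n≡2x : suc (suc s) ℕ.+ q ℕ.* suc m ≡ suc x ℕ.+ suc x) where

  open Residue pr h p≡1+2h
  open PrimeMod pr using (P; <⇒p∤; 1<p)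
  open Trace pr using (T)
  open Reduction pr
  open BernoulliResidue pr
  open Sums pr h p≡1+2h

  n j l e N : ℕ
  n = suc (suc s) ℕ.+ q ℕ.* suc m
  j = suc (suc k)
  l = suc m
  e = n ℕ.+ q
  N = n ℕ.* p

  W τ : ℤ
  W = (ℤ.- P) ℤ.^ e
  τ = T (ε ^ᵖ N)

  pn≡N : p ℕ.* n ≡ N
  pn≡N = ℕ.*-comm p n

  -- From n = 2(x + 1) and p = 2h + 1 it follows that N = 2J + 2, so that N - 1 has the visibly odd
  -- form required in `Sums`.
  J : ℕ
  J = x ℕ.+ (h ℕ.+ h) ℕ.* suc x

  N≡ : suc (suc (J ℕ.+ J)) ≡ N
  N≡ = ≡.trans (lemma x h) (cong₂ ℕ._*_ (≡.sym n≡2x) (≡.sym p≡1+2h))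
    where
    lemma : ∀ x h → suc (suc (x ℕ.+ (h ℕ.+ h) ℕ.* suc x ℕ.+ (x ℕ.+ (h ℕ.+ h) ℕ.* suc x))) ≡ (suc x ℕ.+ suc x) ℕ.* suc (h ℕ.+ h)
    lemma = ℕ-solve-∀

  sgn-n : sgn n ≡ 1ℤ
  sgn-n = ≡.trans (cong sgn n≡2x) (sgn-even (suc x))

  sgn-N : sgn N ≡ 1ℤ
  sgn-N = ≡.trans (cong sgn (≡.trans (≡.sym N≡) (cong suc (≡.sym (ℕ.+-suc J J))))) (sgn-even (suc J))

  C≡ : Cp p (p ℕ.* n) (+ 0) ≡ τ
  C≡ = ≡.trans (cong (λ a → Cp p a (+ 0)) pn≡N) (≡.sym (≡.trans (T-ε^ N) (≡.trans (cong (ℤ._* Cp p N (+ 0)) sgn-N) (ℤ.*-identityˡ _))))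

  -- Two floors are read off from this form: n_* - 1 and n_* - 2 both lie in the range of remainders
  -- modulo p - 1, so the quotient is e = n + q in either case.
  pn≡ : p ℕ.* n ≡ suc (suc s) ℕ.+ e ℕ.* l
  pn≡ = lemma s q l n ≡.refl
    where
    lemma : ∀ s q l n → n ≡ suc (suc s) ℕ.+ q ℕ.* l → n ℕ.+ l ℕ.* n ≡ suc (suc s) ℕ.+ (n ℕ.+ q) ℕ.* l
    lemma s q l n eq = ≡.trans (cong (ℕ._+ l ℕ.* n) eq) (rearrange s q l n)
      where
      rearrange : ∀ s q l n → suc (suc s) ℕ.+ q ℕ.* l ℕ.+ l ℕ.* n ≡ suc (suc s) ℕ.+ (n ℕ.+ q) ℕ.* l
      rearrange = ℕ-solve-∀

  2+s<l : suc (suc s) ℕ.< l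
  2+s<l = +≡⇒< (suc (suc s)) k s+j≡l

  floor₁ : ⌊ (+ (p ℕ.* n)) ℤ.- (+ 1) / p ℕ.∸ 1 ⌋ ≡ + e
  floor₁ = ≡.trans (cong (λ a → ⌊ (+ a) ℤ.- (+ 1) / l ⌋) pn≡) (floor≡ m (suc s) e (ℕ.<⇒≤ 2+s<l))

  floor₂ : ⌊ (+ (p ℕ.* n)) ℤ.- (+ 2) / p ℕ.∸ 1 ⌋ ≡ + e
  floor₂ = ≡.trans (cong (λ a → ⌊ (+ a) ℤ.- (+ 2) / l ⌋) pn≡) (floor≡ m s e (ℕ.<-trans (ℕ.n<1+n s) (ℕ.<⇒≤ 2+s<l)))

  floor₀ : ⌊ (+ n) ℤ.- (+ 2) / p ℕ.∸ 1 ⌋ ≡ + q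
  floor₀ = floor≡ m s q (ℕ.<-trans (ℕ.n<1+n s) (ℕ.<⇒≤ 2+s<l))

  nstar≡ : nstar p n ≡ suc (suc s)
  nstar≡ = cong suc (≡.trans (ℕ.[m+kn]%n≡m%n (suc s) q l) (ℕ.m<n⇒m%n≡m (ℕ.<⇒≤ 2+s<l)))

  N≢0 : + N ≢ 0ℤ
  N≢0 eq with ≡.trans N≡ (ℤ.+-injective eq)
  ... | ()

  inv-W : inv (ιℚ W) ℚ.* ιℚ W ≡ 1ℚ
  inv-W = inv-ιℚ (-P^≢0 e)

  inv-N : inv (ιℚ (+ N)) ℚ.* ιℚ (+ N) ≡ 1ℚ
  inv-N = inv-ιℚ N≢0

  ℕ→ℚ-pn : ℕ→ℚ (p ℕ.* n) ≡ ιℚ (+ N)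
  ℕ→ℚ-pn = ≡.trans (cong ℕ→ℚ pn≡N) (ℕ→ℚ≡ιℚ N)

  Fp≡ : Fp p (p ℕ.* n) (+ 0) ≡ inv (ιℚ W) ℚ.* ιℚ τ
  Fp≡ = ≡.trans (ℚ.+-identityʳ _) (cong₂ ℚ._*_
    (≡.trans (cong (λ a → (ℚ.- ℕ→ℚ p) ^ℤ (ℤ.- a)) floor₁) (cong inv (^ℚ-ι (-p≡ι p) e)))
    (≡.trans (cong (ℚ._/ 1) C≡) (ιℚ≡/1 τ)))

  fleckQuotient-cleared : fleckQuotient p n ℚ.* ιℚ (+ N ℤ.* W) ≡ ιℚ τ
  fleckQuotient-cleared = ≡.trans (cong (ℚ._* ιℚ (+ N ℤ.* W)) (cong₂ (λ a b → a ℚ.* inv b) Fp≡ ℕ→ℚ-pn))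
    (clear-mid (inv (ιℚ W)) (inv (ιℚ (+ N))) W (+ N) τ inv-W inv-N)

  pn∸1≡ : p ℕ.* n ℕ.∸ 1 ≡ suc (J ℕ.+ J)
  pn∸1≡ = cong (ℕ._∸ 1) (≡.trans pn≡N (≡.sym N≡))

  τ≡-2T : τ ≡ ℤ.- (+ 2 ℤ.* T (ε ^ᵖ suc (J ℕ.+ J)))
  τ≡-2T = ≡.trans (≡.sym C≡) (≡.trans (cong (λ a → Cp p a (+ 0)) (≡.trans pn≡N (≡.sym N≡))) (Cp≡-2T J n N≡))

  Z : ℤ
  Z = Σℤ< n (λ j → (+ (suc (J ℕ.+ J) C (p ℕ.* suc j ℕ.∸ 1))) ℤ.* sgn (suc j))

  2Z≡τ : + 2 ℤ.* Z ≡ τ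
  2Z≡τ = ≡.trans (cong (+ 2 ℤ.*_) (≡.sym (T-X≡Σ J n N≡))) (≡.sym (≡.trans τ≡-2T
    (≡.trans (cong (λ a → ℤ.- (+ 2 ℤ.* a)) (T-X-ε^ J n N≡)) (lemma (T (X ⊠ ε ^ᵖ suc (J ℕ.+ J)))))))
    where
    lemma : ∀ a → ℤ.- (+ 2 ℤ.* ℤ.- a) ≡ + 2 ℤ.* a
    lemma = ℤ-solve-∀

  V : ℤ
  V = (ℤ.- P) ℤ.^ q ℤ.* (P ℤ.^ suc n ℤ.* + n)

  -- As n is even, p^n equals (-p)^n and merges with (-p)^q into W.
  V≡ : V ≡ + N ℤ.* W
  V≡ = begin
    (ℤ.- P) ℤ.^ q ℤ.* (P ℤ.* P ℤ.^ n ℤ.* + n)  ≡⟨ lemma ((ℤ.- P) ℤ.^ q) P (P ℤ.^ n) (+ n) ⟩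
    + n ℤ.* P ℤ.* (P ℤ.^ n ℤ.* (ℤ.- P) ℤ.^ q)
      ≡⟨ cong₂ (λ a b → a ℤ.* (b ℤ.* (ℤ.- P) ℤ.^ q)) (≡.sym (ℤ.pos-* n p)) (≡.sym (≡.trans (-^-sgn P n)
           (≡.trans (cong (ℤ._* P ℤ.^ n) sgn-n) (ℤ.*-identityˡ (P ℤ.^ n))))) ⟩
    + N ℤ.* ((ℤ.- P) ℤ.^ n ℤ.* (ℤ.- P) ℤ.^ q)  ≡⟨ cong (+ N ℤ.*_) (ℤ.^-distribˡ-+-* (ℤ.- P) n q) ⟨
    + N ℤ.* W  ∎
    where
    open ≡-Reasoning
    lemma : ∀ a p b n → a ℤ.* (p ℤ.* b ℤ.* n) ≡ n ℤ.* p ℤ.* (b ℤ.* a)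
    lemma = ℤ-solve-∀

  NW≢0 : + N ℤ.* W ≢ 0ℤ
  NW≢0 eq = [ N≢0 , -P^≢0 e ]′ (ℤ.i*j≡0⇒i≡0∨j≡0 (+ N) eq)

  sumQuotient≡ : sumQuotient p n ≡ ιℚ (+ 2) ℚ.* ιℚ Z ℚ.* inv (ιℚ V)
  sumQuotient≡ = cong₂ (λ a b → a ℚ.* inv b)
    (cong₂ ℚ._*_ (ℕ→ℚ≡ιℚ 2) (≡.trans (cong (λ M → Σℤ< n (λ j → (+ (M C (p ℕ.* suc j ℕ.∸ 1))) ℤ.* sgn (suc j)) ℚ./ 1) pn∸1≡) (ιℚ≡/1 Z)))
    (≡.trans (cong₂ ℚ._*_ (^ℤ-ι p q floor₀)
      (≡.trans (cong₂ ℚ._*_ (^ℚ-ι (ℕ→ℚ≡ιℚ p) (suc n)) (ℕ→ℚ≡ιℚ n)) (≡.sym (ιℚ-* (P ℤ.^ suc n) (+ n)))))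
      (≡.sym (ιℚ-* ((ℤ.- P) ℤ.^ q) (P ℤ.^ suc n ℤ.* + n))))

  sumQuotient≡fleckQuotient : sumQuotient p n ≡ fleckQuotient p n
  sumQuotient≡fleckQuotient =
    fraction-cancel (sumQuotient p n) (fleckQuotient p n) (inv (ιℚ (+ N ℤ.* W))) (+ N ℤ.* W) (inv-ιℚ NW≢0) (≡.trans
    (≡.trans (cong (λ a → a ℚ.* ιℚ (+ N ℤ.* W)) sumQuotient≡) (≡.trans (cong (λ a → ιℚ (+ 2) ℚ.* ιℚ Z ℚ.* inv (ιℚ a) ℚ.* ιℚ (+ N ℤ.* W)) V≡)
      (≡.trans (clear-lhs (inv (ιℚ (+ N ℤ.* W))) (+ N ℤ.* W) (+ 2) Z (inv-ιℚ NW≢0)) (cong ιℚ 2Z≡τ))))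
    (≡.sym fleckQuotient-cleared))

  bernoulliQuotient≡ : bernoulliQuotient p n ≡ ιℚ (+ (suc (suc s) !)) ℚ.* inv (ιℚ (+ suc (suc (suc s)))) ℚ.* bernoulli j
  bernoulliQuotient≡ = ≡.trans (cong (λ a → (ℕ→ℚ (a !) ℚ.* inv (ℕ→ℚ (suc a))) ℚ.* bernoulli (l ℕ.∸ a)) nstar≡)
    (cong₂ ℚ._*_ (cong₂ (λ a b → a ℚ.* inv b) (ℕ→ℚ≡ιℚ (suc (suc s) !)) (ℕ→ℚ≡ιℚ (suc (suc (suc s)))))
      (cong bernoulli (≡.trans (cong (ℕ._∸ suc (suc s)) (≡.sym s+j≡l)) (ℕ.m+n∸m≡n (suc (suc s)) j))))

  -- The residue with which all quotients are compared. It is obtained on the Bernoulli side, where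
  -- the only division is by n_* + 1 < p.
  reference : Σ ℤ λ z → bernoulliQuotient p n ~ z × + suc (suc (suc s)) ℤ.* z ≅ + (suc (suc s) !) ℤ.* β j [ P ]
  reference = ~-divide {q = bernoulliQuotient p n} (+ suc (suc (suc s))) (<⇒p∤ (s≤s z≤n) (s≤s 2+s<l))
    (≡.trans (cong (ℚ._* ιℚ (+ suc (suc (suc s)))) bernoulliQuotient≡)
      (clear-rhs (inv (ιℚ (+ suc (suc (suc s))))) (ιℚ (+ (suc (suc s) !))) (+ suc (suc (suc s))) (bernoulli j)
        (inv-ιℚ {+ suc (suc (suc s))} (λ ()))))
    (~-* (~-ιℚ (+ (suc (suc s) !))) (bernoulli~β j j<p))
    where
    j<p : suc j ℕ.< p
    j<p = s≤s (ℕ.≤-trans (ℕ.m≤n+m (suc j) (suc s)) (ℕ.≤-reflexive (≡.trans (ℕ.+-suc (suc s) j) s+j≡l)))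

  z : ℤ
  z = proj₁ reference

  bernoulliQuotient~ : bernoulliQuotient p n ~ z
  bernoulliQuotient~ = proj₁ (proj₂ reference)

  quotient~z : ∀ r C′ t c → r ℚ.* ιℚ (+ N ℤ.* W) ≡ ιℚ C′ → C′ ≡ τ ℤ.+ P ℤ.^ suc v ℤ.* P ℤ.^ e ℤ.* (P ℤ.* t) ℤ.* c → r ~ z
  quotient~z = quotient~ s q v i k n≡ip^v s+j≡l p∤i sgn-n z (proj₂ (proj₂ reference))

  fleckQuotient~ : fleckQuotient p n ~ z
  fleckQuotient~ = quotient~z (fleckQuotient p n) τ 0ℤ 0ℤ fleckQuotient-cleared (lemma τ (P ℤ.^ suc v ℤ.* P ℤ.^ e) P)
    where
    lemma : ∀ a b p → a ≡ a ℤ.+ b ℤ.* (p ℤ.* 0ℤ) ℤ.* 0ℤ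
    lemma = ℤ-solve-∀

  module _ (b′ m′ : ℕ) (1≤m′ : 1 ℕ.≤ m′) where
    private
      b₀ b M : ℕ
      b₀ = v ℕ.+ e ℕ.+ suc b′
      b = suc b₀
      M = m′ ℕ.* φ (p ℕ.^ b)
      B : ℤ
      B = P ℤ.^ b

    B≡ : B ≡ P ℤ.^ suc v ℤ.* P ℤ.^ e ℤ.* (P ℤ.* P ℤ.^ b′)
    B≡ = ≡.trans (ℤ.^-distribˡ-+-* P (suc v ℕ.+ e) (suc b′)) (cong (ℤ._* (P ℤ.* P ℤ.^ b′)) (ℤ.^-distribˡ-+-* P (suc v) e))

    congruent : ∀ r C′ → r ℚ.* ιℚ (+ N ℤ.* W) ≡ ιℚ C′ → C′ ≅ τ [ B ] → r ~ z
    congruent r C′ r≡ (c , eq) = quotient~z r C′ (P ℤ.^ b′) c r≡ (≡.trans eq (cong (λ a → τ ℤ.+ a ℤ.* c) B≡))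

    aX aY : ℕ
    aX = (p ℕ.* n ℕ.∸ 1) ! ℕ.* S M (p ℕ.* n ℕ.∸ 1)
    aY = (p ℕ.* n ℕ.∸ 1) ! ℕ.* S M (p ℕ.* n)

    Y≡ : stirlingY p n b m′ ≡ ℚ.- (ιℚ (+ aY) ℚ.* inv (ιℚ W))
    Y≡ = cong ℚ.-_ (cong₂ (λ a b → a ℚ.* inv b) (ℕ→ℚ≡ιℚ aY) (^ℤ-ι p e floor₁))

    X≡ : stirlingX p n b m′ ≡ ιℚ (+ 2) ℚ.* inv (ιℚ (+ N)) ℚ.* (ιℚ (+ aX) ℚ.* inv (ιℚ W))
    X≡ = cong₂ ℚ._*_ (cong₂ (λ a b → a ℚ.* inv b) (ℕ→ℚ≡ιℚ 2) ℕ→ℚ-pn)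
      (cong₂ (λ a b → a ℚ.* inv b) (ℕ→ℚ≡ιℚ aX) (^ℤ-ι p e floor₂))

    aY≅ : ℤ.- (+ N ℤ.* + aY) ≅ τ [ B ]
    aY≅ = Mod.≅-trans B (Mod.≡⇒≅ B (cong ℤ.-_ (≡.trans (≡.sym (ℤ.pos-* N aY)) (cong (λ a → + a) factorial))))
      (Mod.≅-sym B (subst (λ a → T (ε ^ᵖ a) ≅ ℤ.- (+ (a ! ℕ.* S M a)) [ B ]) N≡ (T-stirling b₀ m′ (suc (J ℕ.+ J)) 1≤m′)))
      where
      factorial : N ℕ.* aY ≡ N ! ℕ.* S M N
      factorial = begin
        N ℕ.* aY  ≡⟨ cong (λ a → N ℕ.* ((a ℕ.∸ 1) ! ℕ.* S M a)) pn≡N ⟩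
        N ℕ.* ((N ℕ.∸ 1) ! ℕ.* S M N)  ≡⟨ cong (λ a → a ℕ.* ((a ℕ.∸ 1) ! ℕ.* S M a)) N≡ ⟨
        N′ ℕ.* (suc (J ℕ.+ J) ! ℕ.* S M N′)  ≡⟨ ℕ.*-assoc N′ (suc (J ℕ.+ J) !) (S M N′) ⟨
        N′ ! ℕ.* S M N′  ≡⟨ cong (λ a → a ! ℕ.* S M a) N≡ ⟩
        N ! ℕ.* S M N  ∎
        where
        open ≡-Reasoning
        N′ = suc (suc (J ℕ.+ J))

    -- `T-stirling` is used for the exponent N - 1, and τ = -2 T((x - 1)^(N-1)) supplies the factor
    -- 2.
    aX≅ : + 2 ℤ.* + aX ≅ τ [ B ]
    aX≅ = subst₂ (λ a b → + 2 ℤ.* + (a ! ℕ.* S M a) ≅ b [ B ]) (≡.sym pn∸1≡) (≡.sym τ≡-2T)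
      (Mod.≅-trans B (Mod.≡⇒≅ B (lemma (+ (suc (J ℕ.+ J) ! ℕ.* S M (suc (J ℕ.+ J))))))
        (Mod.neg-cong B (Mod.*-cong B (Mod.≅-refl B {+ 2}) (Mod.≅-sym B (T-stirling b₀ m′ (J ℕ.+ J) 1≤m′)))))
      where
      lemma : ∀ a → + 2 ℤ.* a ≡ ℤ.- (+ 2 ℤ.* ℤ.- a)
      lemma = ℤ-solve-∀

    Y~ : stirlingY p n b m′ ~ z
    Y~ = congruent (stirlingY p n b m′) (ℤ.- (+ N ℤ.* + aY))
      (≡.trans (cong (λ a → a ℚ.* ιℚ (+ N ℤ.* W)) Y≡) (clear-Y (inv (ιℚ W)) W (+ N) (+ aY) inv-W)) aY≅

    X~ : stirlingX p n b m′ ~ z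
    X~ = congruent (stirlingX p n b m′) (+ 2 ℤ.* + aX)
      (≡.trans (cong (λ a → a ℚ.* ιℚ (+ N ℤ.* W)) X≡) (clear-X (inv (ιℚ W)) (inv (ιℚ (+ N))) W (+ N) (+ 2) (+ aX) inv-W inv-N)) aX≅

  v<e : suc v ℕ.≤ e
  v<e = ℕ.≤-trans (n<p^n v) (ℕ.≤-trans (ℕ.m≤n*m (p ℕ.^ v) (suc i)) (ℕ.≤-trans (ℕ.≤-reflexive (≡.sym n≡ip^v)) (ℕ.m≤m+n n q)))

  -- The denominator N W contains p exactly v + 1 + e times, so congruences modulo p^(v+e+2) are
  -- called for. The hypothesis b > 2e provides them, as v < p^v ≤ n ≤ e.
  precision : ∀ b → (+ 2) ℤ.* ⌊ (+ (p ℕ.* n)) ℤ.- (+ 1) / p ℕ.∸ 1 ⌋ ℤ.< + b → Σ ℕ λ b′ → b ≡ suc (v ℕ.+ e ℕ.+ suc b′)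
  precision b lt = b ℕ.∸ suc (suc v ℕ.+ e) , ≡.sym (≡.trans (ℕ.+-suc (suc v ℕ.+ e) _) (ℕ.m+[n∸m]≡n enough))
    where
    2e<b : 2 ℕ.* e ℕ.< b
    2e<b = ℤ.drop‿+<+ (subst (ℤ._< + b) (≡.trans (cong (+ 2 ℤ.*_) floor₁) (≡.sym (ℤ.pos-* 2 e))) lt)
    enough : suc (suc v ℕ.+ e) ℕ.≤ b
    enough = ℕ.≤-trans (s≤s (ℕ.≤-trans (ℕ.+-monoˡ-≤ e v<e) (ℕ.≤-reflexive (cong (e ℕ.+_) (≡.sym (ℕ.+-identityʳ e)))))) 2e<b

  claim : Claim p n
  claim = sumQuotient≡fleckQuotient , ~⇒≡ fleckQuotient~ bernoulliQuotient~ , λ b m′ _ 1≤m′ lt → let b′ , b≡ = precision b lt in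
    subst (λ b → (stirlingX p n b m′ ≡ stirlingY p n b m′ [modℚ p ]) × (stirlingY p n b m′ ≡ bernoulliQuotient p n [modℚ p ])) (≡.sym b≡)
      (~⇒≡ (X~ b′ m′ 1≤m′) (Y~ b′ m′ 1≤m′) , ~⇒≡ (Y~ b′ m′ 1≤m′) bernoulliQuotient~)

-- Parity, valuation and the decomposition of n

parity : ∀ n → Σ ℕ λ h → n ≡ h ℕ.+ h ⊎ n ≡ suc (h ℕ.+ h)
parity zero    = 0 , inj₁ ≡.refl
parity (suc n) with parity n
... | h , inj₁ e = h , inj₂ (cong suc e)
... | h , inj₂ e = suc h , inj₁ (cong suc (≡.trans e (≡.sym (ℕ.+-suc h h))))

odd-prime : ∀ {p} → Prime p → p ≢ 2 → Σ ℕ λ h → p ≡ suc (h ℕ.+ h)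
odd-prime {p} pr p≢2 with parity p
... | h , inj₂ e = h , e
... | h , inj₁ e with prime⇒irreducible pr (ℕ.divides h (≡.trans e (lemma h)))
  where
  lemma : ∀ h → h ℕ.+ h ≡ h ℕ.* 2
  lemma = ℕ-solve-∀
...   | inj₁ ()
...   | inj₂ 2≡p = ⊥-elim (p≢2 (≡.sym 2≡p))

even-suc : ∀ {x} → 0 ℕ.< x → 2 ∣ x → Σ ℕ λ y → x ≡ suc (suc y)
even-suc {suc zero}    _ d with ℕ.∣1⇒≡1 d
... | ()
even-suc {suc (suc y)} _ _ = y , ≡.refl

valuation : ∀ p → 1 ℕ.< p → ∀ n → 0 ℕ.< n → Σ ℕ λ v → Σ ℕ λ i → n ≡ suc i ℕ.* p ℕ.^ v × ¬ p ∣ suc i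
valuation p 1<p = <-rec _ go
  where
  go : ∀ n → (∀ {m} → m ℕ.< n → 0 ℕ.< m → Σ ℕ λ v → Σ ℕ λ i → m ≡ suc i ℕ.* p ℕ.^ v × ¬ p ∣ suc i) →
    0 ℕ.< n → Σ ℕ λ v → Σ ℕ λ i → n ≡ suc i ℕ.* p ℕ.^ v × ¬ p ∣ suc i
  go (suc n) rec _ with p ℕ.∣? suc n
  ... | no  p∤n = 0 , n , ≡.sym (ℕ.*-identityʳ (suc n)) , p∤n
  ... | yes (ℕ.divides (suc c) e) with rec (ℕ.≤-trans (ℕ.m<m*n (suc c) p 1<p) (ℕ.≤-reflexive (≡.sym e))) (s≤s z≤n)
  ...   | v , i , e′ , p∤i = suc v , i , ≡.trans e (≡.trans (cong (ℕ._* p) e′) (lemma (suc i) p (p ℕ.^ v))) , p∤i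
    where
    lemma : ∀ i p q → i ℕ.* q ℕ.* p ≡ i ℕ.* (p ℕ.* q)
    lemma = ℕ-solve-∀

theorem1p2 : (p : ℕ) → Prime p → p ≢ 2 →
    (n : ℕ) → 1 ℕ.≤ n → 2 ∣ n → ¬ (p ℕ.∸ 1 ∣ n) →
    let P = p ℕ.* n
        mp = ℚ.- ℕ→ℚ p
        ns = nstar p n
        rhs = (ℕ→ℚ (ns !) ℚ.* inv (ℕ→ℚ (suc ns))) ℚ.* bernoulli (p ℕ.∸ 1 ℕ.∸ ns)
        lhs = (ℕ→ℚ 2 ℚ.* (Σℤ< n (λ j → (+ ((P ℕ.∸ 1) C (p ℕ.* suc j ℕ.∸ 1))) ℤ.* sgn (suc j)) ℚ./ 1))
              ℚ.* inv ((mp ^ℤ ⌊ (+ n) ℤ.- (+ 2) / p ℕ.∸ 1 ⌋) ℚ.* ((ℕ→ℚ p ^ℚ suc n) ℚ.* ℕ→ℚ n))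
        mid = Fp p P (+ 0) ℚ.* inv (ℕ→ℚ P)
    in (lhs ≡ mid) × (mid ≡ rhs [modℚ p ]) ×
       ((b m : ℕ) → 1 ℕ.≤ b → 1 ℕ.≤ m →
          (+ 2) ℤ.* ⌊ (+ P) ℤ.- (+ 1) / p ℕ.∸ 1 ⌋ ℤ.< + b →
          let N = m ℕ.* φ (p ℕ.^ b)
              X = (ℕ→ℚ 2 ℚ.* inv (ℕ→ℚ P)) ℚ.*
                  (ℕ→ℚ ((P ℕ.∸ 1) ! ℕ.* S N (P ℕ.∸ 1)) ℚ.* inv (mp ^ℤ ⌊ (+ P) ℤ.- (+ 2) / p ℕ.∸ 1 ⌋))
              Y = ℚ.- (ℕ→ℚ ((P ℕ.∸ 1) ! ℕ.* S N P) ℚ.* inv (mp ^ℤ ⌊ (+ P) ℤ.- (+ 1) / p ℕ.∸ 1 ⌋))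
          in (X ≡ Y [modℚ p ]) × (Y ≡ rhs [modℚ p ]))
theorem1p2 0 pr = ⊥-elim (ℕ.NonTrivial.nonTrivial (prime⇒nonTrivial pr))
theorem1p2 1 pr = ⊥-elim (ℕ.NonTrivial.nonTrivial (prime⇒nonTrivial pr))
theorem1p2 (suc (suc m)) pr p≢2 (suc n′) _ 2∣n l∤n = subst (Claim p) (≡.sym n≡s+ql)
  (Assembly.claim pr h p≡1+2h s₀ q v i k x
    (≡.trans (≡.sym n≡s+ql) n≡ip^v) s+j≡l p∤i (≡.trans (≡.sym n≡s+ql) n≡2x))
  where
  p = suc (suc m)
  l = suc m
  n = suc n′
  h = proj₁ (odd-prime pr p≢2)
  p≡1+2h = proj₂ (odd-prime pr p≢2)
  -- Dividing n - 1 and not n by p - 1 puts s into the range from 1 to p - 1, where it is n_*.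
  q = n′ ℕ./ l
  s = suc (n′ ℕ.% l)
  n≡ : n ≡ s ℕ.+ q ℕ.* l
  n≡ = cong suc (ℕ.m≡m%n+[m/n]*n n′ l)
  2∣l : 2 ∣ l
  2∣l = ℕ.divides h (≡.trans (ℕ.suc-injective p≡1+2h) (lemma h))
    where
    lemma : ∀ h → h ℕ.+ h ≡ h ℕ.* 2
    lemma = ℕ-solve-∀
  2∣s : 2 ∣ s
  2∣s = ℕ.∣m+n∣m⇒∣n (subst (2 ∣_) (≡.trans n≡ (ℕ.+-comm s (q ℕ.* l))) 2∣n) (ℕ.∣n⇒∣m*n q 2∣l)
  -- Here the hypothesis that p - 1 does not divide n enters: it excludes n_* = p - 1.
  s<l : s ℕ.< l
  s<l = ℕ.≤∧≢⇒< (ℕ.m%n<n n′ l) (λ s≡l → l∤n (ℕ.divides (suc q) (≡.trans n≡ (cong (ℕ._+ q ℕ.* l) s≡l))))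
  -- Both n_* and p - 1 - n_* are positive and even, hence at least 2.
  s₀ = proj₁ (even-suc (s≤s z≤n) 2∣s)
  s≡ : s ≡ suc (suc s₀)
  s≡ = proj₂ (even-suc (s≤s z≤n) 2∣s)
  complement : Σ ℕ λ k → l ℕ.∸ s ≡ suc (suc k)
  complement = even-suc (ℕ.m<n⇒0<n∸m s<l) (ℕ.∣m+n∣m⇒∣n (subst (2 ∣_) (≡.sym (ℕ.m+[n∸m]≡n (ℕ.<⇒≤ s<l))) 2∣l) 2∣s)
  k = proj₁ complement
  s+j≡l : suc (suc s₀) ℕ.+ suc (suc k) ≡ l
  s+j≡l = ≡.trans (cong₂ ℕ._+_ (≡.sym s≡) (≡.sym (proj₂ complement))) (ℕ.m+[n∸m]≡n (ℕ.<⇒≤ s<l))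
  n≡s+ql : n ≡ suc (suc s₀) ℕ.+ q ℕ.* l
  n≡s+ql = ≡.trans n≡ (cong (ℕ._+ q ℕ.* l) s≡)
  decomposition = valuation p (s≤s (s≤s z≤n)) n (s≤s z≤n)
  v = proj₁ decomposition
  i = proj₁ (proj₂ decomposition)
  n≡ip^v : n ≡ suc i ℕ.* p ℕ.^ v
  n≡ip^v = proj₁ (proj₂ (proj₂ decomposition))
  p∤i : ¬ p ∣ suc i
  p∤i = proj₂ (proj₂ (proj₂ decomposition))
  half : ∀ {n} → 0 ℕ.< n → 2 ∣ n → Σ ℕ λ x → n ≡ suc x ℕ.+ suc x
  half _ (ℕ.divides (suc x) e) = x , ≡.trans e (lemma x)
    where
    lemma : ∀ x → suc x ℕ.* 2 ≡ suc x ℕ.+ suc x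
    lemma = ℕ-solve-∀
  half 0<n (ℕ.divides zero ≡.refl) = ⊥-elim (ℕ.<⇒≢ 0<n ≡.refl)
  x = proj₁ (half (s≤s z≤n) 2∣n)
  n≡2x : n ≡ suc x ℕ.+ suc x
  n≡2x = proj₂ (half (s≤s z≤n) 2∣n)
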